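{- Let $k\ge 2$ be an integer and let $G$ be a 2-connected non-Hamiltonian graph on $n$ vertices with $c(G)\le 2k+1$. If every vertex of $G$, except for at most one vertex, has degree at least $k$, then $G$ is a subgraph of one of the following graphs: (i) $H(2k+1,2k+1,k)$ (this case occurs with $n=2k+1$), or $H(n,2k+2,k)$ with $n\ge 2k+2$; (ii) $F(s,t,k)$ with $s\ge 1$, $t\ge 1$, or $F_1(t,k)$ with $t\ge 1$; (iii) when $k=3$: $K_2+M_t$ with $t\ge 6$, or $K_2+(S_s\cup M_t)$ with $s+t\ge 6$; when $k=4$: $K_3+M_t$ with $t\ge 7$.
   Context: All graphs are finite, simple and undirected. $c(G)$ (the circumference) is the length of a longest cycle in $G$. For graphs $G,H$, $G\cup H$ is their vertex-disjoint union, $G+H$ is obtained from $G\cup H$ by joining every vertex of $G$ to every vertex of $H$, and $kH$ is the disjoint union of $k$ copies of $H$. $K_m$ is the complete graph on $m$ vertices. $H(n,\ell,a)$: the $n$-vertex graph with vertex partition $A\cup B\cup C$, $|A|=a$, $|B|=n-\ell+a$, $|C|=\ell-2a$, whose edges are all pairs between $A$ and $B$ and all pairs inside $A\cup C$ (so $A\cup C$ is a clique and $B$ is independent). $F_1(t,k)=K_2+(tK_{k-1}\cup K_k\cup K_1)$. $F(s,t,k)$: take vertex-disjoint graphs $K_3$ with vertex set $\{x,y,z\}$, $sK_{k-1}\cup K_1$, and $tK_{k-1}$; join $x$ and $z$ to every vertex of $sK_{k-1}\cup K_1$, and join $y$ and $z$ to every vertex of $tK_{k-1}$. $S_s=K_{1,s-1}$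 is the star on $s$ vertices; $M_t$ is the graph on $t$ vertices consisting of a matching with $\lfloor t/2\rfloor$ edges plus one isolated vertex if $t$ is odd. -}

module Defs where

open import Data.Nat using (ℕ; zero; suc; _+_; _*_; _∸_; _≤_; _/_; _%_)
open import Data.Fin using (Fin; zero; suc; toℕ)
open import Data.Bool using (Bool; true; false)
open import Data.List using (length; filterᵇ; allFin)
open import Data.Product using (Σ; _×_; _,_)
open import Data.Sum using (_⊎_; inj₁; inj₂)
open import Data.Unit using (⊤)
open import Data.Empty using (⊥)
open import Relation.Nullary using (¬_)
open import Relation.Binary.PropositionalEquality using (_≡_; _≢_)
open import Function.Definitions using (Injective)

record Graph (n : ℕ) : Set where
  field
    adj    : Fin n → Fin n → Bool
    sym    : ∀ i j → adj i j ≡ adj j i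
    irrefl : ∀ i → adj i i ≡ false

open Graph public

Adj : ∀ {n} → Graph n → Fin n → Fin n → Set
Adj G u v = adj G u v ≡ true

degree : ∀ {n} → Graph n → Fin n → ℕ
degree {n} G v = length (filterᵇ (adj G v) (allFin n))

HasCycle : ∀ {n} → Graph n → ℕ → Set
HasCycle {n} G m =
  3 ≤ m ×
  Σ (Fin m → Fin n) λ f →
    Injective _≡_ _≡_ f ×
    (∀ i j → suc (toℕ i) ≡ toℕ j → Adj G (f i) (f j)) ×
    (∀ i j → suc (toℕ i) ≡ m → toℕ j ≡ 0 → Adj G (f i) (f j))

CircumferenceAtMost : ∀ {n} → Graph n → ℕ → Set
CircumferenceAtMost G c = ∀ m → HasCycle G m → m ≤ c

Hamiltonian : ∀ {n} → Graph n → Set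
Hamiltonian {n} G = HasCycle G n

data Walk {n} (G : Graph n) (P : Fin n → Set) : Fin n → Fin n → Set where
  here : ∀ {u} → P u → Walk G P u u
  step : ∀ {u w v} → P u → Adj G u w → Walk G P w v → Walk G P u v

TwoConnected : ∀ {n} → Graph n → Set
TwoConnected {n} G =
  3 ≤ n ×
  (∀ u v → Walk G (λ _ → ⊤) u v) ×
  (∀ x u v → u ≢ x → v ≢ x → Walk G (λ w → w ≢ x) u v)

record UGraph : Set₁ where
  field
    V : Set
    E : V → V → Set

open UGraph public

_⊆_ : ∀ {n} → Graph n → UGraph → Set
_⊆_ {n} G H = Σ (Fin n → V H) λ f →
  Injective _≡_ _≡_ f × (∀ u v → Adj G u v → E H (f u) (f v))

K : ℕ → UGraph
K m = record { V = Fin m ; E = λ i j → i ≢ j }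

Ē : ℕ → UGraph
Ē m = record { V = Fin m ; E = λ _ _ → ⊥ }

_∪_ : UGraph → UGraph → UGraph
G ∪ H = record { V = V G ⊎ V H ; E = e }
  where
  e : V G ⊎ V H → V G ⊎ V H → Set
  e (inj₁ a) (inj₁ b) = E G a b
  e (inj₂ a) (inj₂ b) = E H a b
  e _ _ = ⊥

_⊹_ : UGraph → UGraph → UGraph
G ⊹ H = record { V = V G ⊎ V H ; E = e }
  where
  e : V G ⊎ V H → V G ⊎ V H → Set
  e (inj₁ a) (inj₁ b) = E G a b
  e (inj₂ a) (inj₂ b) = E H a b
  e _ _ = ⊤

_·_ : ℕ → UGraph → UGraph
k · H = record { V = Fin k × V H ; E = λ { (i , a) (j , b) → i ≡ j × E H a b } }

infixr 5 _∪_
infixr 4 _⊹_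
infixr 6 _·_

data HV (a b c : ℕ) : Set where
  vA : Fin a → HV a b c
  vB : Fin b → HV a b c
  vC : Fin c → HV a b c

HE : ∀ {a b c} → HV a b c → HV a b c → Set
HE (vA i) (vA j) = i ≢ j
HE (vA _) (vB _) = ⊤
HE (vB _) (vA _) = ⊤
HE (vA _) (vC _) = ⊤
HE (vC _) (vA _) = ⊤
HE (vC i) (vC j) = i ≢ j
HE _ _ = ⊥

Hgraph : ℕ → ℕ → ℕ → UGraph
Hgraph n ℓ a = record { V = HV a (n ∸ ℓ + a) (ℓ ∸ 2 * a) ; E = HE }

F₁ : ℕ → ℕ → UGraph
F₁ t k = K 2 ⊹ (t · K (k ∸ 1) ∪ K k ∪ K 1)

data FV (X Y : Set) : Set where
  vx vy vz : FV X Y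
  inX : X → FV X Y
  inY : Y → FV X Y

FE : (GX GY : UGraph) → FV (V GX) (V GY) → FV (V GX) (V GY) → Set
FE GX GY vx vy = ⊤
FE GX GY vx vz = ⊤
FE GX GY vy vx = ⊤
FE GX GY vy vz = ⊤
FE GX GY vz vx = ⊤
FE GX GY vz vy = ⊤
FE GX GY vx (inX _) = ⊤
FE GX GY vz (inX _) = ⊤
FE GX GY (inX _) vx = ⊤
FE GX GY (inX _) vz = ⊤
FE GX GY vy (inY _) = ⊤
FE GX GY vz (inY _) = ⊤
FE GX GY (inY _) vy = ⊤
FE GX GY (inY _) vz = ⊤
FE GX GY (inX a) (inX b) = E GX a b
FE GX GY (inY a) (inY b) = E GY a b
FE GX GY _ _ = ⊥

Fgraph : ℕ → ℕ → ℕ → UGraph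
Fgraph s t k = record { V = FV (V GX) (V GY) ; E = FE GX GY }
  where
  GX = s · K (k ∸ 1) ∪ K 1
  GY = t · K (k ∸ 1)

S : ℕ → UGraph
S s = Ē 1 ⊹ Ē (s ∸ 1)

M : ℕ → UGraph
M t = (t / 2) · K 2 ∪ Ē (t % 2)

{-# OPTIONS --safe #-}
module Submission where

-- Let w be the only vertex that may have degree below k, and let L be a longest cycle *through w*. Rerouting an arc of L
-- that avoids w cannot lengthen L, and an arc containing w may be replaced as long as the resulting cycle respects the
-- bound 2k+1, so the usual counting of the gaps between the neighbours of an off-cycle path works with 2k+1. It shows that
-- every component of G - L is a clique on p+1 vertices, all of them with the same s = k - p neighbours on L, and that
-- (s-2)p ≤ 1. Thus p = 0, s = 2, or (s,p) = (3,1). If p = 0 then L nearly alternates between the neighbours of the outer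
-- vertex and single gaps, which gives H or, for k = 3, K₂ + (S ∪ M); if s = 2 then all components have the same
-- neighbours on L, or there are just two such pairs {x,z} and {y,z}, which gives F₁ or F; and (s,p) = (3,1) forces k = 4
-- and gives K₃ + M.

-- A vertex of unknown degree outside the cycle would spoil the counting there, which is why `w` is
-- forced onto the cycle. The price is that a rerouted cycle may lose `w`, and then it cannot be
-- compared with `L`. What saves the argument is that `w` cannot be everywhere: it misses one of two
-- complementary arcs (`detour-short`), and it lies on at least one of two cycles that cover `L`
-- (`two-cycles`). So each of the two available bounds, `length L` and `2 * k + 1`, is used once,
-- and only their sum enters. The summand 1 disappears by parity where a count is even (`half`);
-- elsewhere it survives as one spare vertex, and this vertex is the origin of the exceptional
-- shapes: the second vertex of the only double gap, the arc with `k` vertices that becomes `K k` in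
-- `F₁`, the shift between the two pairs in `F`, the pair (3,1). Moreover a longest path outside `L`
-- need not end at vertices with neighbours on `L`, so paths hanging off `L` at one end have to be
-- bounded before any counting (`feeler-short`); this takes a fan.

open import Defs hiding (sym)
open import Data.Bool using (Bool; true; false; if_then_else_; T)
open import Data.Bool.Properties using (T-≡)
import Data.Bool.Properties as Bool
open import Data.Empty using (⊥; ⊥-elim)
open import Data.Fin using (Fin; zero; suc; toℕ; fromℕ<)
open import Data.Fin.Properties using (_≟_; any?; all?; toℕ-fromℕ<)
open import Data.List using (List; []; _∷_; _++_; length; reverse; map; filter; allFin; lookup)
open import Data.List.Properties using (++-assoc; ++-identityʳ; length-++; length-reverse; unfold-reverse; length-map; map-++; length-tabulate; filter-≐; ∷-injectiveˡ; ∷-injectiveʳ; ∷ʳ-injective)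
open import Data.List.Membership.Propositional using (_∈_; _∉_)
open import Data.List.Membership.Propositional.Properties using (∈-∃++; ∈-++⁺ˡ; ∈-++⁺ʳ; ∈-++⁻; ∈-allFin; ∈-filter⁺; ∈-filter⁻; ∈-lookup; ∈-map⁺; ∈-map⁻)
open import Data.List.Relation.Unary.Any using (Any; here; there)
open import Data.List.Relation.Unary.Any.Properties using (reverse⁺; reverse⁻)
import Data.List.Relation.Unary.All as All
import Data.List.Relation.Unary.Any as Any
import Data.List.Relation.Unary.AllPairs as AllPairs
open import Data.List.Relation.Unary.Unique.Propositional using (Unique)
open import Data.List.Relation.Unary.Unique.Propositional.Properties using (allFin⁺; filter⁺)
import Data.Nat
open import Data.Nat using (ℕ; zero; suc; _+_; _*_; _∸_; _/_; _≤_; _<_; z≤n; s≤s; s≤s⁻¹; _≤?_; _<?_)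
open import Data.Nat.Properties hiding (_≟_)
open import Data.Nat.DivMod using (m*n/n≡m)
open import Data.Nat.Tactic.RingSolver using (solve)
open import Data.Product using (Σ; ∃; ∃₂; _×_; _,_; proj₁; proj₂)
import Data.Sum
open import Data.Sum using (_⊎_; inj₁; inj₂; [_,_]′)
open import Data.Sum.Properties using (inj₁-injective; inj₂-injective)
open import Data.Unit using (⊤; tt)
open import Function using (_∘_; id; case_of_; Equivalence)
open import Relation.Nullary using (¬_; Dec; yes; no; does; contradiction)
open import Relation.Nullary.Decidable using (True; toWitness; _×-dec_; _⊎-dec_; ¬?; map′; dec-true; dec-false)
open import Relation.Binary.PropositionalEquality using (_≡_; _≢_; refl; sym; trans; cong; cong₂; subst; subst₂)

-- Lists of vertices

module _ {A : Set} {P : A → Set} where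

  cons : ∀ {x xs} → P x → (∀ {y} → y ∈ xs → P y) → ∀ {y} → y ∈ x ∷ xs → P y
  cons p q (here refl) = p
  cons p q (there r)   = q r

  sole : ∀ {x} → P x → ∀ {y} → y ∈ x ∷ [] → P y
  sole p = cons p λ ()

  both : ∀ {x y} → P x → P y → ∀ {z} → z ∈ x ∷ y ∷ [] → P z
  both p q = cons p (sole q)

module _ {n : ℕ} where

  δ : Fin n → Fin n → ℕ
  δ u v = if does (u ≟ v) then 1 else 0

  δ-refl : ∀ u → δ u u ≡ 1
  δ-refl u rewrite dec-true (u ≟ u) refl = refl

  occ : Fin n → List (Fin n) → ℕ
  occ u []       = 0
  occ u (v ∷ vs) = δ u v + occ u vs

  occ-++ : ∀ u xs ys → occ u (xs ++ ys) ≡ occ u xs + occ u ys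
  occ-++ u []       ys = refl
  occ-++ u (x ∷ xs) ys = trans (cong (δ u x +_) (occ-++ u xs ys)) (sym (+-assoc (δ u x) (occ u xs) (occ u ys)))

  occ-reverse : ∀ u xs → occ u (reverse xs) ≡ occ u xs
  occ-reverse u []       = refl
  occ-reverse u (x ∷ xs) = trans (cong (occ u) (unfold-reverse x xs))
    (trans (occ-++ u (reverse xs) (x ∷ []))
    (trans (cong₂ _+_ (occ-reverse u xs) (+-identityʳ (δ u x))) (+-comm (occ u xs) (δ u x))))

  ∈⇒occ : ∀ {u xs} → u ∈ xs → 1 ≤ occ u xs
  ∈⇒occ {u} {x ∷ xs} (here refl) rewrite δ-refl u = s≤s z≤n
  ∈⇒occ {u} {x ∷ xs} (there p) = ≤-trans (∈⇒occ p) (m≤n+m (occ u xs) (δ u x))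

  occ⇒∈ : ∀ {u} xs → 1 ≤ occ u xs → u ∈ xs
  occ⇒∈ {u} (x ∷ xs) p with u ≟ x
  ... | yes refl = here refl
  ... | no _     = there (occ⇒∈ xs p)

  infix 4 _∈?_ _⊑_ _≋_

  _∈?_ : ∀ (u : Fin n) xs → Dec (u ∈ xs)
  u ∈? xs = Any.any? (u ≟_) xs

  -- Counting occurrences makes concatenation and reversal additive, so that freedom from repetition
  -- of a rerouted cycle becomes a comparison of linear forms, decided by `⊑-by`. The record wrapper
  -- keeps both lists inferable.
  record _⊑_ (xs ys : List (Fin n)) : Set where
    constructor sub
    field occ-≤ : ∀ u → occ u xs ≤ occ u ys
  open _⊑_ public

  record _≋_ (xs ys : List (Fin n)) : Set where
    constructor perm
    field occ-≡ : ∀ u → occ u xs ≡ occ u ys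
  open _≋_ public

  record NoDup (xs : List (Fin n)) : Set where
    constructor nodup
    field occ-≤1 : ∀ u → occ u xs ≤ 1
  open NoDup public

  ≋⇒⊑ : ∀ {xs ys} → xs ≋ ys → xs ⊑ ys
  ≋⇒⊑ p = sub λ u → ≤-reflexive (occ-≡ p u)

  ≋-sym : ∀ {xs ys} → xs ≋ ys → ys ≋ xs
  ≋-sym p = perm λ u → sym (occ-≡ p u)

  ≋-trans : ∀ {xs ys zs} → xs ≋ ys → ys ≋ zs → xs ≋ zs
  ≋-trans p q = perm λ u → trans (occ-≡ p u) (occ-≡ q u)

  ⊑-trans : ∀ {xs ys zs} → xs ⊑ ys → ys ⊑ zs → xs ⊑ zs
  ⊑-trans p q = sub λ u → ≤-trans (occ-≤ p u) (occ-≤ q u)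

  ⊑-antisym : ∀ {xs ys} → xs ⊑ ys → ys ⊑ xs → xs ≋ ys
  ⊑-antisym p q = perm λ u → ≤-antisym (occ-≤ p u) (occ-≤ q u)

  ⊑-∈ : ∀ {u xs ys} → xs ⊑ ys → u ∈ xs → u ∈ ys
  ⊑-∈ {u} {xs} {ys} p q = occ⇒∈ ys (≤-trans (∈⇒occ q) (occ-≤ p u))

  NoDup-⊑ : ∀ {xs ys} → xs ⊑ ys → NoDup ys → NoDup xs
  NoDup-⊑ p q = nodup λ u → ≤-trans (occ-≤ p u) (occ-≤1 q u)

  NoDup-head : ∀ {x xs} → NoDup (x ∷ xs) → x ∉ xs
  NoDup-head {x} {xs} nd p = <⇒≱ (subst (λ d → 1 < d + occ x xs) (sym (δ-refl x)) (s≤s (∈⇒occ p))) (occ-≤1 nd x)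

  NoDup-tail : ∀ {x xs} → NoDup (x ∷ xs) → NoDup xs
  NoDup-tail {x} {xs} nd = nodup λ u → ≤-trans (m≤n+m (occ u xs) (δ u x)) (occ-≤1 nd u)

  NoDup-∷ : ∀ {x xs} → x ∉ xs → NoDup xs → NoDup (x ∷ xs)
  NoDup-∷ {x} {xs} p nd = nodup at-most-one
    where
    at-most-one : ∀ u → δ u x + occ u xs ≤ 1
    at-most-one u with u ≟ x
    ... | no _     = occ-≤1 nd u
    ... | yes refl with occ u xs in eq
    ...   | zero  = ≤-refl
    ...   | suc _ = contradiction (occ⇒∈ xs (subst (1 ≤_) (sym eq) (s≤s z≤n))) p

  NoDup-[] : NoDup []
  NoDup-[] = nodup λ u → z≤n

  NoDup-[x] : ∀ {x} → NoDup (x ∷ [])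
  NoDup-[x] = NoDup-∷ (λ ()) NoDup-[]

  NoDup-++ : ∀ {xs ys} → NoDup xs → NoDup ys → (∀ {u} → u ∈ xs → u ∉ ys) → NoDup (xs ++ ys)
  NoDup-++ {[]}     p q d = q
  NoDup-++ {x ∷ xs} p q d = NoDup-∷
    (λ r → [ NoDup-head p , d (here refl) ]′ (∈-++⁻ xs r))
    (NoDup-++ (NoDup-tail p) q (d ∘ there))

  NoDup-disjoint : ∀ {xs ys u} → NoDup (xs ++ ys) → u ∈ xs → u ∉ ys
  NoDup-disjoint {xs} {ys} {u} nd p q =
    <⇒≱ (subst (1 <_) (sym (occ-++ u xs ys)) (+-mono-≤ (∈⇒occ p) (∈⇒occ q))) (occ-≤1 nd u)

  NoDup? : ∀ xs → Dec (NoDup xs)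
  NoDup? xs = map′ nodup occ-≤1 (all? (λ u → occ u xs ≤? 1))

  Unique⇒NoDup : ∀ {xs} → Unique xs → NoDup xs
  Unique⇒NoDup AllPairs.[] = NoDup-[]
  Unique⇒NoDup (p AllPairs.∷ ps) = NoDup-∷ (λ q → All.lookup p q refl) (Unique⇒NoDup ps)

  length-⊆ : ∀ {xs ys} → NoDup xs → (∀ {u} → u ∈ xs → u ∈ ys) → length xs ≤ length ys
  length-⊆ {[]}     nd s = z≤n
  length-⊆ {x ∷ xs} {ys} nd s with ∈-∃++ (s (here refl))
  ... | ls , rs , refl = subst (suc (length xs) ≤_) (sym eq) (s≤s (length-⊆ (NoDup-tail nd) rest))
    where
    eq : length (ls ++ x ∷ rs) ≡ suc (length (ls ++ rs))
    eq = trans (length-++ ls) (trans (+-suc (length ls) (length rs)) (cong suc (sym (length-++ ls))))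
    rest : ∀ {u} → u ∈ xs → u ∈ ls ++ rs
    rest p with ∈-++⁻ ls (s (there p))
    ... | inj₁ q           = ∈-++⁺ˡ q
    ... | inj₂ (here refl) = contradiction p (NoDup-head nd)
    ... | inj₂ (there q)   = ∈-++⁺ʳ ls q

  ≋-length : ∀ {xs ys} → NoDup xs → xs ≋ ys → length xs ≡ length ys
  ≋-length nd e = ≤-antisym (length-⊆ nd (⊑-∈ (≋⇒⊑ e)))
    (length-⊆ (NoDup-⊑ (≋⇒⊑ (≋-sym e)) nd) (⊑-∈ (≋⇒⊑ (≋-sym e))))

  NoDup⇒length≤ : ∀ {xs} → NoDup xs → length xs ≤ n
  NoDup⇒length≤ {xs} nd = subst (length xs ≤_) (length-tabulate id) (length-⊆ nd (λ {u} _ → ∈-allFin u))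

  lookup-injective : ∀ {xs} → NoDup xs → ∀ i j → lookup xs i ≡ lookup xs j → i ≡ j
  lookup-injective {x ∷ xs} nd zero    zero    e = refl
  lookup-injective {x ∷ xs} nd zero    (suc j) e = contradiction (subst (_∈ xs) (sym e) (∈-lookup j)) (NoDup-head nd)
  lookup-injective {x ∷ xs} nd (suc i) zero    e = contradiction (subst (_∈ xs) e (∈-lookup i)) (NoDup-head nd)
  lookup-injective {x ∷ xs} nd (suc i) (suc j) e = cong suc (lookup-injective (NoDup-tail nd) i j e)

  full⇒length : ∀ {xs} → NoDup xs → (∀ u → u ∈ xs) → length xs ≡ n
  full⇒length {xs} nd s = ≤-antisym (NoDup⇒length≤ nd)
    (subst (_≤ length xs) (length-tabulate id) (length-⊆ (Unique⇒NoDup (allFin⁺ n)) (λ {u} _ → s u)))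

  complement : ∀ xs → (∀ u → u ∈ xs) ⊎ ∃ (_∉ xs)
  complement xs with any? (λ u → ¬? (u ∈? xs))
  ... | yes p = inj₂ p
  ... | no ¬p = inj₁ λ u → case u ∈? xs of λ { (yes q) → q ; (no q) → contradiction (u , q) ¬p }

  find : Fin n → List (Fin n) → ℕ
  find u [] = 0
  find u (x ∷ xs) = if does (u ≟ x) then 0 else suc (find u xs)

  find-< : ∀ {u xs} → u ∈ xs → find u xs < length xs
  find-< {u} {x ∷ xs} p with u ≟ x | p
  ... | yes _ | _         = s≤s z≤n
  ... | no ¬e | here e    = contradiction e ¬e
  ... | no _  | there q   = s≤s (find-< q)

  find-injective : ∀ {u v} xs → u ∈ xs → v ∈ xs → find u xs ≡ find v xs → u ≡ v
  find-injective {u} {v} (x ∷ xs) p q e with u ≟ x | v ≟ x | p | q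
  ... | yes refl | yes refl | _       | _       = refl
  ... | no ¬e    | _        | here e′ | _       = contradiction e′ ¬e
  ... | no _     | no ¬e    | there _ | here e′ = contradiction e′ ¬e
  ... | no _     | no _     | there r | there s = find-injective xs r s (suc-injective e)

  first : ∀ {P : Fin n → Set} → (∀ u → Dec (P u)) → ∀ {xs u} → u ∈ xs → P u →
    ∃₂ λ ls m → ∃ λ rs → xs ≡ ls ++ m ∷ rs × P m × (∀ t → t ∈ ls → ¬ P t)
  first P? {x ∷ xs} u∈ pu with P? x
  ... | yes p = [] , x , xs , refl , p , λ _ ()
  first P? {x ∷ xs} (here refl) pu | no ¬p = contradiction pu ¬p
  first P? {x ∷ xs} (there u∈) pu | no ¬p with first P? u∈ pu
  ... | ls , m , rs , refl , pm , out = x ∷ ls , m , rs , refl , pm ,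
    λ { _ (here refl) → ¬p ; t (there q) → out t q }

  last : ∀ {P : Fin n → Set} → (∀ u → Dec (P u)) → ∀ {xs u} → u ∈ xs → P u →
    ∃₂ λ ls m → ∃ λ rs → xs ≡ ls ++ m ∷ rs × P m × (∀ t → t ∈ rs → ¬ P t)
  last {P} P? {x ∷ xs} u∈ pu with Any.any? P? xs
  ... | yes p = let (y , y∈ , py) = find′ p in case last P? y∈ py of
    λ { (ls , m , rs , refl , pm , out) → x ∷ ls , m , rs , refl , pm , out }
    where
    find′ : ∀ {ys} → Any P ys → ∃ λ y → y ∈ ys × P y
    find′ (here py) = _ , here refl , py
    find′ (there q) = let (y , y∈ , py) = find′ q in y , there y∈ , py
  last P? {x ∷ xs} (here refl) pu | no ¬p = [] , x , xs , refl , pu , λ _ t∈ pt → ¬p (Any.map (λ { refl → pt }) t∈)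
  last P? {x ∷ xs} (there u∈) pu | no ¬p = contradiction (Any.map (λ { refl → pu }) u∈) ¬p

  NoDup-pair : ∀ {x y : Fin n} → x ≢ y → NoDup (x ∷ y ∷ [])
  NoDup-pair x≢y = NoDup-∷ (λ { (here e) → x≢y e }) NoDup-[x]

  ∈⇒1≤length : ∀ {x : Fin n} {xs} → x ∈ xs → 1 ≤ length xs
  ∈⇒1≤length (here _)  = s≤s z≤n
  ∈⇒1≤length (there _) = s≤s z≤n

  singleton-≡ : ∀ (xs : List (Fin n)) → length xs ≡ 1 → ∀ {x y} → x ∈ xs → y ∈ xs → y ≡ x
  singleton-≡ (_ ∷ []) _ (here refl) (here refl) = refl

  pair-≡ : ∀ (xs : List (Fin n)) → length xs ≤ 2 → ∀ {e f} → e ∈ xs → f ∈ xs → f ≢ e → xs ≡ e ∷ f ∷ [] ⊎ xs ≡ f ∷ e ∷ []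
  pair-≡ (_ ∷ _)          _ (here refl)         (here refl)         ne = contradiction refl ne
  pair-≡ (_ ∷ _ ∷ [])     _ (here refl)         (there (here refl)) ne = inj₁ refl
  pair-≡ (_ ∷ _ ∷ [])     _ (there (here refl)) (here refl)         ne = inj₂ refl
  pair-≡ (_ ∷ _ ∷ [])     _ (there (here refl)) (there (here refl)) ne = contradiction refl ne
  pair-≡ (_ ∷ _ ∷ _ ∷ _) (s≤s (s≤s ())) _ _ _

  some-∈ : ∀ (xs : List (Fin n)) → 1 ≤ length xs → ∃ (_∈ xs)
  some-∈ (x ∷ _) _ = x , here refl

  two-∈ : ∀ (xs : List (Fin n)) → NoDup xs → 2 ≤ length xs → ∃₂ λ x y → x ∈ xs × y ∈ xs × x ≢ y
  two-∈ (x ∷ [])    _  (s≤s ())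
  two-∈ (x ∷ y ∷ _) nd _ = x , y , here refl , there (here refl) , λ { refl → NoDup-head nd (here refl) }

  other-∈ : ∀ {e : Fin n} xs → NoDup xs → 2 ≤ length xs → ∃ λ f → f ∈ xs × f ≢ e
  other-∈ {e} xs nd 2≤ with two-∈ xs nd 2≤
  ... | x , y , x∈ , y∈ , x≢y with x ≟ e
  ...   | no x≢e   = x , x∈ , x≢e
  ...   | yes refl = y , y∈ , x≢y ∘ sym

-- A reflective check of multiset inclusion for lists built from the same blocks by concatenation and reversal

infixr 5 _⊕_
infix  8 `_

data Exp (m : ℕ) : Set where
  var : Fin m → Exp m
  rev : Exp m → Exp m
  _⊕_ : Exp m → Exp m → Exp m

`_ : ∀ {m} (i : ℕ) {i<m : True (i <? m)} → Exp m
`_ i {p} = var (fromℕ< (toWitness p))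

mult : ∀ {m} → Exp m → Fin m → ℕ
mult (var i) j = δ j i
mult (rev e) j = mult e j
mult (e ⊕ f) j = mult e j + mult f j

weight : ∀ {m} → Exp m → (Fin m → ℕ) → ℕ
weight (var i) g = g i
weight (rev e) g = weight e g
weight (e ⊕ f) g = weight e g + weight f g

sumᶠ : ∀ {m} → (Fin m → ℕ) → ℕ
sumᶠ {zero}  g = 0
sumᶠ {suc m} g = g zero + sumᶠ (g ∘ suc)

sumᶠ-0 : ∀ {m} (g : Fin m → ℕ) → (∀ j → g j ≡ 0) → sumᶠ g ≡ 0
sumᶠ-0 {zero}  g z = refl
sumᶠ-0 {suc m} g z = cong₂ _+_ (z zero) (sumᶠ-0 (g ∘ suc) (z ∘ suc))

sumᶠ-+ : ∀ {m} (f g : Fin m → ℕ) → sumᶠ (λ j → f j + g j) ≡ sumᶠ f + sumᶠ g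
sumᶠ-+ {zero}  f g = refl
sumᶠ-+ {suc m} f g = trans (cong (f zero + g zero +_) (sumᶠ-+ (f ∘ suc) (g ∘ suc)))
  (interchange (f zero) (g zero) (sumᶠ (f ∘ suc)) (sumᶠ (g ∘ suc)))
  where
  interchange : ∀ a b c d → a + b + (c + d) ≡ a + c + (b + d)
  interchange a b c d = solve (a ∷ b ∷ c ∷ d ∷ [])

sumᶠ-cong : ∀ {m} {f g : Fin m → ℕ} → (∀ j → f j ≡ g j) → sumᶠ f ≡ sumᶠ g
sumᶠ-cong {zero}  e = refl
sumᶠ-cong {suc m} e = cong₂ _+_ (e zero) (sumᶠ-cong (e ∘ suc))

sumᶠ-mono : ∀ {m} {f g : Fin m → ℕ} → (∀ j → f j ≤ g j) → sumᶠ f ≤ sumᶠ g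
sumᶠ-mono {zero}  e = z≤n
sumᶠ-mono {suc m} e = +-mono-≤ (e zero) (sumᶠ-mono (e ∘ suc))

sumᶠ-δ : ∀ {m} (i : Fin m) (g : Fin m → ℕ) → sumᶠ (λ j → δ j i * g j) ≡ g i
sumᶠ-δ zero    g = trans (cong (g zero + 0 +_) (sumᶠ-0 (λ j → 0 * g (suc j)) (λ _ → refl)))
  (trans (+-identityʳ _) (+-identityʳ _))
sumᶠ-δ (suc i) g = trans (sumᶠ-cong (λ j → cong (_* g (suc j)) (δ-suc j))) (sumᶠ-δ i (g ∘ suc))
  where
  δ-suc : ∀ j → δ (suc j) (suc i) ≡ δ j i
  δ-suc j with j ≟ i
  ... | yes _ = refl
  ... | no _  = refl

weight-mult : ∀ {m} (e : Exp m) g → weight e g ≡ sumᶠ (λ j → mult e j * g j)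
weight-mult (var i) g = sym (sumᶠ-δ i g)
weight-mult (rev e) g = weight-mult e g
weight-mult (e ⊕ f) g = trans (cong₂ _+_ (weight-mult e g) (weight-mult f g))
  (trans (sym (sumᶠ-+ (λ j → mult e j * g j) (λ j → mult f j * g j))) (sumᶠ-cong (λ j → sym (*-distribʳ-+ (g j) (mult e j) (mult f j)))))

_≼?_ : ∀ {m} (e f : Exp m) → Dec (∀ j → mult e j ≤ mult f j)
e ≼? f = all? (λ j → mult e j ≤? mult f j)

module _ {n : ℕ} (ρ : List (List (Fin n))) where

  ⟦_⟧ : Exp (length ρ) → List (Fin n)
  ⟦ var i ⟧ = lookup ρ i
  ⟦ rev e ⟧ = reverse ⟦ e ⟧
  ⟦ e ⊕ f ⟧ = ⟦ e ⟧ ++ ⟦ f ⟧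

  occ-⟦⟧ : ∀ u e → occ u ⟦ e ⟧ ≡ weight e (λ j → occ u (lookup ρ j))
  occ-⟦⟧ u (var i) = refl
  occ-⟦⟧ u (rev e) = trans (occ-reverse u ⟦ e ⟧) (occ-⟦⟧ u e)
  occ-⟦⟧ u (e ⊕ f) = trans (occ-++ u ⟦ e ⟧ ⟦ f ⟧) (cong₂ _+_ (occ-⟦⟧ u e) (occ-⟦⟧ u f))

  length-⟦⟧ : ∀ e → length ⟦ e ⟧ ≡ weight e (λ j → length (lookup ρ j))
  length-⟦⟧ (var i) = refl
  length-⟦⟧ (rev e) = trans (length-reverse ⟦ e ⟧) (length-⟦⟧ e)
  length-⟦⟧ (e ⊕ f) = trans (length-++ ⟦ e ⟧) (cong₂ _+_ (length-⟦⟧ e) (length-⟦⟧ f))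

  -- Both counts are linear forms in the counts of the blocks, with `mult` as coefficients, so
  -- comparing coefficients suffices; the comparison is decided by evaluation inside an implicit
  -- argument.
  ⊑-by : ∀ e f {e≼f : True (e ≼? f)} → ⟦ e ⟧ ⊑ ⟦ f ⟧
  ⊑-by e f {p} = sub bound
    where
    bound : ∀ u → occ u ⟦ e ⟧ ≤ occ u ⟦ f ⟧
    bound u rewrite occ-⟦⟧ u e | occ-⟦⟧ u f
      | weight-mult e (λ j → occ u (lookup ρ j)) | weight-mult f (λ j → occ u (lookup ρ j))
      = sumᶠ-mono (λ j → *-monoˡ-≤ (occ u (lookup ρ j)) (toWitness p j))

  ≋-by : ∀ e f {e≼f : True (e ≼? f)} {f≼e : True (f ≼? e)} → ⟦ e ⟧ ≋ ⟦ f ⟧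
  ≋-by e f {p} {q} = ⊑-antisym (⊑-by e f {p}) (⊑-by f e {q})

-- Linear arithmetic by certificate: the hypotheses are added up to `l ≤ r`, `c` is the slack given
-- away, and the identity is left to the ring solver.
lin : ∀ {l r} x y c → l ≤ r → r + x + c ≡ l + y → x ≤ y
lin {l} {r} x y c l≤r e = +-cancelˡ-≤ r x y (begin
  r + x      ≤⟨ m≤m+n (r + x) c ⟩
  r + x + c  ≡⟨ e ⟩
  l + y      ≤⟨ +-monoˡ-≤ y l≤r ⟩
  r + y      ∎)
  where open ≤-Reasoning

-- Walks given by their lists of vertices

module Walks {n : ℕ} (G : Graph n) where

  adj-sym : ∀ {u v} → Adj G u v → Adj G v u
  adj-sym {u} {v} p = trans (Graph.sym G v u) p

  adj⇒≢ : ∀ {u v} → Adj G u v → u ≢ v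
  adj⇒≢ {u} p refl with trans (sym p) (Graph.irrefl G u)
  ... | ()

  Adj? : ∀ u v → Dec (Adj G u v)
  Adj? u v = adj G u v Bool.≟ true

  -- W a xs b: the walk from a to b whose inner vertices are xs, in this order.
  W : Fin n → List (Fin n) → Fin n → Set
  W a []       b = Adj G a b
  W a (x ∷ xs) b = Adj G a x × W x xs b

  W-++ : ∀ {a b c} xs {ys} → W a xs b → W b ys c → W a (xs ++ b ∷ ys) c
  W-++ []       p       q = p , q
  W-++ (x ∷ xs) (p , r) q = p , W-++ xs r q

  W-split : ∀ {a b c} xs {ys} → W a (xs ++ b ∷ ys) c → W a xs b × W b ys c
  W-split []       (p , q) = p , q
  W-split (x ∷ xs) (p , q) = let (r , s) = W-split xs q in (p , r) , s

  W-reverse : ∀ {a b} xs → W a xs b → W b (reverse xs) a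
  W-reverse []       p       = adj-sym p
  W-reverse {a} {b} (x ∷ xs) (p , q) = subst (λ zs → W b zs a) (sym (unfold-reverse x xs))
    (W-++ (reverse xs) (W-reverse xs q) (adj-sym p))

  Path : Fin n → List (Fin n) → Set
  Path a []       = ⊤
  Path a (x ∷ xs) = Adj G a x × Path x xs

  Path? : ∀ a xs → Dec (Path a xs)
  Path? a []       = yes tt
  Path? a (x ∷ xs) = Adj? a x ×-dec Path? x xs

  end : Fin n → List (Fin n) → Fin n
  end a []       = a
  end a (x ∷ xs) = end x xs

  end-++ : ∀ a xs {b ys} → end a (xs ++ b ∷ ys) ≡ end b ys
  end-++ a []       = refl
  end-++ a (x ∷ xs) = end-++ x xs

  end-∈ : ∀ a xs → end a xs ∈ a ∷ xs
  end-∈ a []       = here refl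
  end-∈ a (x ∷ xs) = there (end-∈ x xs)

  W-close : ∀ {a b} xs → Path a xs → Adj G (end a xs) b → W a xs b
  W-close []       _       q = q
  W-close (x ∷ xs) (p , r) q = p , W-close xs r q

  Path-++ : ∀ {a b} xs {ys} → W a xs b → Path b ys → Path a (xs ++ b ∷ ys)
  Path-++ []       p       q = p , q
  Path-++ (x ∷ xs) (p , r) q = p , Path-++ xs r q

  Path-split : ∀ {a b} xs {ys} → Path a (xs ++ b ∷ ys) → W a xs b × Path b ys
  Path-split []       (p , q) = p , q
  Path-split (x ∷ xs) (p , q) = let (r , s) = Path-split xs q in (p , r) , s

  Path-reverse : ∀ u us → Path u us → ∃ λ vs →
    reverse (u ∷ us) ≡ end u us ∷ vs × Path (end u us) vs × end (end u us) vs ≡ u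
  Path-reverse u []       _       = [] , refl , tt , refl
  Path-reverse u (x ∷ xs) (p , q) with Path-reverse x xs q
  ... | vs , e , r , f = vs ++ u ∷ [] ,
    trans (unfold-reverse u (x ∷ xs)) (cong (_++ u ∷ []) e) ,
    Path-++ vs (W-close vs r (subst (λ t → Adj G t u) (sym f) (adj-sym p))) tt ,
    end-++ (end x xs) vs

  Closed : List (Fin n) → Set
  Closed []       = ⊤
  Closed (a ∷ xs) = W a xs a

  Closed-rotate : ∀ xs ys → Closed (xs ++ ys) → Closed (ys ++ xs)
  Closed-rotate []       ys       c = subst Closed (sym (++-identityʳ ys)) c
  Closed-rotate (x ∷ xs) []       c = subst Closed (++-identityʳ (x ∷ xs)) c
  Closed-rotate (x ∷ xs) (y ∷ ys) c = let (p , q) = W-split xs c in W-++ ys q p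

  W-lookup : ∀ {a b} xs → W a xs b → ∀ (i j : Fin (length (a ∷ xs))) → suc (toℕ i) ≡ toℕ j →
    Adj G (lookup (a ∷ xs) i) (lookup (a ∷ xs) j)
  W-lookup (x ∷ xs) (p , q) zero    (suc zero) e = p
  W-lookup (x ∷ xs) (p , q) (suc i) (suc j)    e = W-lookup xs q i j (suc-injective e)
  W-lookup []       p       zero    (suc ())   e

  W-lookup-last : ∀ {a b} xs → W a xs b → ∀ (i : Fin (length (a ∷ xs))) → suc (toℕ i) ≡ length (a ∷ xs) →
    Adj G (lookup (a ∷ xs) i) b
  W-lookup-last []       p       zero    e = p
  W-lookup-last (x ∷ xs) (p , q) (suc i) e = W-lookup-last xs q i (suc-injective e)

  Closed⇒HasCycle : ∀ xs → Closed xs → NoDup xs → 3 ≤ length xs → HasCycle G (length xs)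
  Closed⇒HasCycle (a ∷ xs) c nd l = l , lookup (a ∷ xs) , (λ {i} {j} → lookup-injective nd i j) , W-lookup xs c ,
    λ { i zero e _ → W-lookup-last xs c i e }

  ∃-of-length? : ∀ {P : List (Fin n) → Set} → (∀ xs → Dec (P xs)) → ∀ m → Dec (∃ λ xs → length xs ≡ m × P xs)
  ∃-of-length? P? zero = map′ (λ p → [] , refl , p) (λ { ([] , _ , p) → p }) (P? [])
  ∃-of-length? P? (suc m) = map′
    (λ { (x , xs , e , p) → x ∷ xs , cong suc e , p })
    (λ { (x ∷ xs , e , p) → x , xs , suc-injective e , p })
    (any? λ x → ∃-of-length? (λ xs → P? (x ∷ xs)) m)

  -- Lists of a fixed length can be searched exhaustively, and without repetitions none is longer
  -- than `n`; the search goes down from there.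
  longest : ∀ {P : List (Fin n) → Set} → (∀ xs → Dec (P xs)) → (∀ {xs} → P xs → NoDup xs) →
    ∀ {xs} → P xs → ∃ λ ys → P ys × (∀ {zs} → P zs → length zs ≤ length ys)
  longest {P} P? nd {xs} p = search n (λ q → NoDup⇒length≤ (nd q))
    where
    search : ∀ m → (∀ {zs} → P zs → length zs ≤ m) → ∃ λ ys → P ys × (∀ {zs} → P zs → length zs ≤ length ys)
    search m bound with ∃-of-length? P? m
    ... | yes (ys , refl , q) = ys , q , bound
    search zero    bound | no ¬q = contradiction (xs , n≤0⇒n≡0 (bound p) , p) ¬q
    search (suc m) bound | no ¬q = search m λ {zs} q →
      case m≤n⇒m<n∨m≡n (bound q) of λ { (inj₁ (s≤s l)) → l ; (inj₂ e) → contradiction (zs , e , q) ¬q }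

  W-extend : ∀ {a b} xs {ys} → Path a xs → W (end a xs) ys b → W a (xs ++ ys) b
  W-extend []       _       q = q
  W-extend (x ∷ xs) (p , r) q = p , W-extend xs r q

  Path-suffix : ∀ {x qs} ls {q rs} → x ∷ qs ≡ ls ++ q ∷ rs → Path x qs → Path q rs × end x qs ≡ end q rs
  Path-suffix []       refl p = p , refl
  Path-suffix (x ∷ ls) refl p = proj₂ (Path-split ls p) , end-++ x ls

  -- The entries of `zs` are places of `ys` wasted on non-neighbours. With `zs` just `v` this gives
  -- the strict bound `degree-<`; with `zs` one missed vertex it shows that a vertex of degree at
  -- least `length ys` sees all of `ys`.
  degree-+ : ∀ v zs {ys} → NoDup zs → (∀ {u} → u ∈ zs → ¬ Adj G v u) → (∀ {u} → u ∈ zs → u ∈ ys) →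
    (∀ {u} → Adj G v u → u ∈ ys) → length zs + degree G v ≤ length ys
  degree-+ v zs {ys} nd o s t = subst (_≤ length ys) (length-++ zs)
    (length-⊆ (NoDup-++ nd (Unique⇒NoDup (filter⁺ (λ u → Bool.T? (adj G v u)) (allFin⁺ n))) (λ p q → o p (adjacent q)))
      λ p → [ s , t ∘ adjacent ]′ (∈-++⁻ zs p))
    where
    adjacent : ∀ {u} → u ∈ filter (λ u → Bool.T? (adj G v u)) (allFin n) → Adj G v u
    adjacent p = Equivalence.to T-≡ (proj₂ (∈-filter⁻ (λ u → Bool.T? (adj G v u)) {xs = allFin n} p))

  degree-⊆ : ∀ v {ys} → (∀ {u} → Adj G v u → u ∈ ys) → degree G v ≤ length ys
  degree-⊆ v = degree-+ v [] NoDup-[] (λ ()) (λ ())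

  degree-< : ∀ v {ys} → v ∈ ys → (∀ {u} → Adj G v u → u ∈ ys) → degree G v < length ys
  degree-< v v∈ = degree-+ v (v ∷ []) NoDup-[x] (λ { (here refl) p → adj⇒≢ p refl }) (λ { (here refl) → v∈ })

  W⇒Path : ∀ {a b} xs → W a xs b → Path a xs
  W⇒Path []       _       = tt
  W⇒Path (x ∷ xs) (p , q) = p , W⇒Path xs q

-- Two disjoint paths to a cycle

module Fans {n : ℕ} (G : Graph n)
  (connected : ∀ x u v → u ≢ x → v ≢ x → Walk G (λ t → t ≢ x) u v)
  (C : List (Fin n)) where

  open Walks G

  walk-start : ∀ {P u v} → Walk G P u v → P u
  walk-start (here p)     = p
  walk-start (step p _ _) = p

  module Hitting (T′ : List (Fin n)) (q : Fin n) {S : Fin n → Set} (S? : ∀ u → Dec (S u)) where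

    record Reach (t : Fin n) : Set where
      constructor reach
      field
        inner  : List (Fin n)
        target : Fin n
        walk   : W t inner target
        hits   : S target
        target≢q : target ≢ q
        nd     : NoDup (t ∷ inner)
        avoids : ∀ {y} → y ∈ inner → y ∉ T′ × ¬ S y × y ≢ q

    -- Cut the walk at its first visit to `S` and start it again at its last vertex of `T′` before
    -- that; loops are dropped on the way, so that a path remains.
    hit : ∀ {u v} → Walk G (_≢ q) u v → S v → ¬ S u → Reach u ⊎ ∃ λ t → t ∈ T′ × Reach t
    hit (here _) sv ¬su = contradiction sv ¬su
    hit {u} (step {w = x} u≢q a r) sv ¬su with S? x
    ... | yes sx = inj₁ (reach [] x a sx (walk-start r) NoDup-[x] (λ ()))
    ... | no ¬sx with x ∈? T′ | hit r sv ¬sx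
    ...   | _      | inj₂ h = inj₂ h
    ...   | yes x∈ | inj₁ h = inj₂ (x , x∈ , h)
    ...   | no x∉  | inj₁ (reach ins s wk ss s≢q nd av) with u ∈? ins
    ...     | no u∉ = inj₁ (reach (x ∷ ins) s (a , wk) ss s≢q
                (NoDup-∷ (λ { (here e) → adj⇒≢ a e ; (there u∈) → u∉ u∈ }) nd)
                λ { (here refl) → x∉ , ¬sx , walk-start r ; (there y∈) → av y∈ })
    ...     | yes u∈ with ∈-∃++ u∈
    ...       | ls , rs , refl = inj₁ (reach rs s (proj₂ (W-split (x ∷ ls) {rs} (a , wk))) ss s≢q
                (NoDup-⊑ (⊑-by ((x ∷ ls) ∷ (u ∷ rs) ∷ []) (` 1) (` 0 ⊕ ` 1)) nd)
                (λ y∈ → av (∈-++⁺ʳ ls (there y∈))))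

  -- The path stops at its first vertex of `C`. Unlike in `W`, the list includes that last vertex,
  -- and it is empty if the start is already on `C`.
  ToC : Fin n → List (Fin n) → Set
  ToC a []       = a ∈ C
  ToC a (x ∷ xs) = a ∉ C × Adj G a x × ToC x xs

  ToC-suffix : ∀ {p s} α → ToC p α → s ∈ p ∷ α → ∃ λ σ → ToC s σ × s ∷ σ ⊑ p ∷ α
  ToC-suffix α       c           (here refl) = α , c , sub λ _ → ≤-refl
  ToC-suffix {p} (x ∷ α) (_ , _ , c) (there s∈) = let (σ , d , s) = ToC-suffix α c s∈ in
    σ , d , sub λ u → ≤-trans (occ-≤ s u) (m≤n+m (occ u (x ∷ α)) (δ u p))

  ToC-tail-suffix : ∀ {p s} α → ToC p α → s ∈ α → ∃ λ σ → ToC s σ × s ∷ σ ⊑ α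
  ToC-tail-suffix (x ∷ α) (_ , _ , c) s∈ = ToC-suffix α c s∈

  ToC-join : ∀ {t s} ins {σ} → W t ins s → t ∉ C → (∀ {y} → y ∈ ins → y ∉ C) → ToC s σ → ToC t (ins ++ s ∷ σ)
  ToC-join []        a       t∉ o c = t∉ , a , c
  ToC-join (x ∷ ins) (a , w) t∉ o c = t∉ , a , ToC-join ins w (o (here refl)) (o ∘ there) c

  ToC-last : ∀ {t x} xs → ToC t (x ∷ xs) → ∃₂ λ ins c → x ∷ xs ≡ ins ++ c ∷ [] × W t ins c × c ∈ C × (∀ {y} → y ∈ t ∷ ins → y ∉ C)
  ToC-last {t} {x} []  (t∉ , a , c) = [] , x , refl , a , c , λ { (here refl) → t∉ }
  ToC-last {t} {x} (y ∷ ys) (t∉ , a , c) with ToC-last ys c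
  ... | ins , e , eq , w , e∈ , o = x ∷ ins , e , cong (x ∷_) eq , (a , w) , e∈ , λ { (here refl) → t∉ ; (there y∈) → o y∈ }

  -- The paths have to keep off `T′`, apart from the start of the second one, because they are later
  -- joined by a path that runs inside `q ∷ T′`.
  record Fan (q : Fin n) (T′ : List (Fin n)) : Set where
    constructor mkFan
    field
      α β : List (Fin n)
      t   : Fin n
      t∈  : t ∈ T′
      qα  : ToC q α
      tβ  : ToC t β
      ndα : NoDup (q ∷ α)
      ndβ : NoDup (t ∷ β)
      α∥β : ∀ {y} → y ∈ q ∷ α → y ∉ t ∷ β
      α∥T : ∀ {y} → y ∈ α → y ∉ T′
      β∥T : ∀ {y} → y ∈ β → y ∉ T′

  -- Two disjoint paths from p and from q ∷ T′ to C are known by induction; if the second one starts at q, a third path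
  -- from T′ avoiding q reroutes one of them.
  fan : ∀ {c₁ c₂} → c₁ ∈ C → c₂ ∈ C → c₁ ≢ c₂ → ∀ q T′ γ → ToC q γ → (∀ {y} → y ∈ γ → y ∉ T′) → NoDup (q ∷ γ) →
    q ∉ T′ → (∀ {y} → y ∈ T′ → y ∉ C) → ∀ {t₀} → t₀ ∈ T′ → Fan q T′
  fan {c₁} {c₂} c₁∈ c₂∈ c₁≢c₂ q T′ [] q∈C _ _ q∉T T∥C {t₀} t₀∈ = from-other other
    where
    other : ∃ λ c → c ∈ C × c ≢ q
    other with c₁ ≟ q
    ... | no c₁≢q = c₁ , c₁∈ , c₁≢q
    ... | yes refl = c₂ , c₂∈ , c₁≢c₂ ∘ sym
    in-C? : ∀ y → Dec (y ∈ C)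
    in-C? y = y ∈? C
    open Hitting T′ q in-C?
    build : ∀ {t} → t ∈ T′ → Reach t → Fan q T′
    build t∈ (reach ins s wk s∈ s≢q nd av) = mkFan [] (ins ++ s ∷ []) _ t∈ q∈C
      (ToC-join ins wk (T∥C t∈) (λ y∈ → proj₁ (proj₂ (av y∈))) s∈) NoDup-[x]
      (NoDup-++ nd NoDup-[x] λ { (here refl) (here refl) → T∥C t∈ s∈ ; (there y∈) (here refl) → proj₁ (proj₂ (av y∈)) s∈ })
      (λ { (here refl) (here refl) → q∉T t∈
         ; (here refl) (there y∈) → [ (λ y∈ins → proj₂ (proj₂ (av y∈ins)) refl) , (λ { (here refl) → s≢q refl }) ]′ (∈-++⁻ ins y∈) })
      (λ ())
      λ y∈ → [ (λ y∈ins → proj₁ (av y∈ins)) , (λ { (here refl) s∈T → T∥C s∈T s∈ }) ]′ (∈-++⁻ ins y∈)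
    from-other : (∃ λ c → c ∈ C × c ≢ q) → Fan q T′
    from-other (c , c∈ , c≢q) with hit (connected q t₀ c (λ { refl → q∉T t₀∈ }) c≢q) c∈ (T∥C t₀∈)
    ... | inj₁ r            = build t₀∈ r
    ... | inj₂ (t , t∈ , r) = build t∈ r
  fan c₁∈ c₂∈ c₁≢c₂ q T′ (p ∷ γ) (q∉C , q~p , pγ) γ∥T ndγ q∉T T∥C {t₀} t₀∈
    -- The induction hypothesis is used at the next vertex `p` of the given path, with `q` moved
    -- into the set where the second path may start.
    with fan c₁∈ c₂∈ c₁≢c₂ p (q ∷ T′) γ pγ
      (λ { y∈ (here refl) → NoDup-head ndγ (there y∈) ; y∈ (there y∈T) → γ∥T (there y∈) y∈T })
      (NoDup-tail ndγ)
      (λ { (here refl) → NoDup-head ndγ (here refl) ; (there p∈T) → γ∥T (here refl) p∈T })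
      (λ { (here refl) → q∉C ; (there y∈) → T∥C y∈ })
      (here refl)
  ... | mkFan α β t (there t∈) pα tβ ndα ndβ α∥β α∥T β∥T =
    mkFan (p ∷ α) β t t∈ (q∉C , q~p , pα) tβ
      (NoDup-∷ (λ { (here refl) → NoDup-head ndγ (here refl) ; (there q∈) → α∥T q∈ (here refl) }) ndα) ndβ
      (λ { (here refl) (here refl) → q∉T t∈ ; (here refl) (there q∈) → β∥T q∈ (here refl) ; (there y∈) → α∥β y∈ })
      (λ { (here refl) → γ∥T (here refl) ; (there y∈) y∈T → α∥T y∈ (there y∈T) })
      (λ y∈ y∈T → β∥T y∈ (there y∈T))
  ... | mkFan α β .q (here refl) pα qβ ndα ndβ α∥β α∥T β∥T = reroute
    where
    Target : Fin n → Set
    Target y = y ∈ C ⊎ y ∈ p ∷ α ⊎ y ∈ β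
    Target? : ∀ y → Dec (Target y)
    Target? y = (y ∈? C) ⊎-dec ((y ∈? (p ∷ α)) ⊎-dec (y ∈? β))
    open Hitting T′ q Target?
    p≢q : p ≢ q
    p≢q refl = NoDup-head ndγ (here refl)
    S∥T : ∀ {y} → y ∈ T′ → ¬ Target y
    S∥T y∈ (inj₁ y∈C)                = T∥C y∈ y∈C
    S∥T y∈ (inj₂ (inj₁ (here refl))) = γ∥T (here refl) y∈
    S∥T y∈ (inj₂ (inj₁ (there y∈α))) = α∥T y∈α (there y∈)
    S∥T y∈ (inj₂ (inj₂ y∈β))         = β∥T y∈β (there y∈)
    finish : ∀ {t} → t ∈ T′ → (r : Reach t) → ∀ α′ σ → ToC q α′ → NoDup (q ∷ α′) → (∀ {y} → y ∈ α′ → Target y) →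
      ToC (Reach.target r) σ → NoDup (Reach.target r ∷ σ) → (∀ {y} → y ∈ Reach.target r ∷ σ → Target y) →
      (∀ {y} → y ∈ q ∷ α′ → y ∉ Reach.target r ∷ σ) → Fan q T′
    finish t∈ (reach ins s wk s∈ s≢q nd av) α′ σ qα′ ndα′ α′S sσ ndσ σS α′∥σ =
      mkFan α′ (ins ++ s ∷ σ) _ t∈ qα′
        (ToC-join ins wk (T∥C t∈) (λ y∈ y∈C → proj₁ (proj₂ (av y∈)) (inj₁ y∈C)) sσ) ndα′
        (NoDup-++ nd ndσ λ { (here refl) y∈σ → S∥T t∈ (σS y∈σ) ; (there y∈) y∈σ → proj₁ (proj₂ (av y∈)) (σS y∈σ) })
        (λ { (here refl) (here refl) → q∉T t∈
           ; (there y∈) (here refl) → S∥T t∈ (α′S y∈)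
           ; (here refl) (there y∈) → [ (λ y∈ins → proj₂ (proj₂ (av y∈ins)) refl) , α′∥σ (here refl) ]′ (∈-++⁻ ins y∈)
           ; (there y∈α) (there y∈) → [ (λ y∈ins → proj₁ (proj₂ (av y∈ins)) (α′S y∈α)) , α′∥σ (there y∈α) ]′ (∈-++⁻ ins y∈) })
        (λ y∈ y∈T → S∥T y∈T (α′S y∈))
        λ y∈ y∈T → [ (λ y∈ins → proj₁ (av y∈ins) y∈T) , (λ y∈σ → S∥T y∈T (σS y∈σ)) ]′ (∈-++⁻ ins y∈)
    pα-avoids-q : q ∉ p ∷ α
    pα-avoids-q q∈ = α∥β q∈ (here refl)
    -- `q` has two ways to `C`: along `β`, or through `p` along `α`. It takes one that the third
    -- path does not run into; the third path, if it meets the other, follows it from there.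
    build : ∀ {t} → t ∈ T′ → Reach t → Fan q T′
    build t∈ r with Reach.target r ∈? (p ∷ α) | Reach.target r ∈? β
    ... | yes s∈α | _ with ToC-suffix α pα s∈α
    ...   | σ , sσ , σ⊑ = finish t∈ r β σ qβ ndβ (inj₂ ∘ inj₂) sσ (NoDup-⊑ σ⊑ ndα) (inj₂ ∘ inj₁ ∘ ⊑-∈ σ⊑)
              (λ y∈β y∈σ → α∥β (⊑-∈ σ⊑ y∈σ) y∈β)
    build t∈ r | no _ | yes s∈β with ToC-tail-suffix β qβ s∈β
    ...   | σ , sσ , σ⊑ = finish t∈ r (p ∷ α) σ (q∉C , q~p , pα) (NoDup-∷ pα-avoids-q ndα) (inj₂ ∘ inj₁) sσ
              (NoDup-⊑ σ⊑ (NoDup-tail ndβ)) (λ y∈σ → inj₂ (inj₂ (⊑-∈ σ⊑ y∈σ)))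
              (λ { (here refl) y∈σ → NoDup-head ndβ (⊑-∈ σ⊑ y∈σ) ; (there y∈α) y∈σ → α∥β y∈α (there (⊑-∈ σ⊑ y∈σ)) })
    build t∈ r | no s∉α | no s∉β with Reach.hits r
    ...   | inj₁ s∈C = finish t∈ r β [] qβ ndβ (inj₂ ∘ inj₂) s∈C NoDup-[x] (λ { (here refl) → inj₁ s∈C })
              (λ { (here refl) (here refl) → Reach.target≢q r refl ; (there y∈β) (here refl) → s∉β y∈β })
    ...   | inj₂ (inj₁ s∈) = contradiction s∈ s∉α
    ...   | inj₂ (inj₂ s∈) = contradiction s∈ s∉β
    reroute : Fan q T′
    reroute with hit (connected q t₀ p (λ { refl → q∉T t₀∈ }) p≢q) (inj₂ (inj₁ (here refl))) (S∥T t₀∈)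
    ... | inj₁ r            = build t₀∈ r
    ... | inj₂ (t , t∈ , r) = build t∈ r

-- Longest cycles through a fixed vertex

-- The odd 1 of `2 * k + 1` is lost in rounding, so an even count gives what the bound `2 * k` would
-- give.
half : ∀ x y → 2 * x ≤ 2 * y + 1 → x ≤ y
half x y p = case x ≤? y of λ
  { (yes q) → q
  ; (no ¬q) → ⊥-elim (<⇒≱ (lin (suc (2 * y + 1)) (2 * x) 0 (*-monoʳ-≤ 2 (≰⇒> ¬q)) (eq x y)) p) }
  where
  eq : ∀ x y → 2 * x + suc (2 * y + 1) + 0 ≡ 2 * suc y + 2 * x
  eq x y = solve (x ∷ y ∷ [])

record Setting {n : ℕ} (G : Graph n) (k : ℕ) (w : Fin n) : Set where
  field
    2≤k : 2 ≤ k
    connected : ∀ x u v → u ≢ x → v ≢ x → Walk G (λ t → t ≢ x) u v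
    circumference : ∀ {xs} → Walks.Closed G xs → NoDup xs → 3 ≤ length xs → length xs ≤ 2 * k + 1
    good : ∀ {v} → v ≢ w → k ≤ degree G v

record Longest {n : ℕ} (G : Graph n) (w : Fin n) (L : List (Fin n)) : Set where
  open Walks G
  field
    closed  : Closed L
    nd      : NoDup L
    3≤      : 3 ≤ length L
    w∈      : w ∈ L
    maximal : ∀ {xs} → Closed xs → NoDup xs → 3 ≤ length xs → w ∈ xs → length xs ≤ length L

module Around {n : ℕ} {G : Graph n} {k : ℕ} {w : Fin n} (setting : Setting G k w)
  {L : List (Fin n)} (longest-L : Longest G w L) where

  open Setting setting
  open Walks G
  open Longest longest-L public
  open Fans G connected L

  -- Any cycle on the vertices of `L`, so that `L` can be opened at any vertex and read in either
  -- direction without a standard form.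
  record IsC (xs : List (Fin n)) : Set where
    constructor isC
    field
      closed′ : Closed xs
      same    : xs ≋ L
  open IsC public

  IsC-nd : ∀ {xs} → IsC xs → NoDup xs
  IsC-nd c = NoDup-⊑ (≋⇒⊑ (same c)) nd

  IsC-length : ∀ {xs} → IsC xs → length xs ≡ length L
  IsC-length c = ≋-length (IsC-nd c) (same c)

  IsC-∈ : ∀ {xs u} → IsC xs → u ∈ xs → u ∈ L
  IsC-∈ c = ⊑-∈ (≋⇒⊑ (same c))

  ∈-IsC : ∀ {xs u} → IsC xs → u ∈ L → u ∈ xs
  ∈-IsC c = ⊑-∈ (≋⇒⊑ (≋-sym (same c)))

  IsC-L : IsC L
  IsC-L = isC closed (perm λ _ → refl)

  IsC-rotate : ∀ xs ys → IsC (xs ++ ys) → IsC (ys ++ xs)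
  IsC-rotate xs ys c = isC (Closed-rotate xs ys (closed′ c))
    (≋-trans (≋-by (xs ∷ ys ∷ []) (` 1 ⊕ ` 0) (` 0 ⊕ ` 1)) (same c))

  swap : ∀ {a b} g h → IsC (a ∷ g ++ b ∷ h) → IsC (b ∷ h ++ a ∷ g)
  swap {a} {b} g h = IsC-rotate (a ∷ g) (b ∷ h)

  flip : ∀ {a b} g h → IsC (a ∷ g ++ b ∷ h) → IsC (b ∷ reverse g ++ a ∷ reverse h)
  flip {a} {b} g h c = let (p , q) = W-split g (closed′ c) in
    isC (W-++ (reverse g) (W-reverse g p) (W-reverse h q))
      (≋-trans (≋-by ((a ∷ []) ∷ g ∷ (b ∷ []) ∷ h ∷ []) (` 2 ⊕ rev (` 1) ⊕ ` 0 ⊕ rev (` 3)) (` 0 ⊕ ` 1 ⊕ ` 2 ⊕ ` 3)) (same c))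

  locate : ∀ {x} → x ∈ L → ∃ λ r → IsC (x ∷ r)
  locate {x} x∈ with ∈-∃++ x∈
  ... | ls , rs , e = rs ++ ls , IsC-rotate ls (x ∷ rs) (subst IsC e IsC-L)

  locate₂ : ∀ {x y} → x ∈ L → y ∈ L → x ≢ y → ∃₂ λ g h → IsC (x ∷ g ++ y ∷ h)
  locate₂ {x} {y} x∈ y∈ x≢y with locate x∈
  ... | r , c with ∈-IsC c y∈
  ...   | here refl = contradiction refl x≢y
  ...   | there y∈r with ∈-∃++ y∈r
  ...     | g , h , refl = g , h , c

  |L|≤ : length L ≤ 2 * k + 1
  |L|≤ = circumference closed nd 3≤

  record Out (a : Fin n) (δ : List (Fin n)) (b : Fin n) : Set where
    constructor out
    field
      walk    : W a δ b
      nd-δ    : NoDup δ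
      outside : ∀ {y} → y ∈ δ → y ∉ L

  Out-reverse : ∀ {a b} δ → Out a δ b → Out b (reverse δ) a
  Out-reverse δ (out p q r) = out (W-reverse δ p) (NoDup-⊑ (⊑-by (δ ∷ []) (rev (` 0)) (` 0)) q) (λ y∈ → r (reverse⁻ y∈))

  private
    rerouted : ∀ {a b} g h δ → IsC (a ∷ g ++ b ∷ h) → Out a δ b →
      Closed (a ∷ δ ++ b ∷ h) × NoDup (a ∷ δ ++ b ∷ h)
    rerouted {a} {b} g h δ c (out p q r) = W-++ δ p (proj₂ (W-split g (closed′ c))) ,
      NoDup-⊑ (⊑-by (δ ∷ (a ∷ []) ∷ g ∷ (b ∷ h) ∷ []) (` 1 ⊕ ` 0 ⊕ ` 3) (` 0 ⊕ ` 1 ⊕ ` 2 ⊕ ` 3))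
        (NoDup-++ q (IsC-nd c) (λ y∈ y∈c → r y∈ (IsC-∈ c y∈c)))

    rerouted-length : ∀ {a b : Fin n} δ h → length (a ∷ δ ++ b ∷ h) ≡ 2 + (length δ + length h)
    rerouted-length {a} {b} δ h = cong suc (trans (length-++ δ) (+-suc (length δ) (length h)))

  -- Nothing is assumed about `w`: the new cycle may miss it, so only the circumference bounds it.
  detour₁ : ∀ {a b} g h δ → IsC (a ∷ g ++ b ∷ h) → Out a δ b → 2 + (length δ + length h) ≤ 2 * k + 1
  -- With empty `δ` and `h` the new closed walk would be one edge run to and fro, which is no cycle;
  -- the bound is taken from `L` itself.
  detour₁ {a} {b} g h [] c o = ≤-trans
    (≤-trans (s≤s (≤-trans (m≤n+m (suc (length h)) (length g)) (≤-reflexive (sym (length-++ g)))))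
      (≤-reflexive (IsC-length c))) |L|≤
  detour₁ {a} {b} g h (d ∷ δ) c o = let (p , q) = rerouted g h (d ∷ δ) c o in
    ≤-trans (≤-reflexive (sym (rerouted-length {a} {b} (d ∷ δ) h)))
      (circumference p q (≤-trans (s≤s (s≤s (s≤s z≤n))) (≤-reflexive (sym (rerouted-length {a} {b} (d ∷ δ) h)))))

  -- Here the new cycle keeps `w` and is a competitor of `L`.
  detour₂ : ∀ {a b} g h δ → IsC (a ∷ g ++ b ∷ h) → Out a δ b → w ∉ g → length δ ≤ length g
  detour₂ g h [] c o w∉g = z≤n
  detour₂ {a} {b} g h (d ∷ δ) c o w∉g = let (p , q) = rerouted g h (d ∷ δ) c o in
    +-cancelʳ-≤ (suc (length h)) (suc (length δ)) (length g) (s≤s⁻¹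
      (≤-trans (≤-reflexive (sym (cong suc (length-++ (d ∷ δ)))))
        (≤-trans (maximal p q (≤-trans (s≤s (s≤s (s≤s z≤n))) (≤-reflexive (sym (rerouted-length {a} {b} (d ∷ δ) h)))) (w∈new (∈-IsC c w∈)))
          (≤-reflexive (trans (sym (IsC-length c)) (cong suc (length-++ g)))))))
    where
    w∈new : w ∈ a ∷ g ++ b ∷ h → w ∈ a ∷ (d ∷ δ) ++ b ∷ h
    w∈new (here e)  = here e
    w∈new (there p) = [ (λ q → contradiction q w∉g) , (λ q → ∈-++⁺ʳ (a ∷ d ∷ δ) q) ]′ (∈-++⁻ g p)

  -- `w` misses one of the two arcs between `a` and `b`. By `detour₂` the path `δ` is no longer than
  -- this arc, and by `detour₁` the two together make a cycle of length at most `2 * k + 1`; adding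
  -- gives `2 * suc (length δ) ≤ 2 * k + 1`.
  detour-short : ∀ {a b} δ → a ∈ L → b ∈ L → a ≢ b → Out a δ b → length δ < k
  detour-short {a} {b} δ a∈ b∈ a≢b o with locate₂ a∈ b∈ a≢b
  ... | g , h , c with w ∈? g
  ...   | no w∉g = half (suc (length δ)) k (lin (2 * suc (length δ)) (2 * k + 1) 0
            (+-mono-≤ (detour₂ g h δ c o w∉g)
              (subst (λ l → 2 + (l + length g) ≤ 2 * k + 1) (length-reverse δ) (detour₁ h g (reverse δ) (swap g h c) (Out-reverse δ o))))
            (eq (length δ) (length g) (2 * k + 1)))
    where
    eq : ∀ d g m → g + m + 2 * suc d + 0 ≡ d + (2 + (d + g)) + m
    eq d g m = solve (d ∷ g ∷ m ∷ [])
  ...   | yes w∈g = half (suc (length δ)) k (lin (2 * suc (length δ)) (2 * k + 1) 0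
            (+-mono-≤
              (subst (_≤ length h) (length-reverse δ) (detour₂ h g (reverse δ) (swap g h c) (Out-reverse δ o)
                (λ w∈h → NoDup-disjoint {xs = g} (NoDup-tail (IsC-nd c)) w∈g (there w∈h))))
              (detour₁ g h δ c o))
            (eq (length δ) (length h) (2 * k + 1)))
    where
    eq : ∀ d g m → g + m + 2 * suc d + 0 ≡ d + (2 + (d + g)) + m
    eq d g m = solve (d ∷ g ∷ m ∷ [])

  two-on-L : ∃₂ λ c₁ c₂ → c₁ ∈ L × c₂ ∈ L × c₁ ≢ c₂
  two-on-L = two-∈ L nd (≤-trans (n≤1+n 2) 3≤)

  Feeler : List (Fin n) → Set
  Feeler []       = ⊥
  Feeler (x ∷ qs) = x ∈ L × (∀ {y} → y ∈ qs → y ∉ L) × Path x qs × NoDup (x ∷ qs)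

  Feeler? : ∀ xs → Dec (Feeler xs)
  Feeler? []       = no λ ()
  Feeler? (x ∷ qs) = (x ∈? L) ×-dec (map′ (λ p {y} → All.lookup p) (λ f → All.tabulate f) (All.all? (λ y → ¬? (y ∈? L)) qs)
    ×-dec (Path? x qs ×-dec NoDup? (x ∷ qs)))

  Feeler-nd : ∀ {xs} → Feeler xs → NoDup xs
  Feeler-nd {x ∷ qs} (_ , _ , _ , p) = p

  off-L⇒≢w : ∀ {v} → v ∉ L → v ≢ w
  off-L⇒≢w v∉ refl = v∉ w∈

  private
    tail-∈ : ∀ {x qs q rs y} (ls : List (Fin n)) → x ∷ qs ≡ ls ++ q ∷ rs → y ∈ rs → y ∈ qs
    tail-∈ []       refl y∈ = y∈
    tail-∈ (_ ∷ ls) refl y∈ = ∈-++⁺ʳ ls (there y∈)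

    end-∈-tail : ∀ {x} qs → qs ≢ [] → end x qs ∈ qs
    end-∈-tail []       ne = contradiction refl ne
    end-∈-tail (y ∷ ys) ne = end-∈ y ys

    -- The part of the feeler before `q`, reversed, is the path from `q` to `L` along which `fan`
    -- does its induction.
    back : ∀ {x qs q rs} ls → x ∷ qs ≡ ls ++ q ∷ rs → Feeler (x ∷ qs) →
      ∃ λ γ → ToC q γ × (∀ {y} → y ∈ γ → y ∉ rs) × NoDup (q ∷ γ)
    back []       refl (x∈ , _ , _ , _) = [] , x∈ , (λ ()) , NoDup-[x]
    back {x} {q = q} {rs} (_ ∷ ls) refl (x∈ , qs∥L , path , ndQ) = reverse ls ++ x ∷ [] ,
      ToC-join (reverse ls) (W-reverse ls (proj₁ (Path-split ls path))) (qs∥L (∈-++⁺ʳ ls (here refl)))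
        (λ y∈ → qs∥L (∈-++⁺ˡ (reverse⁻ {xs = ls} y∈))) x∈ ,
      (λ y∈ y∈rs → NoDup-disjoint {xs = x ∷ ls} ndQ
        ([ there ∘ reverse⁻ , (λ { (here refl) → here refl }) ]′ (∈-++⁻ (reverse ls) y∈)) (there y∈rs)) ,
      NoDup-⊑ (⊑-by ((x ∷ []) ∷ ls ∷ (q ∷ []) ∷ rs ∷ []) (` 2 ⊕ (rev (` 1) ⊕ ` 0)) (` 0 ⊕ ` 1 ⊕ ` 2 ⊕ ` 3)) ndQ

  -- The last vertex e of a longest feeler has all its neighbours on it; a fan from the segment spanned by these
  -- neighbours, traversed so as to visit all of them, gives a detour with at least k inner vertices.
  private
    module LongFeeler (x : Fin n) (qs : List (Fin n)) (x∈ : x ∈ L) (qs∥L : ∀ {y} → y ∈ qs → y ∉ L)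
      (path : Path x qs) (ndQ : NoDup (x ∷ qs)) (longestQ : ∀ {zs} → Feeler zs → length zs ≤ suc (length qs))
      (k≤ : k ≤ length qs) where

      e : Fin n
      e = end x qs

      e∈qs : e ∈ qs
      e∈qs = end-∈-tail qs (λ { refl → contradiction (≤-trans 2≤k k≤) λ () })

      k≤deg : k ≤ degree G e
      k≤deg = good (off-L⇒≢w (qs∥L e∈qs))

      -- A neighbour outside `L` would extend the feeler; one on `L` other than `x` would turn it
      -- into a detour with at least `k` inner vertices.
      nbr : ∀ {t} → Adj G e t → t ∈ x ∷ qs
      nbr {t} a with t ∈? (x ∷ qs) | t ∈? L
      ... | yes p | _ = p
      ... | no t∉ | yes t∈L = contradiction
        (detour-short qs x∈ t∈L (λ { refl → t∉ (here refl) }) (out (W-close qs path a) (NoDup-tail ndQ) qs∥L)) (≤⇒≯ k≤)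
      ... | no t∉ | no t∉L = contradiction (longestQ {x ∷ qs ++ t ∷ []} extended)
        (<⇒≱ (s≤s (≤-reflexive (trans (+-comm 1 (length qs)) (sym (length-++ qs))))))
        where
        extended : Feeler (x ∷ qs ++ t ∷ [])
        extended = x∈ , (λ y∈ → [ qs∥L , (λ { (here refl) → t∉L }) ]′ (∈-++⁻ qs y∈)) ,
          Path-++ qs (W-close qs path a) tt ,
          NoDup-++ ndQ NoDup-[x] λ { y∈ (here refl) → t∉ y∈ }

      module _ (ls : List (Fin n)) (q : Fin n) (rs : List (Fin n)) (split : x ∷ qs ≡ ls ++ q ∷ rs) (e~q : Adj G e q)
        (first-nbr : ∀ t → t ∈ ls → ¬ Adj G e t) where

        path-rs : Path q rs
        path-rs = proj₁ (Path-suffix ls split path)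

        nd-split : NoDup (ls ++ q ∷ rs)
        nd-split = subst NoDup split ndQ

        nd-qrs : NoDup (q ∷ rs)
        nd-qrs = NoDup-⊑ (⊑-by (ls ∷ (q ∷ rs) ∷ []) (` 1) (` 0 ⊕ ` 1)) nd-split

        e∈rs : e ∈ rs
        e∈rs = subst (_∈ rs) (sym end≡) (end-∈-tail rs (λ { refl → adj⇒≢ e~q end≡ }))
          where
          end≡ : e ≡ end q rs
          end≡ = proj₂ (Path-suffix ls split path)

        rs∥L : ∀ {y} → y ∈ rs → y ∉ L
        rs∥L y∈ = qs∥L (tail-∈ ls split y∈)

        nbr′ : ∀ {y} → Adj G e y → y ∈ q ∷ rs
        nbr′ a = [ (λ y∈ → contradiction a (first-nbr _ y∈)) , id ]′ (∈-++⁻ ls (subst (_ ∈_) split (nbr a)))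

        record Sweep (t : Fin n) : Set where
          field
            μ      : List (Fin n)
            path-μ : Path q μ
            end-μ  : end q μ ≡ t
            μ⊑     : q ∷ μ ⊑ q ∷ rs
            e∈μ    : e ∈ q ∷ μ
            covers : ∀ {y} → Adj G e y → y ∈ q ∷ μ

        -- Go from `q` to the last neighbour `b` of `e` before `t`, jump to `e`, and come back along
        -- the feeler to `t`. The vertices skipped lie strictly between `b` and `t`, where `e` has
        -- no neighbours.
        sweep : ∀ {t} → t ∈ rs → Sweep t
        sweep {t} t∈ with ∈-∃++ t∈
        ... | M₁ , M₂ , refl with last (Adj? e) {q ∷ M₁} (here refl) e~q | Path-reverse t M₂ (proj₂ (Path-split M₁ path-rs))
        ...   | [] , b , N , refl , _ , last-nbr | vs , eq , pv , ev = record
          { μ = e ∷ vs ; path-μ = adj-sym e~q , subst (λ z → Path z vs) (sym e≡) pv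
          ; end-μ = trans (cong (λ z → end z vs) e≡) ev
          ; μ⊑ = subst (λ z → q ∷ z ⊑ q ∷ M₁ ++ t ∷ M₂) eq′
              (⊑-by ((q ∷ []) ∷ M₁ ∷ (t ∷ M₂) ∷ []) (` 0 ⊕ rev (` 2)) (` 0 ⊕ ` 1 ⊕ ` 2))
          ; e∈μ = there (here refl)
          ; covers = λ {y} a → [ (λ { (here refl) → here refl ; (there y∈) → contradiction a (last-nbr _ y∈) })
              , (λ y∈ → there (subst (y ∈_) eq′ (reverse⁺ y∈))) ]′ (∈-++⁻ (q ∷ M₁) (nbr′ a)) }
          where
          e≡ : e ≡ end t M₂
          e≡ = trans (proj₂ (Path-suffix ls split path)) (end-++ q M₁)
          eq′ : reverse (t ∷ M₂) ≡ e ∷ vs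
          eq′ = trans eq (cong (_∷ vs) (sym e≡))
        ...   | _ ∷ M , b , N , refl , e~b , last-nbr | vs , eq , pv , ev = record
          { μ = M ++ b ∷ e ∷ vs
          ; path-μ = Path-++ M (proj₁ (W-split M (proj₁ (Path-split (M ++ b ∷ N) path-rs))))
              (adj-sym e~b , subst (λ z → Path z vs) (sym e≡) pv)
          ; end-μ = trans (end-++ q M) (trans (cong (λ z → end z vs) e≡) ev)
          ; μ⊑ = subst (λ z → q ∷ M ++ b ∷ z ⊑ q ∷ (M ++ b ∷ N) ++ t ∷ M₂) eq′
              (⊑-by ((q ∷ []) ∷ M ∷ (b ∷ []) ∷ N ∷ (t ∷ M₂) ∷ []) (` 0 ⊕ ` 1 ⊕ ` 2 ⊕ rev (` 4)) (` 0 ⊕ (` 1 ⊕ ` 2 ⊕ ` 3) ⊕ ` 4))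
          ; e∈μ = ∈-++⁺ʳ (q ∷ M) (there (here refl))
          ; covers = λ a → [ in-front a , (λ y∈ → ∈-++⁺ʳ (q ∷ M) (there (subst (_ ∈_) eq′ (reverse⁺ y∈)))) ]′ (∈-++⁻ (q ∷ M ++ b ∷ N) (nbr′ a)) }
          where
          e≡ : e ≡ end t M₂
          e≡ = trans (proj₂ (Path-suffix ls split path)) (end-++ q (M ++ b ∷ N))
          eq′ : reverse (t ∷ M₂) ≡ e ∷ vs
          eq′ = trans eq (cong (_∷ vs) (sym e≡))
          in-front : ∀ {y} → Adj G e y → y ∈ (q ∷ M) ++ b ∷ N → y ∈ (q ∷ M) ++ b ∷ e ∷ vs
          in-front a y∈ with ∈-++⁻ (q ∷ M) y∈
          ... | inj₁ y∈M         = ∈-++⁺ˡ y∈M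
          ... | inj₂ (here refl) = ∈-++⁺ʳ (q ∷ M) (here refl)
          ... | inj₂ (there y∈N) = contradiction a (last-nbr _ y∈N)

        absurd′ : Fan q rs → ⊥
        absurd′ (mkFan α β t t∈ qα tβ ndα ndβ α∥β α∥T β∥T) = arms β tβ ndβ α∥β β∥T α qα ndα α∥β α∥T
          where
          open Sweep (sweep t∈)
          -- `q ∷ μ` contains all neighbours of `e`, at least `k` of them, and `e` itself. So `μ`
          -- still has `k` vertices without `q`, which may lie on `L` and then is not an inner
          -- vertex of the detour.
          k≤μ : k ≤ length μ
          k≤μ = s≤s⁻¹ (≤-trans (s≤s k≤deg) (degree-< e e∈μ covers))
          μ-∈ : ∀ {y} → y ∈ μ → y ∈ rs
          μ-∈ y∈ with ⊑-∈ μ⊑ (there y∈)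
          ... | here refl = contradiction y∈ (NoDup-head (NoDup-⊑ μ⊑ nd-qrs))
          ... | there y∈rs = y∈rs
          too-long : ∀ {a b} δ₁ δ₂ → a ∈ L → b ∈ L → a ≢ b → Out a (δ₁ ++ (μ ++ δ₂)) b → ⊥
          too-long δ₁ δ₂ a∈ b∈ a≢b o = <⇒≱ (detour-short (δ₁ ++ (μ ++ δ₂)) a∈ b∈ a≢b o)
            (≤-trans k≤μ (≤-trans (≤-trans (m≤m+n (length μ) (length δ₂)) (≤-reflexive (sym (length-++ μ))))
              (≤-trans (m≤n+m (length (μ ++ δ₂)) (length δ₁)) (≤-reflexive (sym (length-++ δ₁))))))
          arms : ∀ β → ToC t β → NoDup (t ∷ β) → (∀ {y} → y ∈ q ∷ α → y ∉ t ∷ β) → (∀ {y} → y ∈ β → y ∉ rs) →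
            ∀ α′ → ToC q α′ → NoDup (q ∷ α′) → (∀ {y} → y ∈ q ∷ α′ → y ∉ t ∷ β) → (∀ {y} → y ∈ α′ → y ∉ rs) → ⊥
          arms [] t∈L _ _ _ _ _ _ _ _ = rs∥L t∈ t∈L
          arms (b₀ ∷ β) tβ ndβ _ β∥T α′ qα′ ndα′ α∥β α∥T with ToC-last β tβ
          ... | ins , c , eq , wk , c∈ , o = go α′ qα′ ndα′ α∥β α∥T
            where
            ins-∈ : ∀ {y} → y ∈ ins → y ∈ b₀ ∷ β
            ins-∈ y∈ = subst (_ ∈_) (sym eq) (∈-++⁺ˡ y∈)
            c∈β : c ∈ b₀ ∷ β
            c∈β = subst (c ∈_) (sym eq) (∈-++⁺ʳ ins (here refl))
            nd-ins : NoDup ins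
            nd-ins = NoDup-⊑ (⊑-by (ins ∷ (c ∷ []) ∷ []) (` 0) (` 0 ⊕ ` 1)) (subst NoDup eq (NoDup-tail ndβ))
            walk-μ : W q (μ ++ ins) c
            walk-μ = W-extend μ path-μ (subst (λ z → W z ins c) (sym end-μ) wk)
            nd-μ : NoDup (μ ++ ins)
            nd-μ = NoDup-++ (NoDup-tail (NoDup-⊑ μ⊑ nd-qrs)) nd-ins (λ y∈μ y∈ → β∥T (ins-∈ y∈) (μ-∈ y∈μ))
            μ∥L : ∀ {y} → y ∈ μ ++ ins → y ∉ L
            μ∥L y∈ = [ rs∥L ∘ μ-∈ , o ∘ there ]′ (∈-++⁻ μ y∈)
            go : ∀ α′ → ToC q α′ → NoDup (q ∷ α′) → (∀ {y} → y ∈ q ∷ α′ → y ∉ t ∷ b₀ ∷ β) → (∀ {y} → y ∈ α′ → y ∉ rs) → ⊥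
            go [] q∈L _ α∥β _ = too-long [] ins q∈L c∈ (λ { refl → α∥β (here refl) (there c∈β) }) (out walk-μ nd-μ μ∥L)
            go (a₀ ∷ α′) qα′ ndα′ α∥β α∥T with ToC-last α′ qα′
            ... | ins′ , c′ , eq′ , wk′ , c′∈ , o′ = too-long (reverse ins′ ++ q ∷ []) ins c′∈ c∈
              (λ { refl → α∥β (there (subst (c′ ∈_) (sym eq′) (∈-++⁺ʳ ins′ (here refl)))) (there c∈β) })
              (subst (λ z → Out c′ z c) (sym (++-assoc (reverse ins′) (q ∷ []) (μ ++ ins)))
              (out (W-++ (reverse ins′) (W-reverse ins′ wk′) walk-μ)
                (NoDup-++ (NoDup-⊑ (⊑-by (ins′ ∷ (c′ ∷ []) ∷ []) (rev (` 0)) (` 0 ⊕ ` 1)) (subst NoDup eq′ (NoDup-tail ndα′)))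
                  (NoDup-∷ (λ q∈ → [ (λ q∈μ → NoDup-head nd-qrs (μ-∈ q∈μ)) , (λ q∈ins → α∥β (here refl) (there (ins-∈ q∈ins))) ]′ (∈-++⁻ μ q∈)) nd-μ)
                  λ { y∈ (here refl) → NoDup-head ndα′ (ins′-∈ (reverse⁻ y∈))
                    ; y∈ (there z∈) → [ (λ z∈μ → α∥T (ins′-∈ (reverse⁻ y∈)) (μ-∈ z∈μ)) , (λ z∈ins → α∥β (there (ins′-∈ (reverse⁻ y∈))) (there (ins-∈ z∈ins))) ]′ (∈-++⁻ μ z∈) })
                λ y∈ → [ (λ y∈′ → o′ (there (reverse⁻ y∈′))) , (λ { (here refl) → o′ (here refl) ; (there z∈) → μ∥L z∈ }) ]′ (∈-++⁻ (reverse ins′) y∈)))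
              where
              ins′-∈ : ∀ {y} → y ∈ ins′ → y ∈ a₀ ∷ α′
              ins′-∈ y∈ = subst (_ ∈_) (sym eq′) (∈-++⁺ˡ y∈)

      absurd : ⊥
      absurd with any? (Adj? e)
      ... | no ¬a = contradiction (≤-trans 2≤k (≤-trans k≤deg (degree-⊆ e {[]} (λ {u} a → contradiction (u , a) ¬a)))) λ ()
      ... | yes (u , a) with first (Adj? e) (nbr a) a
      ...   | ls , q , rs , split , e~q , fst =
        let (γ , qγ , γ∥T , ndγ) = back ls split (x∈ , qs∥L , path , ndQ)
            (c₁ , c₂ , c₁∈ , c₂∈ , c₁≢c₂) = two-on-L
        in absurd′ ls q rs split e~q fst (fan c₁∈ c₂∈ c₁≢c₂ q rs γ qγ γ∥T ndγ
             (NoDup-head (nd-qrs ls q rs split e~q fst)) (rs∥L ls q rs split e~q fst) (e∈rs ls q rs split e~q fst))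

  -- Such a path is tied to `L` at one end only, so `detour-short` does not apply to it. The bound
  -- ensures, through `short`, that the ends of a longest outside path have room for at least two
  -- neighbours on `L`.
  feeler-short : ∀ {x qs} → Feeler (x ∷ qs) → length qs < k
  feeler-short {x} {qs} f = case longest Feeler? Feeler-nd f of λ
    { (y ∷ rs , (y∈ , o , p , nd′) , mx) → case k ≤? length rs of λ
      { (yes k≤) → ⊥-elim (LongFeeler.absurd y rs y∈ o p nd′ mx k≤)
      ; (no k≰)  → ≤-<-trans (s≤s⁻¹ (mx f)) (≰⇒> k≰) } }

-- Marked cycles: blocks consisting of a mark and the gap following it

module _ {n : ℕ} where

  Blocks : Set
  Blocks = List (Fin n × List (Fin n))

  flat : Blocks → List (Fin n)
  flat []             = []
  flat ((m , g) ∷ bs) = m ∷ g ++ flat bs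

  marks : Blocks → List (Fin n)
  marks = map proj₁

  marks-⊑ : ∀ bs → marks bs ⊑ flat bs
  marks-⊑ bs = sub (bound bs)
    where
    bound : ∀ bs u → occ u (marks bs) ≤ occ u (flat bs)
    bound []             u = z≤n
    bound ((m , g) ∷ bs) u = +-monoʳ-≤ (δ u m) (≤-trans (bound bs u)
      (≤-trans (m≤n+m (occ u (flat bs)) (occ u g)) (≤-reflexive (sym (occ-++ u g (flat bs))))))

  record Parse (M : Fin n → Set) (xs : List (Fin n)) : Set where
    constructor parsed
    field
      pre     : List (Fin n)
      bs      : Blocks
      split   : xs ≡ pre ++ flat bs
      pre-out : ∀ {y} → y ∈ pre → ¬ M y
      block   : ∀ {m g} → (m , g) ∈ bs → M m × (∀ {y} → y ∈ g → ¬ M y)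

  parse : ∀ {M} → (∀ u → Dec (M u)) → ∀ xs → Parse M xs
  parse M? [] = parsed [] [] refl (λ ()) (λ ())
  parse M? (x ∷ xs) with M? x | parse M? xs
  ... | yes m | parsed pre bs refl o b = parsed [] ((x , pre) ∷ bs) refl (λ ())
    λ { (here refl) → m , o ; (there p) → b p }
  ... | no ¬m | parsed pre bs refl o b = parsed (x ∷ pre) bs refl (λ { (here refl) → ¬m ; (there p) → o p }) b

  block-of : ∀ {bs : Blocks} {y} → y ∈ flat bs → y ∈ marks bs ⊎ ∃₂ λ m g → (m , g) ∈ bs × y ∈ g
  block-of {(m , g) ∷ bs} (here refl) = inj₁ (here refl)
  block-of {(m , g) ∷ bs} (there p) with ∈-++⁻ g p
  ... | inj₁ q = inj₂ (m , g , here refl , q)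
  ... | inj₂ q with block-of {bs} q
  ...   | inj₁ r = inj₁ (there r)
  ...   | inj₂ (m′ , g′ , r , s) = inj₂ (m′ , g′ , there r , s)

  parse-marks : ∀ {M xs} (p : Parse M xs) {y} → y ∈ xs → M y → y ∈ marks (Parse.bs p)
  parse-marks (parsed pre bs refl o b) y∈ my with ∈-++⁻ pre y∈
  ... | inj₁ q = contradiction my (o q)
  ... | inj₂ q with block-of {bs} q
  ...   | inj₁ r = r
  ...   | inj₂ (m , g , r , s) = contradiction my (proj₂ (b r) s)

  -- The number of vertices from the first to the last mark.
  span : Blocks → ℕ
  span []                        = 0
  span ((m , g) ∷ [])            = 1
  span ((m , g) ∷ (m′ , g′) ∷ bs) = suc (length g + span ((m′ , g′) ∷ bs))

  last-mark : Fin n → Blocks → Fin n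
  last-mark m []              = m
  last-mark m ((m′ , _) ∷ bs) = last-mark m′ bs

  last-mark-∈ : ∀ m g bs → last-mark m bs ∈ marks ((m , g) ∷ bs)
  last-mark-∈ m g []               = here refl
  last-mark-∈ m g ((m′ , g′) ∷ bs) = there (last-mark-∈ m′ g′ bs)

  flat-last : ∀ m g b bs → ∃₂ λ inner gₗ →
    flat ((m , g) ∷ b ∷ bs) ≡ m ∷ inner ++ last-mark m (b ∷ bs) ∷ gₗ × span ((m , g) ∷ b ∷ bs) ≡ 2 + length inner
  flat-last m g (m′ , g′) [] = g , g′ , cong (λ z → m ∷ g ++ m′ ∷ z) (++-identityʳ g′) , cong suc (+-comm (length g) 1)
  flat-last m g (m′ , g′) (b ∷ bs) with flat-last m′ g′ b bs
  ... | inner , gₗ , e , f = g ++ m′ ∷ inner , gₗ ,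
    cong (m ∷_) (trans (cong (g ++_) e) (sym (++-assoc g (m′ ∷ inner) _))) ,
    trans (cong (λ z → suc (length g + z)) f) (trans (eq (length g) (length inner)) (cong (2 +_) (sym (length-++ g))))
    where
    eq : ∀ a b → suc (a + (2 + b)) ≡ 2 + (a + suc b)
    eq a b = solve (a ∷ b ∷ [])

  Chain : (Fin n → List (Fin n) → Fin n → Set) → Blocks → Set
  Chain R []                         = ⊤
  Chain R ((m , g) ∷ [])             = ⊤
  Chain R ((m , g) ∷ (m′ , g′) ∷ bs) = R m g m′ × Chain R ((m′ , g′) ∷ bs)

  Chain-map : ∀ {R S : Fin n → List (Fin n) → Fin n → Set} bs →
    (∀ {m g m′} → m ∈ marks bs → m′ ∈ marks bs → R m g m′ → S m g m′) → Chain R bs → Chain S bs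
  Chain-map []                         f c       = tt
  Chain-map ((m , g) ∷ [])             f c       = tt
  Chain-map ((m , g) ∷ (m′ , g′) ∷ bs) f (r , c) =
    f (here refl) (there (here refl)) r , Chain-map ((m′ , g′) ∷ bs) (λ p q → f (there p) (there q)) c

  -- `X` and `Y` stand for adjacency to the two ends of an outside path on `p + 1` vertices. Between
  -- two neighbours of the same end one vertex can be inserted, between neighbours of different ends
  -- the whole path.
  record Gap (X Y : Fin n → Set) (p : ℕ) (m : Fin n) (g : List (Fin n)) (m′ : Fin n) : Set where
    constructor gap
    field
      1≤g : 1 ≤ length g
      XY  : X m → Y m′ → suc p ≤ length g
      YX  : Y m → X m′ → suc p ≤ length g

  Gap-sym : ∀ {X Y p} bs → Chain (Gap X Y p) bs → Chain (Gap Y X p) bs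
  Gap-sym bs = Chain-map bs (λ _ _ (gap a b c) → gap a c b)

  span-≥ : ∀ {X Y p} bs → Chain (Gap X Y p) bs → 2 * length bs ≤ suc (span bs)
  span-≥ []                         c       = z≤n
  span-≥ ((m , g) ∷ [])             c       = ≤-refl
  span-≥ ((m , g) ∷ (m′ , g′) ∷ bs) (r , c) =
    lin _ _ 0 (+-mono-≤ (Gap.1≤g r) (span-≥ ((m′ , g′) ∷ bs) c)) (eq (length g) (span ((m′ , g′) ∷ bs)) (length bs))
    where
    eq : ∀ g s b → g + suc s + 2 * (2 + b) + 0 ≡ 1 + 2 * suc b + suc (suc (g + s))
    eq g s b = solve (g ∷ s ∷ b ∷ [])

  -- Some gap has an `X` mark before it and a `Y` mark after it; it holds at least `p + 1` vertices
  -- where `span-≥` counts one.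
  span-change : ∀ {X Y : Fin n → Set} {p} → (∀ u → Dec (Y u)) → ∀ m g b bs → Chain (Gap X Y p) ((m , g) ∷ b ∷ bs) →
    (∀ {m′} → m′ ∈ marks (b ∷ bs) → X m′ ⊎ Y m′) → X m → Y (last-mark m (b ∷ bs)) →
    2 * length ((m , g) ∷ b ∷ bs) + p ≤ suc (span ((m , g) ∷ b ∷ bs))
  span-change {p = p} Y? m g (m′ , g′) bs (r , c) XorY xm yl with Y? m′
  ... | yes ym′ = lin _ _ 0 (+-mono-≤ (Gap.XY r xm ym′) (span-≥ ((m′ , g′) ∷ bs) c))
      (eq (length g) (span ((m′ , g′) ∷ bs)) (length bs) p)
    where
    eq : ∀ g s b p → g + suc s + (2 * (2 + b) + p) + 0 ≡ suc p + 2 * suc b + suc (suc (g + s))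
    eq g s b p = solve (g ∷ s ∷ b ∷ p ∷ [])
  span-change {p = p} Y? m g (m′ , g′) [] (r , c) XorY xm yl | no ¬y = contradiction yl ¬y
  span-change {p = p} Y? m g (m′ , g′) (b ∷ bs) (r , c) XorY xm yl | no ¬y with XorY (here refl)
  ... | inj₂ ym′ = contradiction ym′ ¬y
  ... | inj₁ xm′ = lin _ _ 0 (+-mono-≤ (Gap.1≤g r) (span-change Y? m′ g′ b bs c (XorY ∘ there) xm′ yl))
      (eq (length g) (span ((m′ , g′) ∷ b ∷ bs)) (length bs) p)
    where
    eq : ∀ g s b p → g + suc s + (2 * (3 + b) + p) + 0 ≡ 1 + (2 * (2 + b) + p) + suc (suc (g + s))
    eq g s b p = solve (g ∷ s ∷ b ∷ p ∷ [])

  -- The marks pass from `X` to `Y` and back again, so two gaps are long.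
  span-two-changes : ∀ {X Y : Fin n → Set} {p} → (∀ u → Dec (X u)) → (∀ u → Dec (Y u)) → ∀ m g b bs →
    Chain (Gap X Y p) ((m , g) ∷ b ∷ bs) → (∀ {m′} → m′ ∈ marks (b ∷ bs) → X m′ ⊎ Y m′) → X m →
    X (last-mark m (b ∷ bs)) → ¬ Y (last-mark m (b ∷ bs)) → ∀ {y} → y ∈ marks (b ∷ bs) → Y y →
    2 * length ((m , g) ∷ b ∷ bs) + 2 * p ≤ suc (span ((m , g) ∷ b ∷ bs))
  span-two-changes {p = p} X? Y? m g (m′ , g′) bs (r , c) XorY xm xl ¬yl y∈ yy with Y? m′
  span-two-changes {p = p} X? Y? m g (m′ , g′) [] (r , c) XorY xm xl ¬yl y∈ yy | yes ym′ = contradiction ym′ ¬yl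
  span-two-changes {p = p} X? Y? m g (m′ , g′) (b ∷ bs) (r , c) XorY xm xl ¬yl y∈ yy | yes ym′ =
    lin _ _ 0 (+-mono-≤ (Gap.XY r xm ym′)
      (span-change X? m′ g′ b bs (Gap-sym ((m′ , g′) ∷ b ∷ bs) c) (λ q → [ inj₂ , inj₁ ]′ (XorY (there q))) ym′ xl))
      (eq (length g) (span ((m′ , g′) ∷ b ∷ bs)) (length bs) p)
    where
    eq : ∀ g s b p → g + suc s + (2 * (3 + b) + 2 * p) + 0 ≡ suc p + (2 * (2 + b) + p) + suc (suc (g + s))
    eq g s b p = solve (g ∷ s ∷ b ∷ p ∷ [])
  span-two-changes X? Y? m g (m′ , g′) bs (r , c) XorY xm xl ¬yl (here refl) yy | no ¬y = contradiction yy ¬y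
  span-two-changes {p = p} X? Y? m g (m′ , g′) (b ∷ bs) (r , c) XorY xm xl ¬yl (there y∈) yy | no ¬y with XorY (here refl)
  ... | inj₂ ym′ = contradiction ym′ ¬y
  ... | inj₁ xm′ = lin _ _ 0 (+-mono-≤ (Gap.1≤g r) (span-two-changes X? Y? m′ g′ b bs c (XorY ∘ there) xm′ xl ¬yl y∈ yy))
      (eq (length g) (span ((m′ , g′) ∷ b ∷ bs)) (length bs) p)
    where
    eq : ∀ g s b p → g + suc s + (2 * (3 + b) + 2 * p) + 0 ≡ 1 + (2 * (2 + b) + 2 * p) + suc (suc (g + s))
    eq g s b p = solve (g ∷ s ∷ b ∷ p ∷ [])

  span-all : ∀ {X Y p} bs → Chain (Gap X Y p) bs → (∀ {m} → m ∈ marks bs → X m × Y m) →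
    length bs * (2 + p) ≤ span bs + suc p
  span-all []                         c       xy = z≤n
  span-all {p = p} ((m , g) ∷ [])     c       xy = ≤-reflexive (+-identityʳ (2 + p))
  span-all {p = p} ((m , g) ∷ (m′ , g′) ∷ bs) (r , c) xy =
    lin _ _ 0 (+-mono-≤ (Gap.XY r (proj₁ (xy (here refl))) (proj₂ (xy (there (here refl)))))
      (span-all ((m′ , g′) ∷ bs) c (xy ∘ there))) (eq (length g) (span ((m′ , g′) ∷ bs)) (length bs * (2 + p)) p)
    where
    eq : ∀ g s b p → g + (s + suc p) + (2 + p + (2 + p + b)) + 0 ≡ suc p + (2 + p + b) + (suc (g + s) + suc p)
    eq g s b p = solve (g ∷ s ∷ b ∷ p ∷ [])

-- With `s = 2 + a` the inequality reduces to `a * p ≤ 1`.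
trichotomy : ∀ s p k → 2 ≤ s → s + p ≡ k → s * (2 + p) ≤ 2 * k + 1 → s ≡ 2 ⊎ p ≡ 0 ⊎ s ≡ 3 × p ≡ 1
trichotomy (suc (suc a)) p .(suc (suc a) + p) _ refl l = cases a p small
  where
  eq : ∀ a p → 2 * (2 + a + p) + 1 + a * p + 0 ≡ (2 + a) * (2 + p) + 1
  eq a p = solve (a ∷ p ∷ [])
  small : a * p ≤ 1
  small = lin (a * p) 1 0 l (eq a p)
  cases : ∀ a p → a * p ≤ 1 → 2 + a ≡ 2 ⊎ p ≡ 0 ⊎ 2 + a ≡ 3 × p ≡ 1
  cases zero                p             _ = inj₁ refl
  cases (suc a)             zero          _ = inj₂ (inj₁ refl)
  cases (suc zero)          (suc zero)    _ = inj₂ (inj₂ (refl , refl))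
  cases (suc a)             (suc (suc p)) (s≤s ())
  cases (suc (suc a))       (suc zero)    (s≤s ())
trichotomy (suc zero) p k (s≤s ()) _ _
trichotomy zero p k () _ _

-- The components outside a longest cycle through w

module Outside {n : ℕ} {G : Graph n} {k : ℕ} {w : Fin n} (setting : Setting G k w)
  {L : List (Fin n)} (longest-L : Longest G w L) where

  open Setting setting
  open Walks G
  open Around setting longest-L

  -- `D` is the vertex set of the component of `v` outside `L`, and `X` is its set of neighbours on
  -- `L`. `shape` records what `trichotomy` leaves.
  record Comp (v : Fin n) : Set where
    field
      D X    : List (Fin n)
      v∈D    : v ∈ D
      ndD    : NoDup D
      ndX    : NoDup X
      D∥L    : ∀ {y} → y ∈ D → y ∉ L
      X⊆L    : ∀ {y} → y ∈ X → y ∈ L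
      size   : length X + length D ≡ suc k
      2≤X    : 2 ≤ length X
      shape  : length X ≡ 2 ⊎ length D ≡ 1 ⊎ length X ≡ 3 × length D ≡ 2
      nbr    : ∀ {u y} → u ∈ D → Adj G u y → y ∈ D ⊎ y ∈ X
      clique : ∀ {u y} → u ∈ D → y ∈ D → u ≢ y → Adj G u y
      joined : ∀ {u y} → u ∈ D → y ∈ X → Adj G u y

  gap-∈ : ∀ {bs m g y} → (m , g) ∈ bs → y ∈ g → y ∈ flat {n} bs
  gap-∈ {(m , g) ∷ bs} (here refl) y∈ = there (∈-++⁺ˡ y∈)
  gap-∈ {(m , g) ∷ bs} (there p)   y∈ = there (∈-++⁺ʳ g (gap-∈ p y∈))

  gap-avoids : ∀ {x : Fin n} {r} pre bs → x ∷ r ≡ pre ++ flat bs → NoDup (x ∷ r) → ∀ {m g} → (m , g) ∈ bs → x ∉ g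
  gap-avoids []        ((m , g) ∷ bs) refl nd′ (here refl) x∈ = NoDup-head nd′ (∈-++⁺ˡ x∈)
  gap-avoids []        ((m , g) ∷ bs) refl nd′ (there p)   x∈ = NoDup-head nd′ (∈-++⁺ʳ g (gap-∈ p x∈))
  gap-avoids (_ ∷ pre) bs             refl nd′ p           x∈ = NoDup-head nd′ (∈-++⁺ʳ pre (gap-∈ p x∈))

  Wide : Fin n → List (Fin n) → Fin n → Set
  Wide m g m′ = ∀ δ → Out m δ m′ → length δ ≤ length g

  wide-chain : ∀ pre bs → IsC (pre ++ flat bs) → (∀ {m g} → (m , g) ∈ bs → w ∉ g) → Chain Wide bs
  wide-chain pre []             c o = tt
  wide-chain pre ((m , g) ∷ []) c o = tt
  wide-chain pre ((m , g) ∷ (m′ , g′) ∷ bs) c o =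
    (λ δ p → detour₂ g ((g′ ++ flat bs) ++ pre) δ
      (subst (λ z → IsC (m ∷ z)) (++-assoc g _ pre) (IsC-rotate pre (m ∷ g ++ m′ ∷ g′ ++ flat bs) c)) p (o (here refl))) ,
    wide-chain (pre ++ m ∷ g) ((m′ , g′) ∷ bs) (subst IsC (sym (++-assoc pre (m ∷ g) _)) c) (o ∘ there)

  -- The arc from the last mark round to the first is the only one that can contain `w` inside,
  -- since the cycle is read from `w`; hence `detour₁` and the bound `2 * k + 1`.
  closing : ∀ pre m g b bs → IsC (pre ++ flat ((m , g) ∷ b ∷ bs)) → ∀ δ → Out (last-mark m (b ∷ bs)) δ m →
    span ((m , g) ∷ b ∷ bs) + length δ ≤ 2 * k + 1
  closing pre m g b bs c δ o with flat-last m g b bs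
  ... | inner , gₗ , e , f = subst (λ z → z + length δ ≤ 2 * k + 1) (sym f)
    (≤-trans (≤-reflexive (cong (2 +_) (+-comm (length inner) (length δ))))
      (detour₁ (gₗ ++ pre) inner δ (swap inner (gₗ ++ pre)
        (subst (λ z → IsC (m ∷ z)) (++-assoc inner _ pre) (IsC-rotate pre _ (subst (λ z → IsC (pre ++ z)) e c)))) o))

  -- The path must pass through the given `v`, which will have a neighbour on `L`: this connects the
  -- path to `L` even when neither of its ends has a neighbour there.
  OffPath : Fin n → List (Fin n) → Set
  OffPath v []       = ⊥
  OffPath v (u ∷ us) = Path u us × NoDup (u ∷ us) × (∀ {y} → y ∈ u ∷ us → y ∉ L) × v ∈ u ∷ us

  OffPath? : ∀ v xs → Dec (OffPath v xs)
  OffPath? v []       = no λ ()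
  OffPath? v (u ∷ us) = Path? u us ×-dec (NoDup? (u ∷ us) ×-dec
    (map′ (λ p {y} → All.lookup p) (λ f → All.tabulate f) (All.all? (λ y → ¬? (y ∈? L)) (u ∷ us)) ×-dec (v ∈? (u ∷ us))))

  OffPath-nd : ∀ {v xs} → OffPath v xs → NoDup xs
  OffPath-nd {xs = _ ∷ _} (_ , p , _) = p

  record Ends (u : Fin n) (us : List (Fin n)) : Set where
    field
      X     : List (Fin n)
      ndX   : NoDup X
      X⊆L   : ∀ {y} → y ∈ X → y ∈ L
      size  : length X + length us ≡ k
      2≤X   : 2 ≤ length X
      small : length X * (2 + length us) ≤ 2 * k + 1
      head~us : ∀ {y} → y ∈ us → Adj G u y
      head~X  : ∀ {y} → y ∈ X → Adj G u y
      end~X   : ∀ {y} → y ∈ X → Adj G (end u us) y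
      L~head  : ∀ {y} → y ∈ L → Adj G u y → y ∈ X
      L~end   : ∀ {y} → y ∈ L → Adj G (end u us) y → y ∈ X

  module LongestOff {v x : Fin n} (x∈L : x ∈ L) (x~v : Adj G x v) (N : ℕ)
    (longest-P : ∀ {zs} → OffPath v zs → length zs ≤ N) where

    head-nbr : ∀ {u us t} → OffPath v (u ∷ us) → N ≤ length (u ∷ us) → Adj G u t → t ∉ L → t ∈ us
    head-nbr {u} {us} {t} (p , nd′ , o , v∈) N≤ a t∉L with t ∈? us
    ... | yes t∈ = t∈
    ... | no t∉  = contradiction (longest-P {t ∷ u ∷ us}
      ((adj-sym a , p) , NoDup-∷ (λ { (here refl) → adj⇒≢ a refl ; (there t∈) → t∉ t∈ }) nd′ ,
       cons t∉L o , there v∈)) (<⇒≱ (s≤s N≤))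

    reversed : ∀ {u us} → OffPath v (u ∷ us) → ∃ λ vs →
      OffPath v (end u us ∷ vs) × length vs ≡ length us × end (end u us) vs ≡ u × reverse (u ∷ us) ≡ end u us ∷ vs
    reversed {u} {us} (p , nd′ , o , v∈) with Path-reverse u us p
    ... | vs , e , q , f = vs ,
      (q , subst NoDup e (NoDup-⊑ (⊑-by ((u ∷ us) ∷ []) (rev (` 0)) (` 0)) nd′) ,
       (λ y∈ → o (reverse⁻ (subst (_ ∈_) (sym e) y∈))) , subst (v ∈_) e (reverse⁺ v∈)) ,
      suc-injective (trans (cong length (sym e)) (length-reverse (u ∷ us))) , f , e

    -- If an end of the path sees `L`, the whole path belongs to a feeler. Otherwise all neighbours
    -- of the end `e` are on the path. Enter it from `x` at `v`, run to `e` and, if `e` has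
    -- neighbours in front of `v`, jump to the first of them and continue towards `v`: this feeler
    -- contains all neighbours of `e` and is too long.
    short : ∀ {u us} → OffPath v (u ∷ us) → N ≤ length (u ∷ us) → 2 + length us ≤ k
    short {u} {us} P@(p , nd′ , o , v∈) N≤ with reversed {u} {us} P
    ... | vs , P′@(p′ , nd″ , o′ , _) , l , f , e≡ with any? (λ y → (y ∈? L) ×-dec Adj? u y) | any? (λ y → (y ∈? L) ×-dec Adj? (end u us) y)
    ... | yes (y , y∈ , a) | _ = feeler-short {y} (y∈ , o , (adj-sym a , p) , NoDup-∷ (λ y∈P → o y∈P y∈) nd′)
    ... | no _ | yes (y , y∈ , a) = subst (λ z → suc z < k) l
      (feeler-short {y} (y∈ , o′ , (adj-sym a , p′) , NoDup-∷ (λ y∈P → o′ y∈P y∈) nd″))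
    ... | no _ | no ¬e with ∈-∃++ v∈
    ...   | A , B , split = too-long (Any.any? (Adj? e) A)
      where
      e = end u us
      e∉L : e ∉ L
      e∉L = o (end-∈ u us)
      k≤deg : k ≤ degree G e
      k≤deg = good (off-L⇒≢w e∉L)
      nbr-P : ∀ {y} → Adj G e y → y ∈ A ++ v ∷ B
      nbr-P {y} a with y ∈? L
      ... | yes y∈ = contradiction (y , y∈ , a) ¬e
      ... | no y∉  = subst (y ∈_) split (reverse⁻ (subst (y ∈_) (sym e≡) (there (head-nbr P′ (subst (λ z → N ≤ suc z) (sym l) N≤) a y∉))))
      path-B : Path v B
      path-B = proj₁ (Path-suffix A split p)
      e≡endB : e ≡ end v B
      e≡endB = proj₂ (Path-suffix A split p)
      nd-split : NoDup (A ++ v ∷ B)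
      nd-split = subst NoDup split nd′
      out-split : ∀ {y} → y ∈ A ++ v ∷ B → y ∉ L
      out-split y∈ = o (subst (_ ∈_) (sym split) y∈)
      too-long : Dec (Any (Adj G e) A) → 2 + length us ≤ k
      too-long (no ¬a) = ⊥-elim (<⇒≱ (feeler-short {x} (x∈L , (λ y∈ → out-split (∈-++⁺ʳ A y∈)) , (x~v , path-B) ,
          NoDup-∷ (λ x∈ → out-split (∈-++⁺ʳ A x∈) x∈L) (NoDup-⊑ (⊑-by (A ∷ (v ∷ B) ∷ []) (` 1) (` 0 ⊕ ` 1)) nd-split)))
        (≤-trans k≤deg (degree-⊆ e λ a → [ (λ y∈A → contradiction (Any.map (λ { refl → a }) y∈A) ¬a) , id ]′ (∈-++⁻ A (nbr-P a)))))
      too-long (yes some) with satisfied some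
        where
        satisfied : ∀ {ys} → Any (Adj G e) ys → ∃ λ y → y ∈ ys × Adj G e y
        satisfied (here a)  = _ , here refl , a
        satisfied (there p) = let (y , y∈ , a) = satisfied p in y , there y∈ , a
      ... | y , y∈A , a with first (Adj? e) y∈A a
      ...   | A₁ , b , A₂ , refl , e~b , fst = ⊥-elim (<⇒≱ (feeler-short {x} (x∈L , outs ,
          (x~v , Path-++ B (W-close B path-B (subst (λ z → Adj G z b) e≡endB e~b)) path-A₂) ,
          NoDup-∷ (λ x∈ → outs x∈ x∈L) (NoDup-⊑ reorder nd-split)))
        (≤-trans k≤deg (degree-⊆ e cover)))
        where
        path-A₂ : Path b A₂
        path-A₂ = W⇒Path A₂ (proj₁ (Path-split A₂ (proj₁ (Path-suffix A₁ (trans split (++-assoc A₁ (b ∷ A₂) (v ∷ B))) p))))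
        reorder : v ∷ B ++ b ∷ A₂ ⊑ (A₁ ++ b ∷ A₂) ++ v ∷ B
        reorder = ⊑-by (A₁ ∷ (b ∷ A₂) ∷ (v ∷ B) ∷ []) (` 2 ⊕ ` 1) ((` 0 ⊕ ` 1) ⊕ ` 2)
        outs : ∀ {y} → y ∈ v ∷ B ++ b ∷ A₂ → y ∉ L
        outs y∈ = out-split (⊑-∈ reorder y∈)
        cover : ∀ {y} → Adj G e y → y ∈ v ∷ B ++ b ∷ A₂
        cover a with ∈-++⁻ (A₁ ++ b ∷ A₂) (nbr-P a)
        ... | inj₂ y∈ = ∈-++⁺ˡ y∈
        ... | inj₁ y∈ = [ (λ y∈A₁ → contradiction a (fst _ y∈A₁)) , ∈-++⁺ʳ (v ∷ B) ]′ (∈-++⁻ A₁ y∈)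

    -- Both ends of a longest off-cycle path send at least k - p edges to the cycle; counting the gaps between the
    -- marked vertices of the cycle leaves room for exactly k - p marks, each of them adjacent to both ends.
    ends : ∀ {u us} → OffPath v (u ∷ us) → N ≤ length (u ∷ us) → Ends u us
    ends {u} {us} P@(p , ndP , o , v∈) N≤ with reversed {u} {us} P
    ... | vs , P′@(p′ , ndP′ , o′ , _) , l , f , e≡ with locate w∈
    ... | r , c with parse (λ y → Adj? u y ⊎-dec Adj? (end u us) y) (w ∷ r)
    ... | parsed pre bs split po bl = result bs refl
      where
      e = end u us
      q = length us
      pr : Parse (λ y → Adj G u y ⊎ Adj G e y) (w ∷ r)
      pr = parsed pre bs split po bl
      c′ : IsC (pre ++ flat bs)
      c′ = subst IsC split c
      mark-L : ∀ {y} → y ∈ marks bs → y ∈ L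
      mark-L y∈ = IsC-∈ c′ (∈-++⁺ʳ pre (⊑-∈ (marks-⊑ bs) y∈))
      L-mark : ∀ {y} → y ∈ L → Adj G u y ⊎ Adj G e y → y ∈ marks bs
      L-mark y∈ m = parse-marks pr (∈-IsC c y∈) m
      mark-M : ∀ {y} → y ∈ marks bs → Adj G u y ⊎ Adj G e y
      mark-M y∈ with ∈-map⁻ proj₁ y∈
      ... | (m , g) , mg∈ , refl = proj₁ (bl mg∈)
      nd-marks : NoDup (marks bs)
      nd-marks = NoDup-⊑ (⊑-trans (marks-⊑ bs) (⊑-by (pre ∷ flat bs ∷ []) (` 1) (` 0 ⊕ ` 1))) (IsC-nd c′)
      across : ∀ {m m′} → Adj G u m → Adj G e m′ → Out m (u ∷ us) m′
      across a a′ = out (adj-sym a , W-close us p a′) ndP o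
      across′ : ∀ {m m′} → Adj G e m → Adj G u m′ → Out m (reverse (u ∷ us)) m′
      across′ a a′ = Out-reverse (u ∷ us) (across a′ a)
      single : ∀ {m m′ t} → t ∈ u ∷ us → Adj G t m → Adj G t m′ → Out m (t ∷ []) m′
      single t∈ a a′ = out (adj-sym a , a′) NoDup-[x] (sole (o t∈))
      to-gap : ∀ {m g m′} → m ∈ marks bs → m′ ∈ marks bs → Wide m g m′ → Gap (Adj G u) (Adj G e) q m g m′
      to-gap {m} {g} {m′} m∈ m′∈ wd = gap (one (mark-M m∈) (mark-M m′∈)) xy yx
        where
        xy : Adj G u m → Adj G e m′ → suc q ≤ length g
        xy a b = wd (u ∷ us) (across a b)
        yx : Adj G e m → Adj G u m′ → suc q ≤ length g
        yx a b = subst (_≤ length g) (length-reverse (u ∷ us)) (wd (reverse (u ∷ us)) (across′ a b))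
        one : Adj G u m ⊎ Adj G e m → Adj G u m′ ⊎ Adj G e m′ → 1 ≤ length g
        one (inj₁ a) (inj₁ b) = wd (u ∷ []) (single (here refl) a b)
        one (inj₂ a) (inj₂ b) = wd (e ∷ []) (single (end-∈ u us) a b)
        one (inj₁ a) (inj₂ b) = ≤-trans (s≤s z≤n) (xy a b)
        one (inj₂ a) (inj₁ b) = ≤-trans (s≤s z≤n) (yx a b)
      chain : Chain (Gap (Adj G u) (Adj G e) q) bs
      chain = Chain-map bs to-gap (wide-chain pre bs c′ (gap-avoids pre bs split (IsC-nd c)))
      cover-u : ∀ {y} → Adj G u y → y ∈ us ++ marks bs
      cover-u {y} a with y ∈? L
      ... | yes y∈ = ∈-++⁺ʳ us (L-mark y∈ (inj₁ a))
      ... | no y∉  = ∈-++⁺ˡ (head-nbr P N≤ a y∉)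
      cover-e : ∀ {y} → Adj G e y → y ∈ vs ++ marks bs
      cover-e {y} a with y ∈? L
      ... | yes y∈ = ∈-++⁺ʳ vs (L-mark y∈ (inj₂ a))
      ... | no y∉  = ∈-++⁺ˡ (head-nbr P′ (subst (λ z → N ≤ suc z) (sym l) N≤) a y∉)
      k≤u : k ≤ degree G u
      k≤u = good (off-L⇒≢w (o (here refl)))
      k≤e : k ≤ degree G e
      k≤e = good (off-L⇒≢w (o (end-∈ u us)))
      s : ℕ
      s = length bs
      len-u : length (us ++ marks bs) ≡ q + s
      len-u = trans (length-++ us) (cong (q +_) (length-map proj₁ bs))
      len-e : length (vs ++ marks bs) ≡ q + s
      len-e = trans (length-++ vs) (cong₂ _+_ l (length-map proj₁ bs))
      k≤q+s : k ≤ q + s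
      k≤q+s = ≤-trans k≤u (≤-trans (degree-⊆ u cover-u) (≤-reflexive len-u))
      2≤s : 2 ≤ s
      2≤s = +-cancelˡ-≤ q 2 s (≤-trans (≤-reflexive (+-comm q 2)) (≤-trans (short P N≤) k≤q+s))
      e-mark : ∃ λ y → y ∈ L × Adj G e y
      e-mark with any? (λ y → (y ∈? L) ×-dec Adj? e y)
      ... | yes a = a
      ... | no ¬a = ⊥-elim (<⇒≱ (≤-trans (n≤1+n (suc q)) (short P N≤)) (≤-trans k≤e (≤-trans (degree-⊆ e {vs} (λ {y} a →
          [ id , (λ y∈ → contradiction (y , mark-L y∈ , a) ¬a) ]′ (∈-++⁻ vs (cover-e a)))) (≤-reflexive l))))
      u-mark : ∃ λ y → y ∈ L × Adj G u y
      u-mark with any? (λ y → (y ∈? L) ×-dec Adj? u y)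
      ... | yes a = a
      ... | no ¬a = ⊥-elim (<⇒≱ (≤-trans (n≤1+n (suc q)) (short P N≤)) (≤-trans k≤u (degree-⊆ u {us} (λ {y} a →
          [ id , (λ y∈ → contradiction (y , mark-L y∈ , a) ¬a) ]′ (∈-++⁻ us (cover-u a))))))
      combine : ∀ {s σ} → 2 * s + q ≤ suc σ → σ + suc q ≤ 2 * k + 1 → 2 * (s + q) ≤ 2 * k + 1
      combine {s} {σ} a b = lin _ _ 0 (+-mono-≤ a b) (eq s σ q (2 * k + 1))
        where
        eq : ∀ s σ q K → suc σ + K + 2 * (s + q) + 0 ≡ 2 * s + q + (σ + suc q) + K
        eq s σ q K = solve (s ∷ σ ∷ q ∷ K ∷ [])
      combine′ : ∀ {s σ} → 2 * s + 2 * q ≤ suc σ → σ + 1 ≤ 2 * k + 1 → 2 * (s + q) ≤ 2 * k + 1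
      combine′ {s} {σ} a b = lin _ _ 0 (+-mono-≤ a b) (eq s σ q (2 * k + 1))
        where
        eq : ∀ s σ q K → suc σ + K + 2 * (s + q) + 0 ≡ 2 * s + 2 * q + (σ + 1) + K
        eq s σ q K = solve (s ∷ σ ∷ q ∷ K ∷ [])
      result : ∀ bs′ → bs ≡ bs′ → Ends u us
      result []                 refl = contradiction 2≤s λ ()
      result (_ ∷ [])           refl = contradiction 2≤s λ { (s≤s ()) }
      result ((m , g) ∷ b ∷ bs′) refl = record
        { X = marks bs ; ndX = nd-marks ; X⊆L = mark-L
        ; size = trans (cong (_+ q) (length-map proj₁ bs)) s+q≡k
        ; 2≤X = subst (2 ≤_) (sym (length-map proj₁ bs)) 2≤s
        ; small = subst (λ z → z * (2 + q) ≤ 2 * k + 1) (sym (length-map proj₁ bs))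
            (≤-trans (span-all bs chain (λ m∈ → all-u m∈ , all-e m∈)) (close (across (all-u last∈) (all-e (here refl)))))
        ; head~us = all-us ; head~X = all-u ; end~X = all-e
        ; L~head = λ y∈ a → L-mark y∈ (inj₁ a) ; L~end = λ y∈ a → L-mark y∈ (inj₂ a) }
        where
        mₗ = last-mark m (b ∷ bs′)
        last∈ : mₗ ∈ marks bs
        last∈ = last-mark-∈ m g (b ∷ bs′)
        close : ∀ {δ} → Out mₗ δ m → span bs + length δ ≤ 2 * k + 1
        close {δ} = closing pre m g b bs′ c′ δ
        close-reverse : Out mₗ (reverse (u ∷ us)) m → span bs + suc q ≤ 2 * k + 1
        close-reverse w = subst (λ z → span bs + z ≤ 2 * k + 1) (length-reverse (u ∷ us)) (close w)
        tail-mark : ∀ {y} → y ∈ marks bs → y ≢ m → y ∈ marks (b ∷ bs′)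
        tail-mark (here e)  ne = contradiction e ne
        tail-mark (there p) ne = p
        -- If the first and the last mark can be assigned to different ends, there is one long gap
        -- and a closing path on `q + 1` vertices. If both belong to the same end only, the other
        -- end has a mark in between: two long gaps and a closing path on one vertex. Both ways add
        -- up to the same.
        bound : 2 * (s + q) ≤ 2 * k + 1
        bound with Adj? u m | Adj? e m | Adj? u mₗ | Adj? e mₗ
        ... | yes a | _ | _ | yes a′ = combine {s} (span-change (Adj? e) m g b bs′ chain (mark-M ∘ there) a a′) (close-reverse (across′ a′ a))
        ... | _ | yes a | yes a′ | _ = combine {s} (span-change (Adj? u) m g b bs′ (Gap-sym bs chain)
              (λ y∈ → [ inj₂ , inj₁ ]′ (mark-M (there y∈))) a a′) (close (across a′ a))
        ... | yes a | no ¬b | yes a′ | no ¬b′ = let (y , y∈ , ey) = e-mark in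
              combine′ {s} (span-two-changes (Adj? u) (Adj? e) m g b bs′ chain (mark-M ∘ there) a a′ ¬b′
                (tail-mark (L-mark y∈ (inj₂ ey)) (λ y≡m → ¬b (subst (Adj G e) y≡m ey))) ey) (close (single (here refl) a′ a))
        ... | no ¬a | yes b′ | no ¬a′ | yes b″ = let (y , y∈ , uy) = u-mark in
              combine′ {s} (span-two-changes (Adj? e) (Adj? u) m g b bs′ (Gap-sym bs chain)
                (λ y∈ → [ inj₂ , inj₁ ]′ (mark-M (there y∈))) b′ b″ ¬a′
                (tail-mark (L-mark y∈ (inj₁ uy)) (λ y≡m → ¬a (subst (Adj G u) y≡m uy))) uy) (close (single (end-∈ u us) b″ b′))
        ... | no ¬a | no ¬b | _ | _ = ⊥-elim ([ ¬a , ¬b ]′ (mark-M (here refl)))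
        ... | _ | _ | no ¬a | no ¬b = ⊥-elim ([ ¬a , ¬b ]′ (mark-M last∈))
        s+q≡k : s + q ≡ k
        s+q≡k = ≤-antisym (half (s + q) k bound) (≤-trans k≤q+s (≤-reflexive (+-comm q s)))
        -- Since `s + q ≡ k`, the list `ys` has exactly `k` entries, and the degree of `t` leaves
        -- none of them out.
        full : ∀ {t ys} → length ys ≡ q + s → k ≤ degree G t → (∀ {y} → Adj G t y → y ∈ ys) → ∀ {y} → y ∈ ys → Adj G t y
        full {t} {ys} le kd cov {y} y∈ with Adj? t y
        ... | yes a = a
        ... | no ¬a = ⊥-elim (<⇒≱ (s≤s kd) (≤-trans
          (degree-+ t (y ∷ []) NoDup-[x] (sole ¬a) (sole y∈) cov)
          (≤-reflexive (trans le (trans (+-comm q s) s+q≡k)))))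
        all-us : ∀ {y} → y ∈ us → Adj G u y
        all-us y∈ = full len-u k≤u cover-u (∈-++⁺ˡ y∈)
        all-u : ∀ {y} → y ∈ marks bs → Adj G u y
        all-u y∈ = full len-u k≤u cover-u (∈-++⁺ʳ us y∈)
        all-e : ∀ {y} → y ∈ marks bs → Adj G e y
        all-e y∈ = full len-e k≤e cover-e (∈-++⁺ʳ vs y∈)

    -- A Pósa rotation turns any vertex of the path into its first vertex without moving the last one.
    rotated : ∀ {u us t} → OffPath v (u ∷ us) → Ends u us → t ∈ u ∷ us → t ≢ end u us → ∃ λ ts →
      OffPath v (t ∷ ts) × length ts ≡ length us × end t ts ≡ end u us × (∀ {y} → y ∈ u ∷ us → y ∈ t ∷ ts)
    rotated {u} {us} {t} P@(p , ndP , o , v∈) E t∈ t≢ with ∈-∃++ t∈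
    ... | [] , rs , refl = us , P , refl , refl , id
    ... | _ ∷ ls , [] , refl = contradiction (sym (end-++ u ls)) t≢
    ... | _ ∷ ls , y ∷ rs , refl = reverse ls ++ u ∷ y ∷ rs ,
      (Path-++ (reverse ls) (W-reverse ls (proj₁ (Path-split ls p)))
        (Ends.head~us E (∈-++⁺ʳ ls (there (here refl))) , proj₂ (proj₂ (Path-split ls p))) ,
       NoDup-⊑ (≋⇒⊑ (≋-sym same′)) ndP , (λ z∈ → o (⊑-∈ (≋⇒⊑ (≋-sym same′)) z∈)) , ⊑-∈ (≋⇒⊑ same′) v∈) ,
      suc-injective (sym (≋-length ndP same′)) , trans (end-++ t (reverse ls)) (sym (end-++ u ls)) , ⊑-∈ (≋⇒⊑ same′)
      where
      same′ : u ∷ ls ++ t ∷ y ∷ rs ≋ t ∷ reverse ls ++ u ∷ y ∷ rs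
      same′ = ≋-by ((u ∷ []) ∷ ls ∷ (t ∷ []) ∷ (y ∷ rs) ∷ []) (` 0 ⊕ ` 1 ⊕ ` 2 ⊕ ` 3) (` 2 ⊕ rev (` 1) ⊕ ` 0 ⊕ ` 3)

    component : ∀ {u us} → OffPath v (u ∷ us) → N ≤ length (u ∷ us) → Comp v
    component {u} {us} P@(p , ndP , o , v∈) N≤ = record
      { D = u ∷ us ; X = X ; v∈D = v∈ ; ndD = ndP ; ndX = ndX ; D∥L = o ; X⊆L = X⊆L
      ; size = trans (+-suc (length X) (length us)) (cong suc size) ; 2≤X = 2≤X
      ; shape = Data.Sum.map₂ (Data.Sum.map (cong suc) (λ (a , b) → a , cong suc b)) (trichotomy (length X) (length us) k 2≤X size small)
      ; nbr = λ t∈ a → proj₁ (member t∈) a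
      ; clique = λ t∈ y∈ ne → proj₁ (proj₂ (member t∈)) y∈ ne
      ; joined = λ t∈ y∈ → proj₂ (proj₂ (member t∈)) y∈ }
      where
      P-ends : Ends u us
      P-ends = ends P N≤
      open Ends P-ends
      from-ends : ∀ {t ts} → OffPath v (t ∷ ts) → length ts ≡ length us → (∀ {y} → y ∈ t ∷ ts → y ∈ u ∷ us) →
        (∀ {y} → y ∈ u ∷ us → y ∈ t ∷ ts) → (∀ {y} → y ∈ X → Adj G t y) → (∀ {y} → y ∈ L → Adj G t y → y ∈ X) →
        (∀ {y} → y ∈ ts → Adj G t y) →
        (∀ {y} → Adj G t y → y ∈ u ∷ us ⊎ y ∈ X) × (∀ {y} → y ∈ u ∷ us → t ≢ y → Adj G t y) × (∀ {y} → y ∈ X → Adj G t y)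
      from-ends {t} {ts} T l ⊆₁ ⊆₂ toX fromX toD =
        (λ {y} a → case y ∈? L of λ
          { (yes y∈) → inj₂ (fromX y∈ a)
          ; (no y∉) → inj₁ (⊆₁ (there (head-nbr T (subst (λ z → N ≤ suc z) (sym l) N≤) a y∉))) }) ,
        (λ y∈ ne → case ⊆₂ y∈ of λ { (here e) → contradiction (sym e) ne ; (there y∈′) → toD y∈′ }) ,
        toX
      member : ∀ {t} → t ∈ u ∷ us →
        (∀ {y} → Adj G t y → y ∈ u ∷ us ⊎ y ∈ X) × (∀ {y} → y ∈ u ∷ us → t ≢ y → Adj G t y) × (∀ {y} → y ∈ X → Adj G t y)
      member {t} t∈ with t ≟ end u us
      ... | yes refl = let (vs , P′ , l , f , e≡) = reversed P ; E′ = ends P′ (subst (λ z → N ≤ suc z) (sym l) N≤) in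
        from-ends P′ l (λ y∈ → reverse⁻ (subst (_ ∈_) (sym e≡) y∈)) (λ y∈ → subst (_ ∈_) e≡ (reverse⁺ y∈))
          end~X L~end (Ends.head~us E′)
      -- Rotation keeps the end of the path, and on `L` this end sees exactly `X`; so the marks
      -- found for the rotated path are again `X`, now for the head `t`.
      ... | no t≢ = let (ts , T , l , f , s) = rotated P P-ends t∈ t≢ ; E′ = ends T (subst (λ z → N ≤ suc z) (sym l) N≤) in
        from-ends T l (back-∈ T l s) s
          (λ y∈ → Ends.head~X E′ (Ends.L~end E′ (X⊆L y∈) (subst (λ z → Adj G z _) (sym f) (end~X y∈))))
          (λ y∈ a → L~end y∈ (subst (λ z → Adj G z _) f (Ends.end~X E′ (Ends.L~head E′ y∈ a))))
          (Ends.head~us E′)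
        where
        back-∈ : ∀ {t ts} → OffPath v (t ∷ ts) → length ts ≡ length us → (∀ {y} → y ∈ u ∷ us → y ∈ t ∷ ts) →
          ∀ {y} → y ∈ t ∷ ts → y ∈ u ∷ us
        back-∈ T l s {y} y∈ with y ∈? (u ∷ us)
        ... | yes y∈′ = y∈′
        ... | no y∉ = ⊥-elim (<⇒≱ (s≤s (≤-reflexive (cong suc l))) (length-⊆ (NoDup-∷ y∉ ndP) (cons y∈ s)))

  attached : ∀ {v x} → v ∉ L → x ∈ L → Adj G v x → Comp v
  attached {v} {x} v∉ x∈ a = case longest (OffPath? v) OffPath-nd {v ∷ []} (tt , NoDup-[x] , sole v∉ , here refl) of λ
    { (u ∷ us , P , mx) → LongestOff.component x∈ (adj-sym a) (suc (length us)) mx P ≤-refl }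

  comp-transport : ∀ {v u} → v ∉ L → Adj G v u → Comp u → Comp v
  comp-transport v∉ a c = record
    { D = D ; X = X ; v∈D = [ id , (λ v∈X → contradiction (X⊆L v∈X) v∉) ]′ (nbr v∈D (adj-sym a)) ; ndD = ndD ; ndX = ndX
    ; D∥L = D∥L ; X⊆L = X⊆L ; size = size ; 2≤X = 2≤X ; shape = shape ; nbr = nbr ; clique = clique ; joined = joined }
    where open Comp c

  -- The longest-path argument needs a vertex with a neighbour on `L`. A walk from `v` to `L` leads
  -- to one, and `comp-transport` carries its record back along the walk.
  comp : ∀ v → v ∉ L → Comp v
  comp v v∉ = along (connected-to-L v∉)
    where
    connected-to-L : ∀ {v} → v ∉ L → ∃ λ c → c ∈ L × ∃ λ x → Walk G (_≢ x) v c
    connected-to-L {v} v∉ = let (c₁ , c₂ , c₁∈ , c₂∈ , ne) = two-on-L in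
      c₁ , c₁∈ , c₂ , connected c₂ v c₁ (λ { refl → v∉ c₂∈ }) ne
    walk-comp : ∀ {v c x} → Walk G (_≢ x) v c → v ∉ L → c ∈ L → Comp v
    walk-comp (here _) v∉ c∈ = contradiction c∈ v∉
    walk-comp (step {w = y} _ a r) v∉ c∈ with y ∈? L
    ... | yes y∈ = attached v∉ y∈ a
    ... | no y∉  = comp-transport v∉ a (walk-comp r y∉ c∈)
    along : (∃ λ c → c ∈ L × ∃ λ x → Walk G (_≢ x) v c) → Comp v
    along (c , c∈ , x , r) = walk-comp r v∉ c∈

-- Embeddings of vertex classes

-- Total, so that places are defined for vertices outside `Dom` as well; the value beyond the range
-- is arbitrary.
clamp : ∀ {m} → 1 ≤ m → ℕ → Fin m
clamp {suc m} _ i with i <? suc m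
... | yes p = fromℕ< p
... | no _  = zero

clamp-injective : ∀ {m} (1≤m : 1 ≤ m) {i j} → i < m → j < m → clamp 1≤m i ≡ clamp 1≤m j → i ≡ j
clamp-injective {suc m} _ {i} {j} p q e with i <? suc m | j <? suc m
... | yes p′ | yes q′ = trans (sym (toℕ-fromℕ< p′)) (trans (cong toℕ e) (toℕ-fromℕ< q′))
... | yes _  | no ¬q  = contradiction q ¬q
... | no ¬p  | _      = contradiction p ¬p

-- Members of a class share the very same list, not just the same elements: its head then names the
-- class, and the position in it tells the members apart.
record Classes {n : ℕ} (Dom : Fin n → Set) (cls : Fin n → List (Fin n)) : Set where
  field
    self   : ∀ {u} → Dom u → u ∈ cls u
    member : ∀ {u y} → Dom u → y ∈ cls u → Dom y × cls y ≡ cls u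

module Slots {n : ℕ} {Dom : Fin n → Set} {cls : Fin n → List (Fin n)} (classes : Classes Dom cls)
  {m : ℕ} (1≤m : 1 ≤ m) (bound : ∀ {u} → Dom u → length (cls u) ≤ m) where

  open Classes classes

  private
    head-or : Fin n → List (Fin n) → Fin n
    head-or u []      = u
    head-or u (y ∷ _) = y

    head-or-∈ : ∀ {u xs y} → y ∈ xs → head-or u xs ∈ xs
    head-or-∈ (here _)  = here refl
    head-or-∈ (there _) = here refl

    head-or-≡ : ∀ {u v xs y} → y ∈ xs → head-or u xs ≡ head-or v xs
    head-or-≡ (here _)  = refl
    head-or-≡ (there _) = refl

  label : Fin n → Fin n
  label u = head-or u (cls u)

  label-cls : ∀ {u} → Dom u → cls (label u) ≡ cls u
  label-cls d = proj₂ (member d (head-or-∈ (self d)))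

  place : Fin n → Fin m
  place u = clamp 1≤m (find u (cls u))

  slot-injective : ∀ {u y} → Dom u → Dom y → label u ≡ label y → place u ≡ place y → u ≡ y
  slot-injective {u} {y} du dy l≡ p≡ = find-injective (cls u) (self du) (subst (y ∈_) (sym cls≡) (self dy))
    (trans (clamp-injective 1≤m (≤-trans (find-< (self du)) (bound du)) (≤-trans (find-< (self dy)) (bound dy)) p≡)
      (cong (find y) (sym cls≡)))
    where
    cls≡ : cls u ≡ cls y
    cls≡ = trans (sym (label-cls du)) (trans (cong cls l≡) (label-cls dy))

  slot-edge : ∀ {u y} → Dom u → y ∈ cls u → u ≢ y → label u ≡ label y × place u ≢ place y
  slot-edge {u} {y} du y∈ u≢y = l≡ , λ p≡ → u≢y (slot-injective du dy l≡ p≡)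
    where
    dy : Dom y
    dy = proj₁ (member du y∈)
    l≡ : label u ≡ label y
    l≡ = trans (head-or-≡ (self du)) (cong (head-or y) (sym (proj₂ (member du y∈))))

module _ {n : ℕ} (G : Graph n) where

  open Walks G

  ⊆-join : ∀ (top : List (Fin n)) {H : UGraph} (g : Fin n → V H) →
    (∀ {u y} → u ∉ top → y ∉ top → g u ≡ g y → u ≡ y) →
    (∀ {u y} → u ∉ top → y ∉ top → Adj G u y → E H (g u) (g y)) →
    G ⊆ (K (length top) ⊹ H)
  ⊆-join top {H} g inj edge = f , (λ {u} {y} → f-inj u y) , f-edge
    where
    f : Fin n → Fin (length top) ⊎ V H
    f u with u ∈? top
    ... | yes p = inj₁ (fromℕ< (find-< p))
    ... | no _  = inj₂ (g u)
    same-place : ∀ {u y} (p : u ∈ top) (q : y ∈ top) → fromℕ< (find-< p) ≡ fromℕ< (find-< q) → u ≡ y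
    same-place p q e = find-injective top p q (trans (sym (toℕ-fromℕ< (find-< p))) (trans (cong toℕ e) (toℕ-fromℕ< (find-< q))))
    f-inj : ∀ u y → f u ≡ f y → u ≡ y
    f-inj u y e with u ∈? top | y ∈? top
    f-inj u y e  | yes p | yes q = same-place p q (inj₁-injective e)
    f-inj u y () | yes p | no q
    f-inj u y () | no p  | yes q
    f-inj u y e  | no p  | no q = inj p q (inj₂-injective e)
    f-edge : ∀ u y → Adj G u y → E (K (length top) ⊹ H) (f u) (f y)
    f-edge u y a with u ∈? top | y ∈? top
    ... | yes p | yes q = λ e → adj⇒≢ a (same-place p q e)
    ... | yes p | no q  = tt
    ... | no p  | yes q = tt
    ... | no p  | no q  = edge p q a

  module IntoM {Dom : Fin n → Set} {cls : Fin n → List (Fin n)} (classes : Classes Dom cls)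
    (bound : ∀ {u} → Dom u → length (cls u) ≤ 2) where

    open Slots classes {2} (s≤s z≤n) bound

    private
      cast : Fin n → Fin (n * 2 / 2)
      cast = subst Fin (sym (m*n/n≡m n 2))

      subst-injective : ∀ {m m′ : ℕ} (e : m ≡ m′) {i j : Fin m} → subst Fin e i ≡ subst Fin e j → i ≡ j
      subst-injective refl p = p

    -- One edge of the matching for every possible label: labels are vertices, so `n` edges suffice,
    -- and since only containment is claimed they need not be filled. `cast` is due to `n * 2 / 2`
    -- not computing to `n`.
    intoM : Fin n → V (M (n * 2))
    intoM u = inj₁ (cast (label u) , place u)

    intoM-injective : ∀ {u y} → Dom u → Dom y → intoM u ≡ intoM y → u ≡ y
    intoM-injective du dy e = let p = inj₁-injective e in
      slot-injective du dy (subst-injective (sym (m*n/n≡m n 2)) (cong proj₁ p)) (cong proj₂ p)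

    intoM-edge : ∀ {u y} → Dom u → y ∈ cls u → u ≢ y → E (M (n * 2)) (intoM u) (intoM y)
    intoM-edge du y∈ ne = let (p , q) = slot-edge du y∈ ne in cong cast p , q

  module _ {k : ℕ} (2≤k : 2 ≤ k) (x y : Fin n) (big : List (Fin n)) (|big|≤k : length big ≤ k)
    {cls : Fin n → List (Fin n)} (classes : Classes (λ u → u ∉ x ∷ y ∷ [] × u ∉ big) cls)
    (bound : ∀ {u} → u ∉ x ∷ y ∷ [] × u ∉ big → length (cls u) ≤ k ∸ 1)
    (big-sep : ∀ {u v} → u ∈ big → Adj G u v → v ∈ x ∷ y ∷ [] ⊎ v ∈ big)
    (cls-sep : ∀ {u v} → u ∉ x ∷ y ∷ [] × u ∉ big → v ∉ x ∷ y ∷ [] × v ∉ big → Adj G u v → v ∈ cls u) where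

    private
      1≤k : 1 ≤ k
      1≤k = ≤-trans (s≤s z≤n) 2≤k

    open Slots classes {k ∸ 1} (∸-monoˡ-≤ 1 2≤k) bound

    private
      g : Fin n → V (n · K (k ∸ 1) ∪ K k ∪ K 1)
      g u with u ∈? big
      ... | yes _ = inj₂ (inj₁ (clamp 1≤k (find u big)))
      ... | no _  = inj₁ (label u , place u)

      same-place : ∀ {u v} → u ∈ big → v ∈ big → clamp 1≤k (find u big) ≡ clamp 1≤k (find v big) → u ≡ v
      same-place p q e = find-injective big p q
        (clamp-injective 1≤k (≤-trans (find-< p) |big|≤k) (≤-trans (find-< q) |big|≤k) e)

      g-inj : ∀ {u v} → u ∉ x ∷ y ∷ [] → v ∉ x ∷ y ∷ [] → g u ≡ g v → u ≡ v
      g-inj {u} {v} u∉ v∉ e with u ∈? big | v ∈? big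
      g-inj u∉ v∉ e  | yes p | yes q = same-place p q (inj₁-injective (inj₂-injective e))
      g-inj u∉ v∉ () | yes p | no q
      g-inj u∉ v∉ () | no p  | yes q
      g-inj u∉ v∉ e  | no p  | no q = slot-injective (u∉ , p) (v∉ , q) (cong proj₁ (inj₁-injective e)) (cong proj₂ (inj₁-injective e))

      g-edge : ∀ {u v} → u ∉ x ∷ y ∷ [] → v ∉ x ∷ y ∷ [] → Adj G u v → E (n · K (k ∸ 1) ∪ K k ∪ K 1) (g u) (g v)
      g-edge {u} {v} u∉ v∉ a with u ∈? big | v ∈? big
      ... | yes p | yes q = λ e → adj⇒≢ a (same-place p q e)
      ... | yes p | no q  = ⊥-elim ([ v∉ , q ]′ (big-sep p a))
      ... | no p  | yes q = ⊥-elim ([ u∉ , p ]′ (big-sep q (adj-sym a)))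
      ... | no p  | no q  = slot-edge (u∉ , p) (cls-sep (u∉ , p) (v∉ , q) a) (adj⇒≢ a)

    -- `big` goes into `K k` and every class into a copy of `K (k ∸ 1)`, with one copy for each
    -- vertex that could be a label.
    ⊆-F₁ : G ⊆ F₁ n k
    ⊆-F₁ = ⊆-join (x ∷ y ∷ []) g g-inj g-edge

  module _ {k : ℕ} (2≤k : 2 ≤ k) (x y z : Fin n) {cls : Fin n → List (Fin n)}
    (classes : Classes (λ u → u ∉ x ∷ y ∷ z ∷ []) cls)
    (bound : ∀ {u} → u ∉ x ∷ y ∷ z ∷ [] → length (cls u) ≤ k ∸ 1)
    (cls-sep : ∀ {u v} → u ∉ x ∷ y ∷ z ∷ [] → v ∉ x ∷ y ∷ z ∷ [] → Adj G u v → v ∈ cls u)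
    (side : Fin n → Bool) (side-cls : ∀ {u v} → u ∉ x ∷ y ∷ z ∷ [] → v ∈ cls u → side u ≡ side v)
    (side-x : ∀ {u} → u ∉ x ∷ y ∷ z ∷ [] → Adj G u x → side u ≡ true)
    (side-y : ∀ {u} → u ∉ x ∷ y ∷ z ∷ [] → Adj G u y → side u ≡ false) where

    open Slots classes {k ∸ 1} (∸-monoˡ-≤ 1 2≤k) bound

    private
      GX GY : UGraph
      GX = n · K (k ∸ 1) ∪ K 1
      GY = n · K (k ∸ 1)

      data View (u : Fin n) : Set where
        is-x : u ≡ x → View u
        is-y : u ≡ y → View u
        is-z : u ≡ z → View u
        low  : u ∉ x ∷ y ∷ z ∷ [] → View u

      view : ∀ u → View u
      view u with u ≟ x | u ≟ y | u ≟ z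
      ... | yes p | _     | _     = is-x p
      ... | no _  | yes p | _     = is-y p
      ... | no _  | no _  | yes p = is-z p
      ... | no p  | no q  | no r  = low λ { (here e) → p e ; (there (here e)) → q e ; (there (there (here e))) → r e }

      place-low : Bool → Fin n → FV (V GX) (V GY)
      place-low true  u = inX (inj₁ (label u , place u))
      place-low false u = inY (label u , place u)

      place-of : ∀ {u} → View u → FV (V GX) (V GY)
      place-of (is-x _)    = vx
      place-of (is-y _)    = vy
      place-of (is-z _)    = vz
      place-of {u} (low _) = place-low (side u) u

      place-low-vx : ∀ b u → vx ≢ place-low b u
      place-low-vx true u ()
      place-low-vx false u ()

      place-low-vy : ∀ b u → vy ≢ place-low b u
      place-low-vy true u ()
      place-low-vy false u ()

      place-low-vz : ∀ b u → vz ≢ place-low b u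
      place-low-vz true u ()
      place-low-vz false u ()

      inX-injective : ∀ {A B : Set} {a b : A} → inX {A} {B} a ≡ inX b → a ≡ b
      inX-injective refl = refl

      inY-injective : ∀ {A B : Set} {a b : B} → inY {A} {B} a ≡ inY b → a ≡ b
      inY-injective refl = refl

      place-low-inj : ∀ b c {u v} → u ∉ x ∷ y ∷ z ∷ [] → v ∉ x ∷ y ∷ z ∷ [] → place-low b u ≡ place-low c v → u ≡ v
      place-low-inj true true p q e = let e′ = inj₁-injective (inX-injective e) in slot-injective p q (cong proj₁ e′) (cong proj₂ e′)
      place-low-inj false false p q e = let e′ = inY-injective e in slot-injective p q (cong proj₁ e′) (cong proj₂ e′)
      place-low-inj true false p q ()
      place-low-inj false true p q ()

      inj : ∀ {u v} (p : View u) (q : View v) → place-of p ≡ place-of q → u ≡ v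
      inj (is-x refl) (is-x refl) e = refl
      inj (is-y refl) (is-y refl) e = refl
      inj (is-z refl) (is-z refl) e = refl
      inj {u} {v} (low p) (low q) e = place-low-inj (side u) (side v) p q e
      inj {v = v} (is-x _) (low _) e = ⊥-elim (place-low-vx (side v) v e)
      inj {v = v} (is-y _) (low _) e = ⊥-elim (place-low-vy (side v) v e)
      inj {v = v} (is-z _) (low _) e = ⊥-elim (place-low-vz (side v) v e)
      inj {u} (low _) (is-x _) e = ⊥-elim (place-low-vx (side u) u (sym e))
      inj {u} (low _) (is-y _) e = ⊥-elim (place-low-vy (side u) u (sym e))
      inj {u} (low _) (is-z _) e = ⊥-elim (place-low-vz (side u) u (sym e))
      inj (is-x _) (is-y _) ()
      inj (is-x _) (is-z _) ()
      inj (is-y _) (is-x _) ()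
      inj (is-y _) (is-z _) ()
      inj (is-z _) (is-x _) ()
      inj (is-z _) (is-y _) ()

      edge-z : ∀ b u → FE GX GY vz (place-low b u)
      edge-z true  u = tt
      edge-z false u = tt

      edge-z′ : ∀ b u → FE GX GY (place-low b u) vz
      edge-z′ true  u = tt
      edge-z′ false u = tt

      edge-low : ∀ b c {u v} → b ≡ c → label u ≡ label v × place u ≢ place v → FE GX GY (place-low b u) (place-low c v)
      edge-low true  .true  refl p = p
      edge-low false .false refl p = p

      edge : ∀ {u v} (p : View u) (q : View v) → Adj G u v → FE GX GY (place-of p) (place-of q)
      edge (is-x refl) (is-x refl) a = ⊥-elim (adj⇒≢ a refl)
      edge (is-y refl) (is-y refl) a = ⊥-elim (adj⇒≢ a refl)
      edge (is-z refl) (is-z refl) a = ⊥-elim (adj⇒≢ a refl)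
      edge (is-x _) (is-y _) a = tt
      edge (is-x _) (is-z _) a = tt
      edge (is-y _) (is-x _) a = tt
      edge (is-y _) (is-z _) a = tt
      edge (is-z _) (is-x _) a = tt
      edge (is-z _) (is-y _) a = tt
      edge {v = v} (is-x refl) (low q) a rewrite side-x q (adj-sym a) = tt
      edge {v = v} (is-y refl) (low q) a rewrite side-y q (adj-sym a) = tt
      edge {v = v} (is-z refl) (low q) a = edge-z (side v) v
      edge {u} (low p) (is-x refl) a rewrite side-x p a = tt
      edge {u} (low p) (is-y refl) a rewrite side-y p a = tt
      edge {u} (low p) (is-z refl) a = edge-z′ (side u) u
      edge {u} {v} (low p) (low q) a = edge-low (side u) (side v) (side-cls p (cls-sep p q a)) (slot-edge p (cls-sep p q a) (adj⇒≢ a))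

    ⊆-Fgraph : G ⊆ Fgraph n n k
    ⊆-Fgraph = (λ u → place-of (view u)) , (λ {u} {v} → inj (view u) (view v)) , λ u v → edge (view u) (view v)

  module _ (A Cs : List (Fin n)) (ndA : NoDup A) (ndC : NoDup Cs) (A∥C : ∀ {u} → u ∈ A → u ∉ Cs)
    (size : 2 * length A + length Cs ≤ n)
    (inside : ∀ {u v} → u ∉ A → v ∉ A → Adj G u v → u ∈ Cs × v ∈ Cs) where

    private
      a = length A
      -- With this `ℓ` the part C of the target has `length Cs` vertices, and its part B, on
      -- `n ∸ ℓ + a` vertices, has room for exactly the rest.
      ℓ = 2 * a + length Cs

      Bs : List (Fin n)
      Bs = filter (λ u → ¬? (u ∈? (A ++ Cs))) (allFin n)

      ∈Bs : ∀ {u} → u ∉ A → u ∉ Cs → u ∈ Bs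
      ∈Bs p q = ∈-filter⁺ (λ u → ¬? (u ∈? (A ++ Cs))) (∈-allFin _) (λ r → [ p , q ]′ (∈-++⁻ A r))

      |Bs| : length Bs ≡ n ∸ ℓ + a
      |Bs| = +-cancelˡ-≡ (a + length Cs) (length Bs) (n ∸ ℓ + a) (trans total (sym rest))
        where
        all-list : List (Fin n)
        all-list = (A ++ Cs) ++ Bs
        nd-all : NoDup all-list
        nd-all = NoDup-++ (NoDup-++ ndA ndC A∥C) (Unique⇒NoDup (filter⁺ (λ u → ¬? (u ∈? (A ++ Cs))) (allFin⁺ n)))
          (λ p q → proj₂ (∈-filter⁻ (λ u → ¬? (u ∈? (A ++ Cs))) {xs = allFin n} q) p)
        every : ∀ u → u ∈ all-list
        every u with u ∈? (A ++ Cs)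
        ... | yes p = ∈-++⁺ˡ p
        ... | no p  = ∈-++⁺ʳ (A ++ Cs) (∈-filter⁺ (λ u → ¬? (u ∈? (A ++ Cs))) (∈-allFin u) p)
        total : a + length Cs + length Bs ≡ n
        total = trans (sym (trans (length-++ (A ++ Cs)) (cong (_+ length Bs) (length-++ A)))) (full⇒length nd-all every)
        rest : a + length Cs + (n ∸ ℓ + a) ≡ n
        rest = trans (eq a (length Cs) (n ∸ ℓ)) (m∸n+n≡m size)
          where
          eq : ∀ a c d → a + c + (d + a) ≡ d + (2 * a + c)
          eq a c d = solve (a ∷ c ∷ d ∷ [])

      |Cs| : length Cs ≡ ℓ ∸ 2 * a
      |Cs| = sym (m+n∸m≡n (2 * a) (length Cs))

      data View (u : Fin n) : Set where
        in-A : u ∈ A → View u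
        in-C : u ∉ A → u ∈ Cs → View u
        in-B : u ∉ A → u ∉ Cs → View u

      view : ∀ u → View u
      view u with u ∈? A | u ∈? Cs
      ... | yes p | _     = in-A p
      ... | no p  | yes q = in-C p q
      ... | no p  | no q  = in-B p q

      C-< : ∀ {u} → u ∈ Cs → find u Cs < ℓ ∸ 2 * a
      C-< p = ≤-trans (find-< p) (≤-reflexive |Cs|)

      B-< : ∀ {u} → u ∉ A → u ∉ Cs → find u Bs < n ∸ ℓ + a
      B-< p q = ≤-trans (find-< (∈Bs p q)) (≤-reflexive |Bs|)

      place-of : ∀ {u} → View u → HV a (n ∸ ℓ + a) (ℓ ∸ 2 * a)
      place-of (in-A p)   = vA (fromℕ< (find-< p))
      place-of (in-C _ p) = vC (fromℕ< (≤-trans (find-< p) (≤-reflexive |Cs|)))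
      place-of (in-B p q) = vB (fromℕ< (B-< p q))

      from : ∀ {u v : Fin n} {m} xs → u ∈ xs → v ∈ xs → (p : find u xs < m) (q : find v xs < m) → fromℕ< p ≡ fromℕ< q → u ≡ v
      from xs u∈ v∈ p q e = find-injective xs u∈ v∈ (trans (sym (toℕ-fromℕ< p)) (trans (cong toℕ e) (toℕ-fromℕ< q)))

      vA-injective : ∀ {a b c i j} → vA {a} {b} {c} i ≡ vA j → i ≡ j
      vA-injective refl = refl

      vB-injective : ∀ {a b c i j} → vB {a} {b} {c} i ≡ vB j → i ≡ j
      vB-injective refl = refl

      vC-injective : ∀ {a b c i j} → vC {a} {b} {c} i ≡ vC j → i ≡ j
      vC-injective refl = refl

      inj : ∀ {u v} (p : View u) (q : View v) → place-of p ≡ place-of q → u ≡ v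
      inj (in-A p)   (in-A q)     e = from A p q (find-< p) (find-< q) (vA-injective e)
      inj (in-C _ p) (in-C _ q)   e = from Cs p q (C-< p) (C-< q) (vC-injective e)
      inj (in-B p q) (in-B p′ q′) e = from Bs (∈Bs p q) (∈Bs p′ q′) (B-< p q) (B-< p′ q′) (vB-injective e)
      inj (in-A _)   (in-C _ _)   ()
      inj (in-A _)   (in-B _ _)   ()
      inj (in-C _ _) (in-A _)     ()
      inj (in-C _ _) (in-B _ _)   ()
      inj (in-B _ _) (in-A _)     ()
      inj (in-B _ _) (in-C _ _)   ()

      edge : ∀ {u v} (p : View u) (q : View v) → Adj G u v → HE (place-of p) (place-of q)
      edge (in-A p)   (in-A q)     e = λ i≡ → adj⇒≢ e (from A p q (find-< p) (find-< q) i≡)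
      edge (in-C _ p) (in-C _ q)   e = λ i≡ → adj⇒≢ e (from Cs p q (C-< p) (C-< q) i≡)
      edge (in-A _)   (in-C _ _)   e = tt
      edge (in-A _)   (in-B _ _)   e = tt
      edge (in-C _ _) (in-A _)     e = tt
      edge (in-B _ _) (in-A _)     e = tt
      edge (in-B p q) (in-B p′ q′) e = ⊥-elim (q (proj₁ (inside p p′ e)))
      edge (in-C p q) (in-B p′ q′) e = ⊥-elim (q′ (proj₂ (inside p p′ e)))
      edge (in-B p q) (in-C p′ q′) e = ⊥-elim (q (proj₁ (inside p p′ e)))

    ⊆-Hgraph : G ⊆ Hgraph n ℓ a
    ⊆-Hgraph = (λ u → place-of (view u)) , (λ {u} {v} → inj (view u) (view v)) , λ u v → edge (view u) (view v)

  module _ (x y q : Fin n) {Dom : Fin n → Set} (Dom? : ∀ u → Dec (Dom u)) {cls : Fin n → List (Fin n)}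
    (classes : Classes Dom cls) (bound : ∀ {u} → Dom u → length (cls u) ≤ 2)
    (cls-sep : ∀ {u t} → Dom u → Dom t → Adj G u t → t ∈ cls u)
    (q-sep : ∀ {u} → Dom u → ¬ Adj G u q)
    (leaf-sep : ∀ {u t} → u ∉ x ∷ y ∷ q ∷ [] → t ∉ x ∷ y ∷ q ∷ [] → Adj G u t → Dom u) where

    open IntoM classes bound

    private
      Goal : UGraph
      -- Besides its centre the star has a leaf for every vertex of `G`, so a leaf can be placed as
      -- itself.
      Goal = S (suc n) ∪ M (n * 2)

      place-of : ∀ {u} → Dec (u ≡ q) → Dec (Dom u) → V Goal
      place-of (yes _) _          = inj₁ (inj₁ zero)
      place-of {u} (no _) (yes _) = inj₂ (intoM u)
      place-of {u} (no _) (no _)  = inj₁ (inj₂ u)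

      place-inj : ∀ {u t} (p : Dec (u ≡ q)) (d : Dec (Dom u)) (p′ : Dec (t ≡ q)) (d′ : Dec (Dom t)) → place-of p d ≡ place-of p′ d′ → u ≡ t
      place-inj (yes refl) _       (yes refl) _        e = refl
      place-inj (no _)     (yes d) (no _)     (yes d′) e = intoM-injective d d′ (inj₂-injective e)
      place-inj (no _)     (no _)  (no _)     (no _)   e = inj₂-injective (inj₁-injective e)
      place-inj (yes _)    _       (no _)     (yes _)  ()
      place-inj (yes _)    _       (no _)     (no _)   ()
      place-inj (no _)     (yes _) (yes _)    _        ()
      place-inj (no _)     (yes _) (no _)     (no _)   ()
      place-inj (no _)     (no _)  (yes _)    _        ()
      place-inj (no _)     (no _)  (no _)     (yes _)  ()

      low : ∀ {u} → u ∉ x ∷ y ∷ [] → u ≢ q → u ∉ x ∷ y ∷ q ∷ []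
      low u∉ u≢q (here e)                 = u∉ (here e)
      low u∉ u≢q (there (here e))         = u∉ (there (here e))
      low u∉ u≢q (there (there (here e))) = u≢q e

      place-edge : ∀ {u t} (p : Dec (u ≡ q)) (d : Dec (Dom u)) (p′ : Dec (t ≡ q)) (d′ : Dec (Dom t)) →
        u ∉ x ∷ y ∷ [] → t ∉ x ∷ y ∷ [] → Adj G u t → E Goal (place-of p d) (place-of p′ d′)
      place-edge (yes refl) _ (yes refl) _ u∉ t∉ e = adj⇒≢ e refl
      place-edge (yes refl) _ (no _) (yes d) u∉ t∉ e = q-sep d (adj-sym e)
      place-edge (yes refl) _ (no _) (no _) u∉ t∉ e = tt
      place-edge (no _) (yes d) (yes refl) _ u∉ t∉ e = q-sep d e
      place-edge (no _) (no _) (yes refl) _ u∉ t∉ e = tt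
      place-edge (no _) (yes d) (no _) (yes d′) u∉ t∉ e = intoM-edge d (cls-sep d d′ e) (adj⇒≢ e)
      place-edge (no u≢q) (no ¬d) (no t≢q) _ u∉ t∉ e = contradiction (leaf-sep (low u∉ u≢q) (low t∉ t≢q) e) ¬d
      place-edge (no u≢q) (yes _) (no t≢q) (no ¬d) u∉ t∉ e = contradiction (leaf-sep (low t∉ t≢q) (low u∉ u≢q) (adj-sym e)) ¬d

    ⊆-K₂+S∪M : G ⊆ (K 2 ⊹ (S (suc n) ∪ M (n * 2)))
    ⊆-K₂+S∪M = ⊆-join (x ∷ y ∷ []) (λ u → place-of (u ≟ q) (Dom? u))
      (λ {u} {t} _ _ → place-inj (u ≟ q) (Dom? u) (t ≟ q) (Dom? t))
      (λ {u} {t} → place-edge (u ≟ q) (Dom? u) (t ≟ q) (Dom? t))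

-- Components and cycles

module Common {n : ℕ} {G : Graph n} {k : ℕ} {w : Fin n} (setting : Setting G k w)
  {L : List (Fin n)} (longest-L : Longest G w L) where

  open Setting setting
  open Walks G
  open Around setting longest-L
  open Outside setting longest-L

  -- Any ordering of a clique is a path, so all of `D` can be inserted between two neighbours of the
  -- component.
  comp-out : ∀ {v} (c : Comp v) {a b} → a ∈ Comp.X c → b ∈ Comp.X c → Out a (Comp.D c) b
  comp-out c {a} {b} a∈ b∈ = out (from-a D (λ { refl → case v∈D of λ () }) ndD id) ndD D∥L
    where
    open Comp c
    along : ∀ d ds → NoDup (d ∷ ds) → (∀ {y} → y ∈ d ∷ ds → y ∈ D) → W d ds b
    along d []       nd s = joined (s (here refl)) b∈
    along d (e ∷ ds) nd s = clique (s (here refl)) (s (there (here refl))) (λ { refl → NoDup-head nd (here refl) }) ,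
      along e ds (NoDup-tail nd) (s ∘ there)
    from-a : ∀ ds → ds ≢ [] → NoDup ds → (∀ {y} → y ∈ ds → y ∈ D) → W a ds b
    from-a []       ne nd s = contradiction refl ne
    from-a (d ∷ ds) ne nd s = adj-sym (joined (s (here refl)) a∈) , along d ds nd s

  1≤D : ∀ {v} (c : Comp v) → 1 ≤ length (Comp.D c)
  1≤D c = ∈⇒1≤length (Comp.v∈D c)

  not-consecutive : ∀ {v} (c : Comp v) {a b h} → IsC (a ∷ b ∷ h) → a ∈ Comp.X c → b ∉ Comp.X c
  not-consecutive c {h = h} isc a∈ b∈ = <⇒≱ (1≤D c) (detour₂ [] h (Comp.D c) isc (comp-out c a∈ b∈) λ ())

  comps-disjoint : ∀ {v v′} (c : Comp v) (c′ : Comp v′) {e} → e ∈ Comp.X c → e ∉ Comp.X c′ → ∀ {y} → y ∈ Comp.D c → y ∉ Comp.D c′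
  comps-disjoint c c′ e∈ e∉ y∈ y∈′ =
    [ (λ e∈D′ → Comp.D∥L c′ e∈D′ (Comp.X⊆L c e∈)) , e∉ ]′ (Comp.nbr c′ y∈′ (Comp.joined c y∈ e∈))

  -- Two cycles that together cover the cycle L: one of them contains w and is therefore no longer than L.
  two-cycles : ∀ (ρ : List (List (Fin n))) (base e₁ e₂ all ends : Exp (length ρ)) → IsC (⟦ ρ ⟧ base) → NoDup (⟦ ρ ⟧ all) →
    Closed (⟦ ρ ⟧ e₁) → Closed (⟦ ρ ⟧ e₂) → 3 ≤ weight ends (λ j → length (lookup ρ j)) →
    {_ : True (e₁ ≼? all)} {_ : True (e₂ ≼? all)} {_ : True (ends ≼? e₁)} {_ : True (ends ≼? e₂)} {_ : True (base ≼? (e₁ ⊕ e₂))} →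
    weight e₁ (λ j → length (lookup ρ j)) + weight e₂ (λ j → length (lookup ρ j)) ≤ 2 * k + 1 + weight base (λ j → length (lookup ρ j))
  two-cycles ρ base e₁ e₂ all ends c nd-all c₁ c₂ 3≤e {p₁} {p₂} {q₁} {q₂} {r} =
    subst₂ _≤_ (cong₂ _+_ (length-⟦⟧ ρ e₁) (length-⟦⟧ ρ e₂)) (cong (2 * k + 1 +_) (length-⟦⟧ ρ base)) bound
    where
    nd₁ : NoDup (⟦ ρ ⟧ e₁)
    nd₁ = NoDup-⊑ (⊑-by ρ e₁ all {p₁}) nd-all
    nd₂ : NoDup (⟦ ρ ⟧ e₂)
    nd₂ = NoDup-⊑ (⊑-by ρ e₂ all {p₂}) nd-all
    long : ∀ e → NoDup (⟦ ρ ⟧ e) → ⟦ ρ ⟧ ends ⊑ ⟦ ρ ⟧ e → 3 ≤ length (⟦ ρ ⟧ e)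
    long e nd-e s = ≤-trans 3≤e (≤-trans (≤-reflexive (sym (length-⟦⟧ ρ ends))) (length-⊆ (NoDup-⊑ s nd-e) (⊑-∈ s)))
    bound : length (⟦ ρ ⟧ e₁) + length (⟦ ρ ⟧ e₂) ≤ 2 * k + 1 + length (⟦ ρ ⟧ base)
    bound with ∈-++⁻ (⟦ ρ ⟧ e₁) (⊑-∈ (⊑-by ρ base (e₁ ⊕ e₂) {r}) (∈-IsC c w∈))
    ... | inj₁ w∈₁ = ≤-trans (+-mono-≤ (≤-trans (maximal c₁ nd₁ (long e₁ nd₁ (⊑-by ρ ends e₁ {q₁})) w∈₁) (≤-reflexive (sym (IsC-length c))))
          (circumference c₂ nd₂ (long e₂ nd₂ (⊑-by ρ ends e₂ {q₂})))) (≤-reflexive (+-comm (length (⟦ ρ ⟧ base)) _))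
    ... | inj₂ w∈₂ = +-mono-≤ (circumference c₁ nd₁ (long e₁ nd₁ (⊑-by ρ ends e₁ {q₁})))
          (≤-trans (maximal c₂ nd₂ (long e₂ nd₂ (⊑-by ρ ends e₂ {q₂})) w∈₂) (≤-reflexive (sym (IsC-length c))))

  comp-≡ : ∀ {v v′} (c : Comp v) (c′ : Comp v′) {y} → y ∈ Comp.D c → y ∈ Comp.D c′ → ∀ {z} → z ∈ Comp.D c → z ∈ Comp.D c′
  comp-≡ c c′ {y} y∈ y∈′ {z} z∈ with y ≟ z
  ... | yes refl = y∈′
  ... | no y≢z = [ id , (λ z∈X → contradiction (Comp.X⊆L c′ z∈X) (Comp.D∥L c z∈)) ]′ (Comp.nbr c′ y∈′ (Comp.clique c y∈ z∈ y≢z))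

  off-class? : ∀ u y → Dec (y ∉ L × (y ≡ u ⊎ Adj G u y))
  off-class? u y = ¬? (y ∈? L) ×-dec ((y ≟ u) ⊎-dec Adj? u y)

  -- The component of an outside vertex as a sublist of `allFin n`, so that all its vertices yield
  -- literally the same list, as `Classes` demands; the lists `D` of different `Comp` records need
  -- not agree.
  off-class : Fin n → List (Fin n)
  off-class u = filter (off-class? u) (allFin n)

  ∈-off-class : ∀ {u y} → y ∉ L → y ≡ u ⊎ Adj G u y → y ∈ off-class u
  ∈-off-class {u} {y} y∉ p = ∈-filter⁺ (off-class? u) (∈-allFin y) (y∉ , p)

  off-class-∈ : ∀ {u y} → y ∈ off-class u → y ∉ L × (y ≡ u ⊎ Adj G u y)
  off-class-∈ {u} p = proj₂ (∈-filter⁻ (off-class? u) {xs = allFin n} p)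

  off-class-D : ∀ {u v y} (c : Comp v) → u ∈ Comp.D c → y ∈ off-class u → y ∈ Comp.D c
  off-class-D c u∈ y∈ with off-class-∈ y∈
  ... | y∉ , inj₁ refl = u∈
  ... | y∉ , inj₂ a = [ id , (λ y∈X → contradiction (Comp.X⊆L c y∈X) y∉) ]′ (Comp.nbr c u∈ a)

  off-class-length : ∀ {u v} (c : Comp v) → u ∈ Comp.D c → length (off-class u) ≤ length (Comp.D c)
  off-class-length {u} c u∈ = length-⊆ (Unique⇒NoDup (filter⁺ (off-class? u) (allFin⁺ n))) (off-class-D c u∈)

  off-class-≡ : ∀ {u y} → u ∉ L → y ∈ off-class u → off-class y ≡ off-class u
  off-class-≡ {u} {y} u∉ y∈ = filter-≐ (off-class? y) (off-class? u)
    ((λ (z∉ , p) → z∉ , to (y∈D) (Comp.v∈D c) z∉ p) , (λ (z∉ , p) → z∉ , to (Comp.v∈D c) y∈D z∉ p)) (allFin n)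
    where
    c = comp u u∉
    y∈D : y ∈ Comp.D c
    y∈D = off-class-D c (Comp.v∈D c) y∈
    to : ∀ {s t z} → s ∈ Comp.D c → t ∈ Comp.D c → z ∉ L → z ≡ s ⊎ Adj G s z → z ≡ t ⊎ Adj G t z
    to {s} {t} {z} s∈ t∈ z∉ p with z ≟ t
    ... | yes e = inj₁ e
    ... | no z≢t = inj₂ (Comp.clique c t∈ (off-class-D c s∈ (∈-off-class z∉ p)) (z≢t ∘ sym))

  Disjoint : List (List (Fin n)) → Set
  Disjoint []       = ⊤
  Disjoint (z ∷ zs) = (∀ {u z′} → u ∈ z → z′ ∈ zs → u ∉ z′) × Disjoint zs

  zone-class : List (List (Fin n)) → Fin n → List (Fin n)
  zone-class []       u = off-class u
  zone-class (z ∷ zs) u with u ∈? z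
  ... | yes _ = z
  ... | no _  = zone-class zs u

  zone-class-in : ∀ zs → Disjoint zs → ∀ {z u} → z ∈ zs → u ∈ z → zone-class zs u ≡ z
  zone-class-in (z ∷ zs) (d , ds) {u = u} z∈ u∈ with u ∈? z
  zone-class-in (z ∷ zs) (d , ds) (here refl) u∈ | yes _  = refl
  zone-class-in (z ∷ zs) (d , ds) (there z∈)  u∈ | yes u∈′ = contradiction u∈ (d u∈′ z∈)
  zone-class-in (z ∷ zs) (d , ds) (here refl) u∈ | no u∉  = contradiction u∈ u∉
  zone-class-in (z ∷ zs) (d , ds) (there z∈)  u∈ | no _   = zone-class-in zs ds z∈ u∈

  zone-class-out : ∀ zs {u} → (∀ {z} → z ∈ zs → u ∉ z) → zone-class zs u ≡ off-class u
  zone-class-out []       o = refl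
  zone-class-out (z ∷ zs) {u} o with u ∈? z
  ... | yes u∈ = contradiction u∈ (o (here refl))
  ... | no _   = zone-class-out zs (o ∘ there)

  -- The vertices of Dom on the cycle are partitioned into the zones, those off the cycle into components.
  module Zones {Dom : Fin n → Set} (zs : List (List (Fin n))) (disjoint : Disjoint zs)
    (zone-Dom : ∀ {z u} → z ∈ zs → u ∈ z → Dom u) (zone-L : ∀ {z u} → z ∈ zs → u ∈ z → u ∈ L)
    (cover : ∀ {u} → Dom u → u ∈ L → ∃ λ z → z ∈ zs × u ∈ z)
    (off-Dom : ∀ {u y} → Dom u → u ∉ L → y ∈ off-class u → Dom y) where

    private
      off : ∀ {u} → u ∉ L → zone-class zs u ≡ off-class u
      off u∉ = zone-class-out zs (λ z∈ u∈ → u∉ (zone-L z∈ u∈))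

    zone-classes : Classes Dom (zone-class zs)
    zone-classes = record { self = self ; member = member }
      where
      self : ∀ {u} → Dom u → u ∈ zone-class zs u
      self {u} d with u ∈? L
      ... | yes u∈ = let (z , z∈ , u∈z) = cover d u∈ in subst (u ∈_) (sym (zone-class-in zs disjoint z∈ u∈z)) u∈z
      ... | no u∉  = subst (u ∈_) (sym (off u∉)) (∈-off-class u∉ (inj₁ refl))
      member : ∀ {u y} → Dom u → y ∈ zone-class zs u → Dom y × zone-class zs y ≡ zone-class zs u
      member {u} {y} d y∈ with u ∈? L
      ... | yes u∈ = let (z , z∈ , u∈z) = cover d u∈ ; eq = zone-class-in zs disjoint z∈ u∈z ; y∈z = subst (y ∈_) eq y∈ in
            zone-Dom z∈ y∈z , trans (zone-class-in zs disjoint z∈ y∈z) (sym eq)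
      ... | no u∉ = let y∈o = subst (y ∈_) (off u∉) y∈ in
            off-Dom d u∉ y∈o , trans (off (proj₁ (off-class-∈ y∈o))) (trans (off-class-≡ u∉ y∈o) (sym (off u∉)))

    zone-bound : ∀ {m} → (∀ {z} → z ∈ zs → length z ≤ m) → (∀ {u} (u∉ : u ∉ L) → Dom u → length (Comp.D (comp u u∉)) ≤ m) →
      ∀ {u} → Dom u → length (zone-class zs u) ≤ m
    zone-bound {m} bz bo {u} d with u ∈? L
    ... | yes u∈ = let (z , z∈ , u∈z) = cover d u∈ in subst (λ l → length l ≤ m) (sym (zone-class-in zs disjoint z∈ u∈z)) (bz z∈)
    ... | no u∉  = subst (λ l → length l ≤ m) (sym (off u∉)) (≤-trans (off-class-length (comp u u∉) (Comp.v∈D (comp u u∉))) (bo u∉ d))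

    zone-sep : (∀ {z u v} → z ∈ zs → u ∈ z → Dom v → Adj G u v → v ∈ z) →
      ∀ {u v} → Dom u → Dom v → Adj G u v → v ∈ zone-class zs u
    zone-sep closed-zone {u} {v} du dv a with u ∈? L
    ... | yes u∈ = let (z , z∈ , u∈z) = cover du u∈ in
          subst (v ∈_) (sym (zone-class-in zs disjoint z∈ u∈z)) (closed-zone z∈ u∈z dv a)
    ... | no u∉ with v ∈? L
    ...   | yes v∈ = let (z , z∈ , v∈z) = cover dv v∈ in contradiction (zone-L z∈ (closed-zone z∈ v∈z du (adj-sym a))) u∉
    ...   | no v∉  = subst (v ∈_) (sym (off u∉)) (∈-off-class v∉ (inj₂ a))

-- Components with two vertices and three neighbours on the cycle (k = 4)

module CaseIII {n : ℕ} {G : Graph n} {w : Fin n} (setting : Setting G 4 w)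
  {L : List (Fin n)} (longest-L : Longest G w L) {v₀ : Fin n} (C₀ : Outside.Comp setting longest-L v₀)
  (|X| : length (Outside.Comp.X C₀) ≡ 3) (|D| : length (Outside.Comp.D C₀) ≡ 2) where

  open Walks G
  open Around setting longest-L
  open Outside setting longest-L
  open Common setting longest-L
  open Comp C₀ using (D; X)

  record Tri (a b c : Fin n) (P Q R : List (Fin n)) : Set where
    constructor tri
    field
      isc  : IsC (a ∷ P ++ b ∷ Q ++ c ∷ R)
      a∈   : a ∈ X
      b∈   : b ∈ X
      c∈   : c ∈ X
      only : ∀ {y} → y ∈ X → y ∈ a ∷ b ∷ c ∷ []

  rotate : ∀ {a b c P Q R} → Tri a b c P Q R → Tri b c a Q R P
  rotate {a} {b} {c} {P} {Q} {R} (tri isc a∈ b∈ c∈ only) = tri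
    (subst (λ z → IsC (b ∷ z)) (++-assoc Q (c ∷ R) (a ∷ P)) (IsC-rotate (a ∷ P) (b ∷ Q ++ c ∷ R) isc)) b∈ c∈ a∈
    (λ y∈ → case only y∈ of λ
      { (here e) → there (there (here e)) ; (there (here e)) → here e ; (there (there (here e))) → there (here e) })

  -- `D` replaces the third arc; `a`, `b`, `c` and `D` take five of the nine vertices allowed.
  two-arcs : ∀ {a b c P Q R} → Tri a b c P Q R → length P + length Q ≤ 4
  two-arcs {a} {b} {c} {P} {Q} {R} (tri isc a∈ b∈ c∈ _) =
    lin _ _ 0 (≤-trans (≤-reflexive (cong₂ (λ d l → 2 + (d + l)) (sym |D|) (sym (length-++ P))))
      (detour₁ R (P ++ b ∷ Q) D (IsC-rotate (a ∷ P ++ b ∷ Q) (c ∷ R) (subst (λ z → IsC (a ∷ z)) (sym (++-assoc P (b ∷ Q) (c ∷ R))) isc))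
        (comp-out C₀ c∈ a∈))) (eq (length P) (length Q))
    where
    eq : ∀ p q → 9 + (p + q) + 0 ≡ 2 + (2 + (p + suc q)) + 4
    eq p q = solve (p ∷ q ∷ [])

  arc-≥ : ∀ {a b c P Q R} → Tri a b c P Q R → w ∉ P → 2 ≤ length P
  arc-≥ {P = P} {Q} {R} (tri isc a∈ b∈ _ _) w∉ = subst (_≤ length P) |D| (detour₂ P (Q ++ _ ∷ R) D isc (comp-out C₀ a∈ b∈) w∉)

  nd-tri : ∀ {a b c P Q R} → Tri a b c P Q R → NoDup (a ∷ P ++ b ∷ Q ++ c ∷ R)
  nd-tri t = IsC-nd (Tri.isc t)

  P∥Q : ∀ {a b c P Q R} → Tri a b c P Q R → ∀ {y} → y ∈ P → y ∉ Q
  P∥Q {P = P} {Q} t y∈ y∈′ = NoDup-disjoint {xs = P} (NoDup-tail (nd-tri t)) y∈ (there (∈-++⁺ˡ y∈′))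

  -- `w` misses `Q` or `R`. The arc it misses has at least two vertices, and together with `P` at
  -- most four.
  arc-≤ : ∀ {a b c P Q R} → Tri a b c P Q R → length P ≤ 2
  arc-≤ {a} {b} {c} {P} {Q} {R} t with w ∈? Q
  ... | no w∉Q = lin _ _ 0 (+-mono-≤ (two-arcs t) (arc-≥ (rotate t) w∉Q)) (eq (length P) (length Q))
    where
    eq : ∀ p q → 4 + q + p + 0 ≡ p + q + 2 + 2
    eq p q = solve (p ∷ q ∷ [])
  ... | yes w∈Q = lin _ _ 0 (+-mono-≤ (two-arcs (rotate (rotate t))) (arc-≥ (rotate (rotate t)) (P∥Q (rotate t) w∈Q))) (eq (length P) (length R))
    where
    eq : ∀ p q → 4 + q + p + 0 ≡ q + p + 2 + 2
    eq p q = solve (p ∷ q ∷ [])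

  1≤arc : ∀ {a b c P Q R} → Tri a b c P Q R → 1 ≤ length P
  1≤arc {P = P} t with w ∈? P
  ... | no w∉ = ≤-trans (s≤s z≤n) (arc-≥ t w∉)
  ... | yes w∈P = ∈⇒1≤length w∈P

  -- Both cycles run through `a`, `b`, `c`, `p`, `q`, `δ`, `D` and `R`, and they divide the rest of
  -- `P` and `Q`. The sum of their lengths leaves no room for `R`, but no arc is empty.
  separated : ∀ {a b c P Q R} → Tri a b c P Q R → ∀ {p q} δ → p ∈ P → q ∈ Q → Out p δ q → (∀ {y} → y ∈ δ → y ∉ D) → ⊥
  separated {a} {b} {c} {P} {Q} {R} t@(tri isc a∈ b∈ c∈ _) {p} {q} δ p∈ q∈ (out wδ ndδ oδ) δ∥D with ∈-∃++ p∈ | ∈-∃++ q∈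
  ... | P₁ , P₂ , refl | Q₁ , Q₂ , refl = <⇒≱ (1≤arc (rotate (rotate t)))
    (arith (length P₁) (length P₂) (length Q₁) (length Q₂) (length R) (length D) (length δ) |D|
      (two-cycles ρ base first-cycle second-cycle all-of-it (` 2 ⊕ ` 6 ⊕ ` 10) isc nd-all cy cz ≤-refl))
    where
    ρ = δ ∷ D ∷ (a ∷ []) ∷ P₁ ∷ (p ∷ []) ∷ P₂ ∷ (b ∷ []) ∷ Q₁ ∷ (q ∷ []) ∷ Q₂ ∷ (c ∷ []) ∷ R ∷ []
    base first-cycle second-cycle all-of-it : Exp 12
    base = ` 2 ⊕ (` 3 ⊕ ` 4 ⊕ ` 5) ⊕ ` 6 ⊕ (` 7 ⊕ ` 8 ⊕ ` 9) ⊕ ` 10 ⊕ ` 11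
    first-cycle = ` 6 ⊕ rev (` 5) ⊕ ` 4 ⊕ ` 0 ⊕ ` 8 ⊕ ` 9 ⊕ ` 10 ⊕ ` 11 ⊕ ` 2 ⊕ ` 1
    second-cycle = ` 6 ⊕ ` 7 ⊕ ` 8 ⊕ rev (` 0) ⊕ ` 4 ⊕ rev (` 3) ⊕ ` 2 ⊕ rev (` 11) ⊕ ` 10 ⊕ ` 1
    all-of-it = ` 0 ⊕ ` 1 ⊕ base
    nd-all : NoDup (⟦ ρ ⟧ all-of-it)
    nd-all = NoDup-++ ndδ (NoDup-++ (Comp.ndD C₀) (IsC-nd isc) (λ y∈ y∈L → Comp.D∥L C₀ y∈ (IsC-∈ isc y∈L)))
      (λ y∈ y∈′ → [ δ∥D y∈ , (λ y∈L → oδ y∈ (IsC-∈ isc y∈L)) ]′ (∈-++⁻ D y∈′))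
    walks = W-split (P₁ ++ p ∷ P₂) (closed′ isc)
    aPb = W-split P₁ (proj₁ walks)
    walks′ = W-split (Q₁ ++ q ∷ Q₂) (proj₂ walks)
    bQc = W-split Q₁ (proj₁ walks′)
    cy : Closed (⟦ ρ ⟧ first-cycle)
    cy = W-++ (reverse P₂) (W-reverse P₂ (proj₂ aPb)) (W-++ δ wδ (W-++ Q₂ (proj₂ bQc) (W-++ R (proj₂ walks′) (Out.walk (comp-out C₀ a∈ b∈)))))
    cz : Closed (⟦ ρ ⟧ second-cycle)
    cz = W-++ Q₁ (proj₁ bQc) (W-++ (reverse δ) (W-reverse δ wδ) (W-++ (reverse P₁) (W-reverse P₁ (proj₁ aPb))
      (W-++ (reverse R) (W-reverse R (proj₂ walks′)) (Out.walk (comp-out C₀ c∈ b∈)))))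
    arith : ∀ p₁ p₂ q₁ q₂ r d δ → d ≡ 2 →
      1 + (p₂ + (1 + (δ + (1 + (q₂ + (1 + (r + (1 + d)))))))) + (1 + (q₁ + (1 + (δ + (1 + (p₁ + (1 + (r + (1 + d)))))))))
        ≤ 9 + (1 + ((p₁ + (1 + p₂)) + (1 + ((q₁ + (1 + q₂)) + (1 + r))))) → r ≤ 0
    arith p₁ p₂ q₁ q₂ r .2 δ refl h = lin r 0 (2 * δ) h (eq p₁ p₂ q₁ q₂ r δ)
      where
      eq : ∀ p₁ p₂ q₁ q₂ r δ → 9 + (1 + ((p₁ + (1 + p₂)) + (1 + ((q₁ + (1 + q₂)) + (1 + r))))) + r + 2 * δ ≡
        1 + (p₂ + (1 + (δ + (1 + (q₂ + (1 + (r + (1 + 2)))))))) + (1 + (q₁ + (1 + (δ + (1 + (p₁ + (1 + (r + (1 + 2))))))))) + 0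
      eq p₁ p₂ q₁ q₂ r δ = solve (p₁ ∷ p₂ ∷ q₁ ∷ q₂ ∷ r ∷ δ ∷ [])

  arc-∉X : ∀ {a b c P Q R} → Tri a b c P Q R → ∀ {e} → e ∈ P → e ∉ X
  arc-∉X {a} {b} {c} {P} {Q} t {e} e∈ e∈X = on-arc (Tri.only t e∈X)
    where
    on-arc : e ∉ a ∷ b ∷ c ∷ []
    on-arc (here refl) = NoDup-head (nd-tri t) (∈-++⁺ˡ e∈)
    on-arc (there (here refl)) = NoDup-disjoint {xs = P} (NoDup-tail (nd-tri t)) e∈ (here refl)
    on-arc (there (there (here refl))) = NoDup-disjoint {xs = P} (NoDup-tail (nd-tri t)) e∈ (there (∈-++⁺ʳ Q (here refl)))

  -- The two cycles share `a`, `b`, `c`, `e`, `D` and `D′` and divide the rest of `L`; the sum of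
  -- their lengths then leaves no vertex for `D′`.
  opposite : ∀ {a b c P Q R} → Tri a b c P Q R → ∀ {v} (C′ : Comp v) {e} → e ∈ P → e ∈ Comp.X C′ → c ∉ Comp.X C′
  opposite {a} {b} {c} {P} {Q} {R} t@(tri isc a∈ b∈ c∈ only) C′ {e} e∈ e∈′ c∈′ with ∈-∃++ e∈
  ... | P₁ , P₂ , refl = contradiction (arith (length P₁) (length P₂) (length Q) (length R) (length D) (length D′) |D| (1≤D C′)
      (two-cycles ρ base first-cycle second-cycle all-of-it (` 2 ⊕ ` 6 ⊕ ` 8) isc nd-all cy cz ≤-refl)) λ { (s≤s ()) }
    where
    D′ = Comp.D C′
    ρ = D′ ∷ D ∷ (a ∷ []) ∷ P₁ ∷ (e ∷ []) ∷ P₂ ∷ (b ∷ []) ∷ Q ∷ (c ∷ []) ∷ R ∷ []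
    base first-cycle second-cycle all-of-it : Exp 10
    base = ` 2 ⊕ (` 3 ⊕ ` 4 ⊕ ` 5) ⊕ ` 6 ⊕ ` 7 ⊕ ` 8 ⊕ ` 9
    first-cycle = ` 2 ⊕ ` 3 ⊕ ` 4 ⊕ ` 0 ⊕ ` 8 ⊕ rev (` 7) ⊕ ` 6 ⊕ ` 1
    second-cycle = ` 6 ⊕ rev (` 5) ⊕ ` 4 ⊕ ` 0 ⊕ ` 8 ⊕ ` 9 ⊕ ` 2 ⊕ ` 1
    all-of-it = ` 0 ⊕ ` 1 ⊕ base
    nd-all : NoDup (⟦ ρ ⟧ all-of-it)
    nd-all = NoDup-++ (Comp.ndD C′) (NoDup-++ (Comp.ndD C₀) (IsC-nd isc) (λ y∈ y∈L → Comp.D∥L C₀ y∈ (IsC-∈ isc y∈L)))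
      (λ y∈ y∈′ → [ comps-disjoint C′ C₀ e∈′ (arc-∉X t e∈) y∈ , (λ y∈L → Comp.D∥L C′ y∈ (IsC-∈ isc y∈L)) ]′ (∈-++⁻ D y∈′))
    walks = W-split (P₁ ++ e ∷ P₂) (closed′ isc)
    aPb = W-split P₁ (proj₁ walks)
    bQc = W-split Q (proj₂ walks)
    cy : Closed (⟦ ρ ⟧ first-cycle)
    cy = W-++ P₁ (proj₁ aPb) (W-++ D′ (Out.walk (comp-out C′ e∈′ c∈′)) (W-++ (reverse Q) (W-reverse Q (proj₁ bQc)) (Out.walk (comp-out C₀ b∈ a∈))))
    cz : Closed (⟦ ρ ⟧ second-cycle)
    cz = W-++ (reverse P₂) (W-reverse P₂ (proj₂ aPb)) (W-++ D′ (Out.walk (comp-out C′ e∈′ c∈′)) (W-++ R (proj₂ bQc) (Out.walk (comp-out C₀ a∈ b∈))))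
    arith : ∀ p₁ p₂ q r d d′ → d ≡ 2 → 1 ≤ d′ →
      1 + (p₁ + (1 + (d′ + (1 + (q + (1 + d)))))) + (1 + (p₂ + (1 + (d′ + (1 + (r + (1 + d)))))))
        ≤ 9 + (1 + ((p₁ + (1 + p₂)) + (1 + (q + (1 + r))))) → 2 ≤ 1
    arith p₁ p₂ q r .2 d′ refl 1≤ h = lin 2 1 0 (+-mono-≤ h (*-monoʳ-≤ 2 1≤)) (eq p₁ p₂ q r d′)
      where
      eq : ∀ p₁ p₂ q r d′ → 9 + (1 + ((p₁ + (1 + p₂)) + (1 + (q + (1 + r))))) + 2 * d′ + 2 + 0 ≡
        1 + (p₁ + (1 + (d′ + (1 + (q + (1 + 2)))))) + (1 + (p₂ + (1 + (d′ + (1 + (r + (1 + 2))))))) + 2 * 1 + 1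
      eq p₁ p₂ q r d′ = solve (p₁ ∷ p₂ ∷ q ∷ r ∷ d′ ∷ [])

  -- If `w` is inside `P`, then `Q` and `R` avoid it and have at least two vertices each; of the
  -- nine vertices allowed this leaves two for the component.
  pair-small : ∀ {a b c P Q R} → Tri a b c P Q R → ∀ {v} (C′ : Comp v) → a ∈ Comp.X C′ → b ∈ Comp.X C′ → length (Comp.D C′) ≤ 2
  pair-small {a} {b} {c} {P} {Q} {R} t C′ a∈′ b∈′ with w ∈? P
  ... | no w∉P  = ≤-trans (detour₂ P (Q ++ c ∷ R) (Comp.D C′) (Tri.isc t) (comp-out C′ a∈′ b∈′) w∉P) (arc-≤ t)
  ... | yes w∈P = lin _ _ 0 (+-mono-≤ (+-mono-≤ (arc-≥ (rotate t) (P∥Q t w∈P))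
        (arc-≥ (rotate (rotate t)) (λ w∈R → P∥Q (rotate (rotate t)) w∈R w∈P)))
      (subst (λ l → 2 + (length (Comp.D C′) + l) ≤ 9) (length-++ Q) (detour₁ P (Q ++ c ∷ R) (Comp.D C′) (Tri.isc t) (comp-out C′ a∈′ b∈′))))
      (eq (length Q) (length R) (length (Comp.D C′)))
    where
    eq : ∀ q r d → q + r + 9 + d + 0 ≡ 2 + 2 + (2 + (d + (q + suc r))) + 2
    eq q r d = solve (q ∷ r ∷ d ∷ [])

  private
    arc-split-≤ : ∀ {a b c P₁ e P₂ Q R} → Tri a b c (P₁ ++ e ∷ P₂) Q R → length P₁ ≤ 1 × length P₂ ≤ 1
    arc-split-≤ {P₁ = P₁} {e} {P₂} t = let h = subst (_≤ 2) (length-++ P₁) (arc-≤ t) in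
      lin _ _ (length P₂) h (eq₁ (length P₁) (length P₂)) , lin _ _ (length P₁) h (eq₂ (length P₁) (length P₂))
      where
      eq₁ : ∀ p q → 2 + p + q ≡ p + suc q + 1
      eq₁ p q = solve (p ∷ q ∷ [])
      eq₂ : ∀ p q → 2 + q + p ≡ p + suc q + 1
      eq₂ p q = solve (p ∷ q ∷ [])

    -- `e` is one of at most two vertices of `P`, so at most one lies between `a` and `e`, and the
    -- component has to fit there. If that vertex is `w`, the bound 9 together with the sizes of `Q`
    -- and `R` says the same.
    end-a : ∀ {a b c P Q R} → Tri a b c P Q R → ∀ {v} (C′ : Comp v) {e} → e ∈ P → e ∈ Comp.X C′ → a ∈ Comp.X C′ → length (Comp.D C′) ≤ 1
    end-a {a} {b} {c} {P} {Q} {R} t C′ {e} e∈ e∈′ a∈′ with ∈-∃++ e∈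
    ... | P₁ , P₂ , refl with w ∈? P₁ | subst (λ z → IsC (a ∷ z)) (++-assoc P₁ (e ∷ P₂) (b ∷ Q ++ c ∷ R)) (Tri.isc t)
    ...   | no w∉ | i = ≤-trans (detour₂ P₁ _ (Comp.D C′) i (comp-out C′ a∈′ e∈′) w∉) (proj₁ (arc-split-≤ t))
    ...   | yes w∈P₁ | i = lin _ _ (length P₂) (+-mono-≤ (+-mono-≤ (arc-≥ (rotate t) (P∥Q t (∈-++⁺ˡ w∈P₁)))
          (arc-≥ (rotate (rotate t)) (λ w∈R → P∥Q (rotate (rotate t)) w∈R (∈-++⁺ˡ w∈P₁))))
        (subst (λ l → 2 + (length (Comp.D C′) + l) ≤ 9) (length-⟦⟧ (P₂ ∷ (b ∷ []) ∷ Q ∷ (c ∷ []) ∷ R ∷ []) (` 0 ⊕ ` 1 ⊕ ` 2 ⊕ ` 3 ⊕ ` 4))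
          (detour₁ P₁ (P₂ ++ b ∷ Q ++ c ∷ R) (Comp.D C′) i (comp-out C′ a∈′ e∈′))))
        (eq (length Q) (length R) (length (Comp.D C′)) (length P₂))
      where
      eq : ∀ q r d p → q + r + 9 + d + p ≡ 2 + 2 + (2 + (d + (p + (1 + (q + (1 + r)))))) + 1
      eq q r d p = solve (q ∷ r ∷ d ∷ p ∷ [])

    end-b : ∀ {a b c P Q R} → Tri a b c P Q R → ∀ {v} (C′ : Comp v) {e} → e ∈ P → e ∈ Comp.X C′ → b ∈ Comp.X C′ → length (Comp.D C′) ≤ 1
    end-b {a} {b} {c} {P} {Q} {R} t C′ {e} e∈ e∈′ b∈′ with ∈-∃++ e∈
    ... | P₁ , P₂ , refl with w ∈? P₂ | rotated-at-e
      where
      rotated-at-e : IsC (e ∷ P₂ ++ b ∷ (Q ++ c ∷ R ++ a ∷ P₁))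
      rotated-at-e = isC (subst Closed assoc₂ (Closed-rotate (a ∷ P₁) (e ∷ P₂ ++ b ∷ Q ++ c ∷ R) (subst (λ z → Closed (a ∷ z)) assoc₁ (closed′ (Tri.isc t)))))
        (≋-trans (≋-by ((e ∷ P₂) ∷ (b ∷ Q) ∷ (c ∷ R) ∷ (a ∷ P₁) ∷ []) (` 0 ⊕ ` 1 ⊕ ` 2 ⊕ ` 3) (` 3 ⊕ ` 0 ⊕ ` 1 ⊕ ` 2))
          (≋-trans (perm (λ u → cong (occ u) (sym (cong (a ∷_) assoc₁)))) (same (Tri.isc t))))
        where
        assoc₁ : (P₁ ++ e ∷ P₂) ++ b ∷ Q ++ c ∷ R ≡ P₁ ++ e ∷ P₂ ++ b ∷ Q ++ c ∷ R
        assoc₁ = ++-assoc P₁ (e ∷ P₂) (b ∷ Q ++ c ∷ R)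
        assoc₂ : (e ∷ P₂ ++ b ∷ Q ++ c ∷ R) ++ a ∷ P₁ ≡ e ∷ P₂ ++ b ∷ Q ++ c ∷ R ++ a ∷ P₁
        assoc₂ = cong (e ∷_) (trans (++-assoc P₂ (b ∷ Q ++ c ∷ R) (a ∷ P₁))
          (cong (λ z → P₂ ++ b ∷ z) (++-assoc Q (c ∷ R) (a ∷ P₁))))
    ...   | no w∉ | i = ≤-trans (detour₂ P₂ _ (Comp.D C′) i (comp-out C′ e∈′ b∈′) w∉) (proj₂ (arc-split-≤ t))
    ...   | yes w∈P₂ | i = lin _ _ (length P₁) (+-mono-≤ (+-mono-≤ (arc-≥ (rotate t) (P∥Q t (∈-++⁺ʳ P₁ (there w∈P₂))))
          (arc-≥ (rotate (rotate t)) (λ w∈R → P∥Q (rotate (rotate t)) w∈R (∈-++⁺ʳ P₁ (there w∈P₂)))))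
        (subst (λ l → 2 + (length (Comp.D C′) + l) ≤ 9) (length-⟦⟧ (Q ∷ (c ∷ []) ∷ R ∷ (a ∷ []) ∷ P₁ ∷ []) (` 0 ⊕ ` 1 ⊕ ` 2 ⊕ ` 3 ⊕ ` 4))
          (detour₁ P₂ (Q ++ c ∷ R ++ a ∷ P₁) (Comp.D C′) i (comp-out C′ e∈′ b∈′))))
        (eq (length Q) (length R) (length (Comp.D C′)) (length P₁))
      where
      eq : ∀ q r d p → q + r + 9 + d + p ≡ 2 + 2 + (2 + (d + (q + (1 + (r + (1 + p)))))) + 1
      eq q r d p = solve (q ∷ r ∷ d ∷ p ∷ [])

  on-cycle : ∀ {a b c P Q R} → Tri a b c P Q R → ∀ {y} → y ∈ L → y ∈ a ∷ b ∷ c ∷ [] ⊎ y ∈ P ⊎ y ∈ Q ⊎ y ∈ R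
  on-cycle {a} {b} {c} {P} {Q} {R} t y∈ with ∈-++⁻ (a ∷ P) (∈-IsC (Tri.isc t) y∈)
  ... | inj₁ (here e)  = inj₁ (here e)
  ... | inj₁ (there p) = inj₂ (inj₁ p)
  ... | inj₂ p with ∈-++⁻ (b ∷ Q) p
  ...   | inj₁ (here e)  = inj₁ (there (here e))
  ...   | inj₁ (there q) = inj₂ (inj₂ (inj₁ q))
  ...   | inj₂ (here e)  = inj₁ (there (there (here e)))
  ...   | inj₂ (there q) = inj₂ (inj₂ (inj₂ q))

  -- Since `c`, the other arcs and the second vertex of `P` are excluded, the component has at most
  -- the neighbours `a`, `b`, `e`, hence at least two vertices. But it also has `a` or `b` as a
  -- neighbour besides `e`, and then `end-a` or `end-b` allows only one.
  arc-free : ∀ {a b c P Q R} → Tri a b c P Q R → ∀ {v} (C′ : Comp v) {e} → e ∈ P → e ∉ Comp.X C′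
  arc-free {a} {b} {c} {P} {Q} {R} t {v} C′ {e} e∈ e∈′ = <⇒≱ 2≤D (D-small (other-∈ X′ (Comp.ndX C′) (Comp.2≤X C′)))
    where
    X′ = Comp.X C′
    via : ∀ {f} → f ∈ X′ → Out e (v ∷ []) f
    via f∈ = out (adj-sym (Comp.joined C′ (Comp.v∈D C′) e∈′) , Comp.joined C′ (Comp.v∈D C′) f∈) NoDup-[x]
      (sole (Comp.D∥L C′ (Comp.v∈D C′)))
    via-∉D : ∀ {y} → y ∈ v ∷ [] → y ∉ D
    via-∉D (here refl) = comps-disjoint C′ C₀ e∈′ (arc-∉X t e∈) (Comp.v∈D C′)
    same-arc : ∀ {f} → f ∈ P → f ≢ e → f ∉ X′
    same-arc f∈P f≢e f∈ with pair-≡ P (arc-≤ t) e∈ f∈P f≢e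
    ... | inj₁ eq = not-consecutive C′ (IsC-rotate (a ∷ []) _ (subst (λ z → IsC (a ∷ z ++ b ∷ Q ++ c ∷ R)) eq (Tri.isc t))) e∈′ f∈
    ... | inj₂ eq = not-consecutive C′ (IsC-rotate (a ∷ []) _ (subst (λ z → IsC (a ∷ z ++ b ∷ Q ++ c ∷ R)) eq (Tri.isc t))) f∈ e∈′
    where-is : ∀ {f} → f ∈ X′ → f ∈ a ∷ b ∷ e ∷ []
    where-is {f} f∈ with f ≟ e
    ... | yes refl = there (there (here refl))
    ... | no f≢e with on-cycle t (Comp.X⊆L C′ f∈)
    ...   | inj₁ (here refl)                 = here refl
    ...   | inj₁ (there (here refl))         = there (here refl)
    ...   | inj₁ (there (there (here refl))) = contradiction f∈ (opposite t C′ e∈ e∈′)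
    ...   | inj₂ (inj₁ f∈P)                  = contradiction f∈ (same-arc f∈P f≢e)
    ...   | inj₂ (inj₂ (inj₁ f∈Q))           = ⊥-elim (separated t (v ∷ []) e∈ f∈Q (via f∈) via-∉D)
    ...   | inj₂ (inj₂ (inj₂ f∈R))           = ⊥-elim (separated (rotate (rotate t)) (v ∷ []) f∈R e∈ (Out-reverse (v ∷ []) (via f∈)) via-∉D)
    2≤D : 2 ≤ length (Comp.D C′)
    2≤D = lin _ _ 0 (+-mono-≤ (length-⊆ (Comp.ndX C′) where-is) (≤-reflexive (sym (Comp.size C′)))) (eq (length X′) (length (Comp.D C′)))
      where
      eq : ∀ x d → 3 + (x + d) + 2 + 0 ≡ x + 5 + d
      eq x d = solve (x ∷ d ∷ [])
    D-small : (∃ λ f → f ∈ X′ × f ≢ e) → length (Comp.D C′) ≤ 1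
    D-small (f , f∈ , f≢e) with where-is f∈
    ... | here refl                 = end-a t C′ e∈ e∈′ f∈
    ... | there (here refl)         = end-b t C′ e∈ e∈′ f∈
    ... | there (there (here refl)) = contradiction refl f≢e

  X′⊆ : ∀ {a b c P Q R} → Tri a b c P Q R → ∀ {v} (C′ : Comp v) {y} → y ∈ Comp.X C′ → y ∈ a ∷ b ∷ c ∷ []
  X′⊆ t C′ y∈ with on-cycle t (Comp.X⊆L C′ y∈)
  ... | inj₁ p               = p
  ... | inj₂ (inj₁ p)        = contradiction y∈ (arc-free t C′ p)
  ... | inj₂ (inj₂ (inj₁ p)) = contradiction y∈ (arc-free (rotate t) C′ p)
  ... | inj₂ (inj₂ (inj₂ p)) = contradiction y∈ (arc-free (rotate (rotate t)) C′ p)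

  D′-small : ∀ {a b c P Q R} → Tri a b c P Q R → ∀ {v} (C′ : Comp v) → length (Comp.D C′) ≤ 2
  D′-small {a} t C′ with other-∈ {e = a} (Comp.X C′) (Comp.ndX C′) (Comp.2≤X C′)
  ... | x , x∈ , _ = first-end t (X′⊆ t C′ x∈)
    where
    with-a : ∀ {a b c P Q R} → Tri a b c P Q R → a ∈ Comp.X C′ → length (Comp.D C′) ≤ 2
    with-a {a} t a∈′ with other-∈ {e = a} (Comp.X C′) (Comp.ndX C′) (Comp.2≤X C′)
    ... | y , y∈ , y≢a with X′⊆ t C′ y∈
    ...   | here refl                 = contradiction refl y≢a
    ...   | there (here refl)         = pair-small t C′ a∈′ y∈
    ...   | there (there (here refl)) = pair-small (rotate (rotate t)) C′ y∈ a∈′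
    first-end : ∀ {a b c P Q R} → Tri a b c P Q R → x ∈ a ∷ b ∷ c ∷ [] → length (Comp.D C′) ≤ 2
    first-end t (here refl)                 = with-a t x∈
    first-end t (there (here refl))         = with-a (rotate t) x∈
    first-end t (there (there (here refl))) = with-a (rotate (rotate t)) x∈

  some-tri : ∃₂ λ a b → ∃₂ λ c P → ∃₂ λ Q R → Tri a b c P Q R
  some-tri = from X (Comp.ndX C₀) |X| id id
    where
    from : ∀ xs → NoDup xs → length xs ≡ 3 → (∀ {y} → y ∈ xs → y ∈ X) → (∀ {y} → y ∈ X → y ∈ xs) →
      ∃₂ λ a b → ∃₂ λ c P → ∃₂ λ Q R → Tri a b c P Q R
    from (x ∷ y ∷ z ∷ []) nd′ refl to only with locate₂ (Comp.X⊆L C₀ (to (here refl))) (Comp.X⊆L C₀ (to (there (here refl)))) (λ { refl → NoDup-head nd′ (here refl) })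
    ... | g , h , i with ∈-++⁻ (x ∷ g) (∈-IsC i (Comp.X⊆L C₀ (to (there (there (here refl))))))
    ...   | inj₁ (here refl) = contradiction (there (here refl)) (NoDup-head nd′)
    ...   | inj₂ (here refl) = contradiction (here refl) (NoDup-head (NoDup-tail nd′))
    ...   | inj₁ (there z∈g) with ∈-∃++ z∈g
    ...     | g₁ , g₂ , refl = x , z , y , g₁ , g₂ , h , tri (subst (λ l → IsC (x ∷ l)) (++-assoc g₁ (z ∷ g₂) (y ∷ h)) i)
              (to (here refl)) (to (there (there (here refl)))) (to (there (here refl)))
              (λ p → case only p of λ { (here e) → here e ; (there (here e)) → there (there (here e)) ; (there (there (here e))) → there (here e) })
    from (x ∷ y ∷ z ∷ []) nd′ refl to only | g , h , i | inj₂ (there z∈h) with ∈-∃++ z∈h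
    ...     | h₁ , h₂ , refl = x , y , z , g , h₁ , h₂ , tri i (to (here refl)) (to (there (here refl))) (to (there (there (here refl)))) only

  embed : ∀ {a b c P Q R} → Tri a b c P Q R → G ⊆ (K 3 ⊹ M (n * 2))
  embed {a} {b} {c} {P} {Q} {R} t = ⊆-join G top intoM intoM-injective
    (λ u∉ y∉ e → intoM-edge u∉ (zone-sep closed-zone u∉ y∉ e) (adj⇒≢ e))
    where
    top = a ∷ b ∷ c ∷ []
    zs = P ∷ Q ∷ R ∷ []
    arc-∉top : ∀ {a b c P Q R} → Tri a b c P Q R → ∀ {u} → u ∈ P → u ∉ a ∷ b ∷ c ∷ []
    arc-∉top t u∈ (here refl) = arc-∉X t u∈ (Tri.a∈ t)
    arc-∉top t u∈ (there (here refl)) = arc-∉X t u∈ (Tri.b∈ t)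
    arc-∉top t u∈ (there (there (here refl))) = arc-∉X t u∈ (Tri.c∈ t)
    unrotate : ∀ {y : Fin n} {a b c} → y ∈ a ∷ b ∷ c ∷ [] → y ∈ b ∷ c ∷ a ∷ []
    unrotate (here e) = there (there (here e))
    unrotate (there (here e)) = here e
    unrotate (there (there (here e))) = there (here e)
    zone-Dom : ∀ {z u} → z ∈ zs → u ∈ z → u ∉ top
    zone-Dom (here refl) u∈ = arc-∉top t u∈
    zone-Dom (there (here refl)) u∈ p = arc-∉top (rotate t) u∈ (unrotate p)
    zone-Dom (there (there (here refl))) u∈ p = arc-∉top (rotate (rotate t)) u∈ (unrotate (unrotate p))
    zone-L : ∀ {z u} → z ∈ zs → u ∈ z → u ∈ L
    zone-L (here refl) u∈ = IsC-∈ (Tri.isc t) (there (∈-++⁺ˡ u∈))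
    zone-L (there (here refl)) u∈ = IsC-∈ (Tri.isc (rotate t)) (there (∈-++⁺ˡ u∈))
    zone-L (there (there (here refl))) u∈ = IsC-∈ (Tri.isc (rotate (rotate t))) (there (∈-++⁺ˡ u∈))
    cover : ∀ {u} → u ∉ top → u ∈ L → ∃ λ z → z ∈ zs × u ∈ z
    cover u∉ u∈ with on-cycle t u∈
    ... | inj₁ p               = contradiction p u∉
    ... | inj₂ (inj₁ p)        = P , here refl , p
    ... | inj₂ (inj₂ (inj₁ p)) = Q , there (here refl) , p
    ... | inj₂ (inj₂ (inj₂ p)) = R , there (there (here refl)) , p
    off-Dom : ∀ {u y} → u ∉ top → u ∉ L → y ∈ off-class u → y ∉ top
    off-Dom _ _ y∈ p = proj₁ (off-class-∈ y∈) (Comp.X⊆L C₀ (top-X p))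
      where
      top-X : ∀ {y} → y ∈ top → y ∈ X
      top-X (here refl) = Tri.a∈ t
      top-X (there (here refl)) = Tri.b∈ t
      top-X (there (there (here refl))) = Tri.c∈ t
    disjoint : Disjoint zs
    disjoint = (λ { u∈ (here refl) → P∥Q t u∈ ; u∈ (there (here refl)) u∈′ → P∥Q (rotate (rotate t)) u∈′ u∈ }) ,
      (λ { u∈ (here refl) → P∥Q (rotate t) u∈ }) , (λ _ ()) , tt
    Dom : Fin n → Set
    Dom u = u ∉ top
    open Zones {Dom} zs disjoint zone-Dom zone-L cover off-Dom
    arc-closed : ∀ {a b c P Q R} → Tri a b c P Q R → ∀ {u v} → u ∈ P → v ∉ a ∷ b ∷ c ∷ [] → Adj G u v → v ∈ P
    arc-closed {P = P} t {u} {v} u∈ v∉ e with v ∈? L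
    ... | no v∉L = ⊥-elim ([ (λ u∈D → Comp.D∥L (comp v v∉L) u∈D (IsC-∈ (Tri.isc t) (there (∈-++⁺ˡ u∈)))) , arc-free t (comp v v∉L) u∈ ]′
          (Comp.nbr (comp v v∉L) (Comp.v∈D (comp v v∉L)) (adj-sym e)))
    ... | yes v∈ with on-cycle t v∈
    ...   | inj₁ p               = contradiction p v∉
    ...   | inj₂ (inj₁ p)        = p
    ...   | inj₂ (inj₂ (inj₁ p)) = ⊥-elim (separated t [] u∈ p (out e NoDup-[] (λ ())) (λ ()))
    ...   | inj₂ (inj₂ (inj₂ p)) = ⊥-elim (separated (rotate (rotate t)) [] p u∈ (out (adj-sym e) NoDup-[] (λ ())) (λ ()))
    closed-zone : ∀ {z u v} → z ∈ zs → u ∈ z → v ∉ top → Adj G u v → v ∈ z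
    closed-zone (here refl) u∈ v∉ e = arc-closed t u∈ v∉ e
    closed-zone (there (here refl)) u∈ v∉ e = arc-closed (rotate t) u∈ (v∉ ∘ unrotate ∘ unrotate) e
    closed-zone (there (there (here refl))) u∈ v∉ e = arc-closed (rotate (rotate t)) u∈ (v∉ ∘ unrotate) e
    small : ∀ {z} → z ∈ zs → length z ≤ 2
    small (here refl) = arc-≤ t
    small (there (here refl)) = arc-≤ (rotate t)
    small (there (there (here refl))) = arc-≤ (rotate (rotate t))
    class-bound : ∀ {u} → u ∉ top → length (zone-class zs u) ≤ 2
    class-bound = zone-bound small (λ {u} u∉ _ → D′-small t (comp u u∉))
    open IntoM G zone-classes class-bound

  caseIII : ∃ λ t → 7 ≤ t × G ⊆ (K 3 ⊹ M t)
  caseIII = let (_ , _ , _ , _ , _ , _ , t) = some-tri in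
    n * 2 , ≤-trans (n≤1+n 7) (*-monoˡ-≤ 2 4≤n) , embed t
    where
    4≤n : 4 ≤ n
    4≤n = ≤-trans (s≤s 3≤) (NoDup⇒length≤ (NoDup-∷ (Comp.D∥L C₀ (Comp.v∈D C₀)) nd))

-- All components have two neighbours on the cycle

ordered-pair : ∀ {n} {e f : Fin n} {xs} → e ∈ xs → f ∈ xs → e ≢ f →
  (∃₂ λ l m → ∃ λ r → xs ≡ l ++ e ∷ m ++ f ∷ r) ⊎ (∃₂ λ l m → ∃ λ r → xs ≡ l ++ f ∷ m ++ e ∷ r)
ordered-pair (here refl) (here refl) ne = contradiction refl ne
ordered-pair (here refl) (there f∈)  ne = let (m , r , eq) = ∈-∃++ f∈ in inj₁ ([] , m , r , cong (_ ∷_) eq)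
ordered-pair (there e∈)  (here refl) ne = let (m , r , eq) = ∈-∃++ e∈ in inj₂ ([] , m , r , cong (_ ∷_) eq)
ordered-pair (there e∈)  (there f∈)  ne with ordered-pair e∈ f∈ ne
... | inj₁ (l , m , r , eq) = inj₁ (_ ∷ l , m , r , cong (_ ∷_) eq)
... | inj₂ (l , m , r , eq) = inj₂ (_ ∷ l , m , r , cong (_ ∷_) eq)

module _ {n : ℕ} where

  last-∈ : ∀ {y q : Fin n} {r} xs zs → xs ++ y ∷ [] ≡ zs ++ q ∷ r → y ∈ q ∷ r
  last-∈ {y} xs []           eq = subst (y ∈_) eq (∈-++⁺ʳ xs (here refl))
  last-∈ []       (_ ∷ [])    ()
  last-∈ []       (_ ∷ _ ∷ _) ()
  last-∈ (_ ∷ xs) (_ ∷ zs)    eq = last-∈ xs zs (∷-injectiveʳ eq)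

  mid-∈ : ∀ {x y p q t : Fin n} {α} l m {r} → x ∷ α ++ y ∷ [] ≡ l ++ p ∷ m ++ q ∷ r → NoDup (x ∷ α ++ y ∷ []) → t ∈ m → t ∈ α
  mid-∈ {x} {y} {p} {q} {t} {α} l m {r} eq nd t∈ with subst (t ∈_) (sym eq) (∈-++⁺ʳ l (there (∈-++⁺ˡ t∈)))
  ... | here refl = contradiction t∈ (not-head l eq)
    where
    not-head : ∀ l → t ∷ α ++ y ∷ [] ≡ l ++ p ∷ m ++ q ∷ r → t ∉ m
    not-head []      eq′  t∈′ = NoDup-head nd (subst (t ∈_) (sym (∷-injectiveʳ eq′)) (∈-++⁺ˡ t∈′))
    not-head (_ ∷ l) eq′  t∈′ = NoDup-head nd (subst (t ∈_) (sym (∷-injectiveʳ eq′)) (∈-++⁺ʳ l (there (∈-++⁺ˡ t∈′))))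
  ... | there t∈′ with ∈-++⁻ α t∈′
  ...   | inj₁ t∈α = t∈α
  ...   | inj₂ (here refl) = contradiction (last-∈ (x ∷ α) (l ++ p ∷ m) (trans eq (sym (++-assoc l (p ∷ m) (q ∷ r)))))
          (NoDup-disjoint {xs = l ++ p ∷ m} (subst NoDup (trans eq (sym (++-assoc l (p ∷ m) (q ∷ r)))) nd) (∈-++⁺ʳ l (there t∈)))

  ends-strict : ∀ {x y p q : Fin n} {α m} l r → x ∷ α ++ y ∷ [] ≡ l ++ p ∷ m ++ q ∷ r → p ∉ x ∷ y ∷ [] ⊎ q ∉ x ∷ y ∷ [] →
    1 ≤ length l + length r
  ends-strict (_ ∷ _) r       eq ne = s≤s z≤n
  ends-strict []      (_ ∷ _) eq ne = s≤s z≤n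
  ends-strict {x} {y} {p} {q} {α} {m} [] [] eq ne with ∷-injectiveˡ eq | proj₂ (∷ʳ-injective (x ∷ α) (p ∷ m) eq)
  ... | refl | refl = ⊥-elim ([ (λ f → f (here refl)) , (λ f → f (there (here refl))) ]′ ne)

  pair-length : ∀ {x y p q : Fin n} {α} l m r → x ∷ α ++ y ∷ [] ≡ l ++ p ∷ m ++ q ∷ r →
    length α + 2 ≡ length l + (1 + (length m + (1 + length r)))
  pair-length {p = p} {q} {α} l m r eq = trans (trans (+-comm (length α) 2) (cong suc (trans (+-comm 1 (length α)) (sym (length-++ α)))))
    (trans (cong length eq) (length-⟦⟧ (l ∷ (p ∷ []) ∷ m ∷ (q ∷ []) ∷ r ∷ []) (` 0 ⊕ ` 1 ⊕ ` 2 ⊕ ` 3 ⊕ ` 4)))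

module CaseII {n : ℕ} {G : Graph n} {k : ℕ} {w : Fin n} (setting : Setting G k w)
  {L : List (Fin n)} (longest-L : Longest G w L)
  (|X|≡2 : ∀ {v} (c : Outside.Comp setting longest-L v) → length (Outside.Comp.X c) ≡ 2) where

  open Setting setting
  open Walks G
  open Around setting longest-L
  open Outside setting longest-L
  open Common setting longest-L

  |D| : ∀ {v} (c : Comp v) → suc (length (Comp.D c)) ≡ k
  |D| c = suc-injective (trans (cong (_+ length (Comp.D c)) (sym (|X|≡2 c))) (Comp.size c))

  |D|≤ : ∀ {v} (c : Comp v) → length (Comp.D c) ≤ k ∸ 1
  |D|≤ c = subst (λ m → length (Comp.D c) ≤ m ∸ 1) (|D| c) ≤-refl

  -- Both cycles contain `x`, `y`, `p`, `q`, `δ` and all of `D`, and they divide the rest of `L`. As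
  -- `D` has `k ∸ 1` vertices, the sum of their lengths is too large by one even for empty `δ`.
  separated : ∀ {v} (C : Comp v) {x y} α β → IsC (x ∷ α ++ y ∷ β) → x ∈ Comp.X C → y ∈ Comp.X C →
    ∀ {p q} δ → p ∈ α → q ∈ β → Out p δ q → (∀ {u} → u ∈ δ → u ∉ Comp.D C) → ⊥
  separated C {x} {y} α β isc x∈ y∈ {p} {q} δ p∈ q∈ (out wδ ndδ oδ) δ∥D with ∈-∃++ p∈ | ∈-∃++ q∈
  ... | α₁ , α₂ , refl | β₁ , β₂ , refl = contradiction
      (arith (length α₁) (length α₂) (length β₁) (length β₂) (length D) (length δ) (|D| C)
        (two-cycles ρ base first-cycle second-cycle all-of-it (` 2 ⊕ ` 6 ⊕ ` 4) isc nd-all cy cz ≤-refl)) λ ()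
    where
    open Comp C using (D)
    ρ = δ ∷ D ∷ (x ∷ []) ∷ α₁ ∷ (p ∷ []) ∷ α₂ ∷ (y ∷ []) ∷ β₁ ∷ (q ∷ []) ∷ β₂ ∷ []
    base first-cycle second-cycle all-of-it : Exp 10
    base = ` 2 ⊕ (` 3 ⊕ ` 4 ⊕ ` 5) ⊕ ` 6 ⊕ ` 7 ⊕ ` 8 ⊕ ` 9
    first-cycle = ` 2 ⊕ ` 3 ⊕ ` 4 ⊕ ` 0 ⊕ ` 8 ⊕ rev (` 7) ⊕ ` 6 ⊕ ` 1
    second-cycle = ` 6 ⊕ rev (` 5) ⊕ ` 4 ⊕ ` 0 ⊕ ` 8 ⊕ ` 9 ⊕ ` 2 ⊕ ` 1
    all-of-it = ` 0 ⊕ ` 1 ⊕ base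
    nd-all : NoDup (⟦ ρ ⟧ all-of-it)
    nd-all = NoDup-++ ndδ (NoDup-++ (Comp.ndD C) (IsC-nd isc) (λ u∈ u∈L → Comp.D∥L C u∈ (IsC-∈ isc u∈L)))
      (λ u∈ u∈′ → [ δ∥D u∈ , (λ u∈L → oδ u∈ (IsC-∈ isc u∈L)) ]′ (∈-++⁻ D u∈′))
    walks = W-split (α₁ ++ p ∷ α₂) (closed′ isc)
    xαy = W-split α₁ (proj₁ walks)
    yβx = W-split β₁ (proj₂ walks)
    cy : Closed (⟦ ρ ⟧ first-cycle)
    cy = W-++ α₁ (proj₁ xαy) (W-++ δ wδ (W-++ (reverse β₁) (W-reverse β₁ (proj₁ yβx)) (Out.walk (comp-out C y∈ x∈))))
    cz : Closed (⟦ ρ ⟧ second-cycle)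
    cz = W-++ (reverse α₂) (W-reverse α₂ (proj₂ xαy)) (W-++ δ wδ (W-++ β₂ (proj₂ yβx) (Out.walk (comp-out C x∈ y∈))))
    arith : ∀ a₁ a₂ b₁ b₂ d δ {k} → suc d ≡ k →
      1 + (a₁ + (1 + (δ + (1 + (b₁ + (1 + d)))))) + (1 + (a₂ + (1 + (δ + (1 + (b₂ + (1 + d)))))))
        ≤ 2 * k + 1 + (1 + ((a₁ + (1 + a₂)) + (1 + (b₁ + (1 + b₂))))) → 1 ≤ 0
    arith a₁ a₂ b₁ b₂ d δ refl h = lin 1 0 (2 * δ) h (eq a₁ a₂ b₁ b₂ d δ)
      where
      eq : ∀ a₁ a₂ b₁ b₂ d δ → 2 * suc d + 1 + (1 + ((a₁ + (1 + a₂)) + (1 + (b₁ + (1 + b₂))))) + 1 + 2 * δ ≡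
        1 + (a₁ + (1 + (δ + (1 + (b₁ + (1 + d)))))) + (1 + (a₂ + (1 + (δ + (1 + (b₂ + (1 + d))))))) + 0
      eq a₁ a₂ b₁ b₂ d δ = solve (a₁ ∷ a₂ ∷ b₁ ∷ b₂ ∷ d ∷ δ ∷ [])

  cycle-∉ends : ∀ {x y α β} → IsC (x ∷ α ++ y ∷ β) → ∀ {e} → e ∈ α → e ∉ x ∷ y ∷ []
  cycle-∉ends isc e∈ (here refl) = NoDup-head (IsC-nd isc) (∈-++⁺ˡ e∈)
  cycle-∉ends {α = α} isc e∈ (there (here refl)) = NoDup-disjoint {xs = α} (NoDup-tail (IsC-nd isc)) e∈ (here refl)

  on-cycle : ∀ {x y α β} → IsC (x ∷ α ++ y ∷ β) → ∀ {e} → e ∈ L → e ∈ x ∷ y ∷ [] ⊎ e ∈ α ⊎ e ∈ β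
  on-cycle {x} {y} {α} {β} isc e∈ with ∈-++⁻ (x ∷ α) (∈-IsC isc e∈)
  ... | inj₁ (here p)  = inj₁ (here p)
  ... | inj₁ (there p) = inj₂ (inj₁ p)
  ... | inj₂ (here p)  = inj₁ (there (here p))
  ... | inj₂ (there p) = inj₂ (inj₂ p)

  on-L : ∀ {x y} α β → IsC (x ∷ α ++ y ∷ β) → ∀ {e} → e ∈ α → e ∈ L
  on-L α β isc e∈ = IsC-∈ isc (there (∈-++⁺ˡ e∈))

  |cycle| : ∀ {x y} α β → IsC (x ∷ α ++ y ∷ β) → 2 + (length α + length β) ≤ 2 * k + 1
  |cycle| {x} {y} α β isc = ≤-trans (≤-reflexive (trans (sym (cong suc (+-suc (length α) (length β)))) (trans (cong suc (sym (length-++ α))) (IsC-length isc)))) |L|≤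

  embed-F₁ : ∀ {v} (C : Comp v) {x y} α β → IsC (x ∷ α ++ y ∷ β) → x ∈ Comp.X C → y ∈ Comp.X C →
    (∀ {u e} → u ∉ L → e ∈ L → e ∉ x ∷ y ∷ [] → ¬ Adj G u e) → length α ≤ k → length β ≤ k ∸ 1 → G ⊆ F₁ n k
  embed-F₁ C {x} {y} α β isc x∈ y∈ no-extra |α|≤ |β|≤ = ⊆-F₁ G 2≤k x y α |α|≤ zone-classes
    (zone-bound (sole |β|≤) (λ u∉ _ → |D|≤ (comp _ u∉))) big-sep (zone-sep closed-zone)
    where
    isc′ : IsC (y ∷ β ++ x ∷ α)
    isc′ = swap α β isc
    Dom : Fin n → Set
    Dom u = u ∉ x ∷ y ∷ [] × u ∉ α
    swap-ends : ∀ {u} → u ∈ x ∷ y ∷ [] → u ∈ y ∷ x ∷ []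
    swap-ends (here p) = there (here p)
    swap-ends (there (here p)) = here p
    ends-L : ∀ {u} → u ∈ x ∷ y ∷ [] → u ∈ L
    ends-L (here refl) = Comp.X⊆L C x∈
    ends-L (there (here refl)) = Comp.X⊆L C y∈
    zone-Dom : ∀ {z u} → z ∈ β ∷ [] → u ∈ z → Dom u
    zone-Dom (here refl) u∈ = (λ p → cycle-∉ends isc′ u∈ (swap-ends p)) ,
      λ u∈α → NoDup-disjoint {xs = x ∷ α} (IsC-nd isc) (there u∈α) (there u∈)
    zone-L : ∀ {z u} → z ∈ β ∷ [] → u ∈ z → u ∈ L
    zone-L (here refl) u∈ = on-L β α isc′ u∈
    cover : ∀ {u} → Dom u → u ∈ L → ∃ λ z → z ∈ β ∷ [] × u ∈ z
    cover (u∉ , u∉α) u∈ with on-cycle isc u∈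
    ... | inj₁ p        = contradiction p u∉
    ... | inj₂ (inj₁ p) = contradiction p u∉α
    ... | inj₂ (inj₂ p) = β , here refl , p
    off-Dom : ∀ {u z} → Dom u → u ∉ L → z ∈ off-class u → Dom z
    off-Dom _ _ z∈ = let z∉ = proj₁ (off-class-∈ z∈) in (λ p → z∉ (ends-L p)) , λ p → z∉ (on-L α β isc p)
    disjoint : Disjoint (β ∷ [])
    disjoint = (λ _ ()) , tt
    open Zones {Dom} (β ∷ []) disjoint zone-Dom zone-L cover off-Dom
    big-sep : ∀ {u v} → u ∈ α → Adj G u v → v ∈ x ∷ y ∷ [] ⊎ v ∈ α
    big-sep {u} {v} u∈ a with v ∈? L
    ... | no v∉  = contradiction (adj-sym a) (no-extra v∉ (on-L α β isc u∈) (cycle-∉ends isc u∈))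
    ... | yes v∈ with on-cycle isc v∈
    ...   | inj₁ p        = inj₁ p
    ...   | inj₂ (inj₁ p) = inj₂ p
    ...   | inj₂ (inj₂ p) = ⊥-elim (separated C α β isc x∈ y∈ [] u∈ p (out a NoDup-[] (λ ())) (λ ()))
    closed-zone : ∀ {z u v} → z ∈ β ∷ [] → u ∈ z → Dom v → Adj G u v → v ∈ z
    closed-zone {u = u} {v} (here refl) u∈ (v∉ , v∉α) a with v ∈? L
    ... | no v∉L = contradiction (adj-sym a) (no-extra v∉L (on-L β α isc′ u∈) (cycle-∉ends isc′ u∈ ∘ swap-ends))
    ... | yes v∈ with on-cycle isc v∈
    ...   | inj₁ p        = contradiction p v∉
    ...   | inj₂ (inj₁ p) = contradiction p v∉α
    ...   | inj₂ (inj₂ p) = p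

  rotate-pair : ∀ {x y p q} γ κ → IsC (x ∷ γ ++ y ∷ κ) → ∀ l m r → x ∷ γ ++ y ∷ [] ≡ l ++ p ∷ m ++ q ∷ r →
    IsC (p ∷ m ++ q ∷ (r ++ κ ++ l))
  rotate-pair {x} {y} {p} {q} γ κ isc l m r eq = subst IsC assoc (IsC-rotate l ((p ∷ m ++ q ∷ r) ++ κ)
    (subst IsC (trans (sym (cong (x ∷_) (++-assoc γ (y ∷ []) κ)))
      (trans (cong (_++ κ) eq) (++-assoc l (p ∷ m ++ q ∷ r) κ))) isc))
    where
    assoc : ((p ∷ m ++ q ∷ r) ++ κ) ++ l ≡ p ∷ m ++ q ∷ (r ++ κ ++ l)
    assoc = trans (++-assoc (p ∷ m ++ q ∷ r) κ l) (cong (p ∷_) (++-assoc m (q ∷ r) (κ ++ l)))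

  nd-arc : ∀ {x y} γ κ → IsC (x ∷ γ ++ y ∷ κ) → NoDup (x ∷ γ ++ y ∷ [])
  nd-arc {x} {y} γ κ isc = NoDup-⊑ (⊑-by ((x ∷ γ) ∷ (y ∷ []) ∷ κ ∷ []) (` 0 ⊕ ` 1) (` 0 ⊕ ` 1 ⊕ ` 2)) (IsC-nd isc)

  -- The cycle z J y′ y I with components attached to {z, y} and to {z, y′}.
  record TwoPairs {v v′} (C : Comp v) (C′ : Comp v′) (z y y′ : Fin n) (J I : List (Fin n)) : Set where
    constructor twoPairs
    field
      isc   : IsC (z ∷ J ++ y′ ∷ y ∷ I)
      z∈    : z ∈ Comp.X C
      y∈    : y ∈ Comp.X C
      z∈′   : z ∈ Comp.X C′
      y′∈   : y′ ∈ Comp.X C′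
      |I|≤  : length I ≤ k ∸ 1
      |J|≤  : length J ≤ k ∸ 1

  module _ {v v′} {C : Comp v} {C′ : Comp v′} where

    mirror : ∀ {z y y′ J I} → TwoPairs C C′ z y y′ J I → TwoPairs C′ C z y′ y (reverse I) (reverse J)
    mirror {z} {y} {y′} {J} {I} (twoPairs isc z∈ y∈ z∈′ y′∈ |I|≤ |J|≤) = twoPairs
      (isC (W-++ (reverse I) (W-reverse I (proj₂ (proj₂ walks))) (adj-sym (proj₁ (proj₂ walks)) , W-reverse J (proj₁ walks)))
        (≋-trans (≋-by ((z ∷ []) ∷ J ∷ (y′ ∷ []) ∷ (y ∷ []) ∷ I ∷ []) (` 0 ⊕ rev (` 4) ⊕ ` 3 ⊕ ` 2 ⊕ rev (` 1)) (` 0 ⊕ ` 1 ⊕ ` 2 ⊕ ` 3 ⊕ ` 4)) (same isc)))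
      z∈′ y′∈ z∈ y∈ (subst (_≤ k ∸ 1) (sym (length-reverse J)) |J|≤) (subst (_≤ k ∸ 1) (sym (length-reverse I)) |I|≤)
      where
      walks : W z J y′ × Adj G y′ y × W y I z
      walks = W-split J (closed′ isc)

    split-at-y : ∀ {z y y′ J I} → TwoPairs C C′ z y y′ J I → IsC (y ∷ I ++ z ∷ (J ++ y′ ∷ []))
    split-at-y {z} {y} {y′} {J} {I} t = IsC-rotate (z ∷ (J ++ y′ ∷ [])) (y ∷ I)
      (subst (λ l → IsC (z ∷ l)) (sym (++-assoc J (y′ ∷ []) (y ∷ I))) (TwoPairs.isc t))

    I-separated : ∀ {z y y′ J I} → TwoPairs C C′ z y y′ J I → ∀ {p q} δ → p ∈ I → q ∈ J ++ y′ ∷ [] → Out p δ q →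
      (∀ {u} → u ∈ δ → u ∉ Comp.D C) → ⊥
    I-separated {J = J} {I} t δ = separated C I (J ++ _ ∷ []) (split-at-y t) (TwoPairs.y∈ t) (TwoPairs.z∈ t) δ

    -- The component has `k ∸ 1` vertices, more than there is room for between two vertices of the
    -- arc other than its two ends. If `w` lies there, the component together with the other side,
    -- which includes `J` with at least `k ∸ 1` vertices, exceeds `2 * k + 1`.
    inner-pair : ∀ {z y y′ J I} → TwoPairs C C′ z y y′ J I → ∀ {v″} (C″ : Comp v″) {e f} l m r →
      y ∷ I ++ z ∷ [] ≡ l ++ e ∷ m ++ f ∷ r → 1 ≤ length l + length r → e ∈ Comp.X C″ → f ∉ Comp.X C″
    inner-pair {z} {y} {y′} {J} {I} t C″ {e} {f} l m r eq 1≤ e∈ f∈ with w ∈? m | rotate-pair I (J ++ y′ ∷ []) (split-at-y t) l m r eq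
    ... | no w∉m | i = contradiction (arith (length l) (length m) (length r) (length I) (length (Comp.D C″)) {k ∸ 1} 1≤ (pair-length l m r eq) (TwoPairs.|I|≤ t)
          (detour₂ m _ (Comp.D C″) i (comp-out C″ e∈ f∈) w∉m) (cong (_∸ 1) (|D| C″))) λ ()
      where
      arith : ∀ l m r i d {k} → 1 ≤ l + r → i + 2 ≡ l + (1 + (m + (1 + r))) → i ≤ k → d ≤ m → d ≡ k → 1 ≤ 0
      arith l m r i d 1≤ e i≤ d≤ refl = lin _ _ 0 (+-mono-≤ (+-mono-≤ 1≤ (≤-reflexive (sym e))) (+-mono-≤ i≤ d≤)) (eq′ l m r i d)
        where
        eq′ : ∀ l m r i d → l + r + (i + 2) + (d + m) + 1 + 0 ≡ 1 + (l + (1 + (m + (1 + r)))) + (i + d) + 0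
        eq′ l m r i d = solve (l ∷ m ∷ r ∷ i ∷ d ∷ [])
    ... | yes w∈m | i = contradiction (arith (length l) (length r) (length J) (length (Comp.D C″)) (length (Comp.D C′)) (|D| C″) (|D| C′) 1≤
          (subst (λ x → 2 + (length (Comp.D C″) + x) ≤ 2 * k + 1)
            (length-⟦⟧ (r ∷ J ∷ (y′ ∷ []) ∷ l ∷ []) (` 0 ⊕ (` 1 ⊕ ` 2) ⊕ ` 3))
            (detour₁ m (r ++ (J ++ y′ ∷ []) ++ l) (Comp.D C″) i (comp-out C″ e∈ f∈)))
          (detour₂ J (y ∷ I) (Comp.D C′) (TwoPairs.isc t) (comp-out C′ (TwoPairs.z∈′ t) (TwoPairs.y′∈ t)) w∉J)) λ ()
      where
      w∉J : w ∉ J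
      w∉J w∈J = NoDup-disjoint {xs = e ∷ m} (IsC-nd i) (there w∈m) (there (∈-++⁺ʳ r (∈-++⁺ˡ (∈-++⁺ˡ w∈J))))
      arith : ∀ l r j d d′ {k} → suc d ≡ k → suc d′ ≡ k → 1 ≤ l + r → 2 + (d + (r + ((j + 1) + l))) ≤ 2 * k + 1 → d′ ≤ j → 1 ≤ 0
      arith l r j d .d refl refl 1≤ h d≤ = lin _ _ 0 (+-mono-≤ (+-mono-≤ 1≤ h) d≤) (eq′ l r j d)
        where
        eq′ : ∀ l r j d → l + r + (2 * suc d + 1) + j + 1 + 0 ≡ 1 + (2 + (d + (r + ((j + 1) + l)))) + d + 0
        eq′ l r j d = solve (l ∷ r ∷ j ∷ d ∷ [])

  pair-only : ∀ {v} (C : Comp v) {x y} α β → IsC (x ∷ α ++ y ∷ β) → x ∈ Comp.X C → y ∈ Comp.X C → ∀ {e} → e ∈ Comp.X C → e ∈ x ∷ y ∷ []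
  pair-only C {x} {y} α β isc x∈ y∈ {e} e∈ with e ∈? (x ∷ y ∷ [])
  ... | yes p = p
  ... | no ¬p = ⊥-elim (<⇒≱ (length-⊆ (NoDup-∷ ¬p (NoDup-∷ (λ { (here refl) → NoDup-head (IsC-nd isc) (∈-++⁺ʳ α (here refl)) }) NoDup-[x]))
      (cons e∈ (both x∈ y∈)))
    (≤-reflexive (|X|≡2 C)))

  link : ∀ {v} (C : Comp v) {e f} → e ∈ Comp.X C → f ∈ Comp.X C → Out e (v ∷ []) f
  link C e∈ f∈ = out (adj-sym (Comp.joined C (Comp.v∈D C) e∈) , Comp.joined C (Comp.v∈D C) f∈) NoDup-[x]
    (sole (Comp.D∥L C (Comp.v∈D C)))

  link-∉ : ∀ {v v′} (C : Comp v) (C′ : Comp v′) {e} → e ∈ Comp.X C → e ∉ Comp.X C′ → ∀ {u} → u ∈ v ∷ [] → u ∉ Comp.D C′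
  link-∉ C C′ e∈ e∉ (here refl) = comps-disjoint C C′ e∈ e∉ (Comp.v∈D C)

  -- A second neighbour on the same arc or at its ends contradicts `inner-pair`; one elsewhere on
  -- the cycle gives a path that `I-separated` forbids.
  I-free : ∀ {v v′} {C : Comp v} {C′ : Comp v′} {z y y′ J I} → TwoPairs C C′ z y y′ J I →
    ∀ {v″} (C″ : Comp v″) {e} → e ∈ I → e ∉ Comp.X C″
  I-free {C = C} {C′} {z} {y} {y′} {J} {I} t {v″} C″ {e} e∈I e∈ with other-∈ {e = e} (Comp.X C″) (Comp.ndX C″) (Comp.2≤X C″)
  ... | f , f∈ , f≢e = place (∈-++⁻ (y ∷ I) (∈-IsC (split-at-y t) (Comp.X⊆L C″ f∈)))
    where
    e∉ends : e ∉ y ∷ z ∷ []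
    e∉ends = cycle-∉ends (split-at-y t) e∈I
    in-arc : f ∈ y ∷ I ++ z ∷ [] → ⊥
    in-arc f∈′ with ordered-pair (there (∈-++⁺ˡ e∈I)) f∈′ (f≢e ∘ sym)
    ... | inj₁ (l , m , r , eq) = inner-pair t C″ l m r eq (ends-strict l r eq (inj₁ e∉ends)) e∈ f∈
    ... | inj₂ (l , m , r , eq) = inner-pair t C″ l m r eq (ends-strict l r eq (inj₂ e∉ends)) f∈ e∈
    place : f ∈ y ∷ I ⊎ f ∈ z ∷ (J ++ y′ ∷ []) → ⊥
    place (inj₁ p)           = in-arc (∈-++⁺ˡ p)
    place (inj₂ (here refl)) = in-arc (∈-++⁺ʳ (y ∷ I) (here refl))
    place (inj₂ (there p))   = I-separated t (v″ ∷ []) e∈I p (link C″ e∈ f∈)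
      (link-∉ C″ C e∈ (e∉ends ∘ pair-only C I (J ++ y′ ∷ []) (split-at-y t) (TwoPairs.y∈ t) (TwoPairs.z∈ t)))

  embed-F : ∀ {v v′} {C : Comp v} {C′ : Comp v′} {z y y′ J I} → TwoPairs C C′ z y y′ J I → G ⊆ Fgraph n n k
  embed-F {C = C} {C′} {z} {y} {y′} {J} {I} t = ⊆-Fgraph G 2≤k y y′ z zone-classes
    (zone-bound (both (TwoPairs.|I|≤ t) (TwoPairs.|J|≤ t)) (λ u∉ _ → |D|≤ (comp _ u∉)))
    (zone-sep closed-zone) side side-class side-y side-y′
    where
    top = y ∷ y′ ∷ z ∷ []
    zs = I ∷ J ∷ []
    isc = split-at-y t
    t′ = mirror t
    isc′ = split-at-y t′
    J-rev : ∀ {u} → u ∈ J → u ∈ reverse J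
    J-rev = reverse⁺
    top-L : ∀ {u} → u ∈ top → u ∈ L
    top-L (here refl) = Comp.X⊆L C (TwoPairs.y∈ t)
    top-L (there (here refl)) = Comp.X⊆L C′ (TwoPairs.y′∈ t)
    top-L (there (there (here refl))) = Comp.X⊆L C (TwoPairs.z∈ t)
    I∉top : ∀ {u} → u ∈ I → u ∉ top
    I∉top u∈ (here refl) = cycle-∉ends isc u∈ (here refl)
    I∉top u∈ (there (here refl)) = NoDup-disjoint {xs = y ∷ I} (IsC-nd isc) (there u∈) (there (∈-++⁺ʳ J (here refl)))
    I∉top u∈ (there (there (here refl))) = cycle-∉ends isc u∈ (there (here refl))
    J∉top : ∀ {u} → u ∈ J → u ∉ top
    J∉top u∈ (here refl) = NoDup-disjoint {xs = y′ ∷ reverse J} (IsC-nd isc′) (there (J-rev u∈)) (there (∈-++⁺ʳ (reverse I) (here refl)))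
    J∉top u∈ (there (here refl)) = cycle-∉ends isc′ (J-rev u∈) (here refl)
    J∉top u∈ (there (there (here refl))) = cycle-∉ends isc′ (J-rev u∈) (there (here refl))
    I∥J : ∀ {u} → u ∈ I → u ∉ J
    I∥J u∈ u∈J = NoDup-disjoint {xs = y ∷ I} (IsC-nd isc) (there u∈) (there (∈-++⁺ˡ u∈J))
    where-on-L : ∀ {u} → u ∉ top → u ∈ L → u ∈ I ⊎ u ∈ J
    where-on-L u∉ u∈ with ∈-++⁻ (y ∷ I) (∈-IsC isc u∈)
    ... | inj₁ (here refl) = contradiction (here refl) u∉
    ... | inj₁ (there p)   = inj₁ p
    ... | inj₂ (here refl) = contradiction (there (there (here refl))) u∉
    ... | inj₂ (there p) with ∈-++⁻ J p
    ...   | inj₁ q           = inj₂ q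
    ...   | inj₂ (here refl) = contradiction (there (here refl)) u∉
    zone-Dom : ∀ {s u} → s ∈ zs → u ∈ s → u ∉ top
    zone-Dom (here refl) = I∉top
    zone-Dom (there (here refl)) = J∉top
    zone-L : ∀ {s u} → s ∈ zs → u ∈ s → u ∈ L
    zone-L (here refl) u∈ = IsC-∈ isc (there (∈-++⁺ˡ u∈))
    zone-L (there (here refl)) u∈ = IsC-∈ isc (∈-++⁺ʳ (y ∷ I) (there (∈-++⁺ˡ u∈)))
    cover : ∀ {u} → u ∉ top → u ∈ L → ∃ λ s → s ∈ zs × u ∈ s
    cover u∉ u∈ = [ (λ p → I , here refl , p) , (λ p → J , there (here refl) , p) ]′ (where-on-L u∉ u∈)
    Dom : Fin n → Set
    Dom u = u ∉ top
    disjoint : Disjoint zs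
    disjoint = (λ { u∈ (here refl) → I∥J u∈ }) , (λ _ ()) , tt
    off-Dom : ∀ {u s} → Dom u → u ∉ L → s ∈ off-class u → Dom s
    off-Dom _ _ p q = proj₁ (off-class-∈ p) (top-L q)
    open Zones {Dom} zs disjoint zone-Dom zone-L cover off-Dom
    off-adj : ∀ {u v} → u ∈ L → (v∉ : v ∉ L) → Adj G u v → u ∈ Comp.X (comp v v∉)
    off-adj {v = v} u∈ v∉ a = [ (λ u∈D → contradiction u∈ (Comp.D∥L (comp v v∉) u∈D)) , id ]′ (Comp.nbr (comp v v∉) (Comp.v∈D (comp v v∉)) (adj-sym a))
    edge : ∀ {u v} → Adj G u v → Out u [] v
    edge a = out a NoDup-[] (λ ())
    I-closed : ∀ {u v} → u ∈ I → Adj G u v → v ∈ I ⊎ v ∈ y ∷ z ∷ []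
    I-closed {u} {v} u∈ a with v ∈? L
    ... | no v∉ = contradiction (off-adj (zone-L (here refl) u∈) v∉ a) (I-free t (comp v v∉) u∈)
    ... | yes v∈ with ∈-++⁻ (y ∷ I) (∈-IsC isc v∈)
    ...   | inj₁ (here refl) = inj₂ (here refl)
    ...   | inj₁ (there p)   = inj₁ p
    ...   | inj₂ (here refl) = inj₂ (there (here refl))
    ...   | inj₂ (there p)   = ⊥-elim (I-separated t [] u∈ p (edge a) (λ ()))
    J-closed : ∀ {u v} → u ∈ J → Adj G u v → v ∈ J ⊎ v ∈ y′ ∷ z ∷ []
    J-closed {u} {v} u∈ a with v ∈? L
    ... | no v∉ = contradiction (off-adj (zone-L (there (here refl)) u∈) v∉ a) (I-free t′ (comp v v∉) (J-rev u∈))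
    ... | yes v∈ with ∈-++⁻ (y′ ∷ reverse J) (∈-IsC isc′ v∈)
    ...   | inj₁ (here refl) = inj₂ (here refl)
    ...   | inj₁ (there p)   = inj₁ (reverse⁻ p)
    ...   | inj₂ (here refl) = inj₂ (there (here refl))
    ...   | inj₂ (there p)   = ⊥-elim (I-separated t′ [] (J-rev u∈) p (edge a) (λ ()))
    closed-zone : ∀ {s u v} → s ∈ zs → u ∈ s → v ∉ top → Adj G u v → v ∈ s
    closed-zone (here refl) u∈ v∉ a = [ id , (λ { (here refl) → contradiction (here refl) v∉ ; (there (here refl)) → contradiction (there (there (here refl))) v∉ }) ]′ (I-closed u∈ a)
    closed-zone (there (here refl)) u∈ v∉ a = [ id , (λ { (here refl) → contradiction (there (here refl)) v∉ ; (there (here refl)) → contradiction (there (there (here refl))) v∉ }) ]′ (J-closed u∈ a)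
    -- A component has two of `y`, `y′`, `z` as neighbours, but not both `y` and `y′`, which are
    -- consecutive on the cycle; so adjacency to `y` decides its side.
    side : Fin n → Bool
    side u with u ∈? L
    ... | yes _ = does (u ∈? I)
    ... | no _  = adj G u y
    side-I : ∀ {u} → u ∈ I → side u ≡ true
    side-I {u} u∈ with u ∈? L
    ... | yes _ = dec-true (u ∈? I) u∈
    ... | no u∉ = contradiction (zone-L (here refl) u∈) u∉
    side-J : ∀ {u} → u ∈ J → side u ≡ false
    side-J {u} u∈ with u ∈? L
    ... | yes _ = dec-false (u ∈? I) (λ u∈I → I∥J u∈I u∈)
    ... | no u∉ = contradiction (zone-L (there (here refl)) u∈) u∉
    side-off : ∀ {u} → u ∉ L → side u ≡ adj G u y
    side-off {u} u∉ with u ∈? L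
    ... | yes u∈ = contradiction u∈ u∉
    ... | no _   = refl
    side-class : ∀ {u v} → u ∉ top → v ∈ zone-class zs u → side u ≡ side v
    side-class {u} {v} u∉ v∈ with u ∈? L
    ... | yes u∈ = [ (λ p → trans (side-in-I p) (sym (side-I (subst (v ∈_) (zone-class-in zs disjoint (here refl) p) v∈))))
                   , (λ p → trans (side-in-J p) (sym (side-J (subst (v ∈_) (zone-class-in zs disjoint (there (here refl)) p) v∈)))) ]′
                   (where-on-L u∉ u∈)
      where
      side-in-I : u ∈ I → does (u ∈? I) ≡ true
      side-in-I p = dec-true (u ∈? I) p
      side-in-J : u ∈ J → does (u ∈? I) ≡ false
      side-in-J p = dec-false (u ∈? I) (λ q → I∥J q p)
    ... | no u∉L = trans same-adj (sym (side-off (proj₁ (off-class-∈ v∈o))))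
      where
      v∈o : v ∈ off-class u
      v∈o = subst (v ∈_) (zone-class-out zs (λ s∈ u∈s → u∉L (zone-L s∈ u∈s))) v∈
      C″ = comp u u∉L
      v∈D : v ∈ Comp.D C″
      v∈D = off-class-D C″ (Comp.v∈D C″) v∈o
      y-adj : ∀ {a b} → a ∈ Comp.D C″ → b ∈ Comp.D C″ → adj G a y ≡ true → adj G b y ≡ true
      y-adj a∈ b∈ p = Comp.joined C″ b∈ ([ (λ y∈D → contradiction (top-L (here refl)) (Comp.D∥L C″ y∈D)) , id ]′ (Comp.nbr C″ a∈ p))
      same-adj : adj G u y ≡ adj G v y
      same-adj with adj G u y in p | adj G v y in q
      ... | true  | true  = refl
      ... | false | false = refl
      ... | true  | false = trans (sym (y-adj (Comp.v∈D C″) v∈D p)) q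
      ... | false | true  = trans (sym p) (y-adj v∈D (Comp.v∈D C″) q)
    y≢y′ : y ≢ y′
    y≢y′ refl = NoDup-head (IsC-nd isc) (∈-++⁺ʳ I (there (∈-++⁺ʳ J (here refl))))
    z≢y : z ≢ y
    z≢y refl = NoDup-head (IsC-nd isc) (∈-++⁺ʳ I (here refl))
    z≢y′ : z ≢ y′
    z≢y′ refl = NoDup-head (IsC-nd isc′) (∈-++⁺ʳ (reverse J) (here refl))
    side-y : ∀ {u} → u ∉ top → Adj G u y → side u ≡ true
    side-y {u} u∉ a = by-place (u ∈? L)
      where
      by-place : Dec (u ∈ L) → side u ≡ true
      by-place (no u∉L) = trans (side-off u∉L) a
      by-place (yes u∈) with where-on-L u∉ u∈
      ... | inj₁ p = side-I p
      ... | inj₂ p = ⊥-elim ([ (λ y∈J → J∉top y∈J (here refl)) , (λ { (here e) → y≢y′ e ; (there (here e)) → z≢y (sym e) }) ]′ (J-closed p a))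
    side-y′ : ∀ {u} → u ∉ top → Adj G u y′ → side u ≡ false
    side-y′ {u} u∉ a = by-place (u ∈? L)
      where
      by-place : Dec (u ∈ L) → side u ≡ false
      by-place (yes u∈) with where-on-L u∉ u∈
      ... | inj₁ p = ⊥-elim ([ (λ y′∈I → I∉top y′∈I (there (here refl))) , (λ { (here e) → y≢y′ (sym e) ; (there (here e)) → z≢y′ (sym e) }) ]′ (I-closed p a))
      ... | inj₂ p = side-J p
      by-place (no u∉L) with adj G u y in p
      ... | false = trans (side-off u∉L) p
      ... | true  = ⊥-elim (not-consecutive (comp u u∉L)
            (subst IsC (cong (λ l → y′ ∷ y ∷ l) refl) (IsC-rotate (z ∷ J) (y′ ∷ y ∷ I) (TwoPairs.isc t)))
            (off-adj (top-L (there (here refl))) u∉L (adj-sym a)) (off-adj (top-L (here refl)) u∉L (adj-sym p)))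

  -- Exactly one vertex of the closed arc lies outside the stretch from `e` to `f`, and it is an end
  -- of the arc. So the two pairs share the other end, and their remaining members are consecutive
  -- on the cycle.
  attach : ∀ {v v′} (C : Comp v) (C′ : Comp v′) {x y} γ κ → IsC (x ∷ γ ++ y ∷ κ) → x ∈ Comp.X C → y ∈ Comp.X C →
    ∀ {e f} l m r → x ∷ γ ++ y ∷ [] ≡ l ++ e ∷ m ++ f ∷ r → 1 ≤ length l + length r → length l + length r ≤ 1 →
    e ∈ Comp.X C′ → f ∈ Comp.X C′ → length m ≤ k ∸ 1 → length κ ≤ k ∸ 1 → G ⊆ Fgraph n n k
  attach C C′ {x} {y} γ κ isc x∈ y∈ {e} {f} [] m (a ∷ []) eq _ _ e∈ f∈ |m|≤ |κ|≤
    with ∷-injectiveˡ eq | ∷ʳ-injective (x ∷ γ) ((e ∷ m) ++ f ∷ []) (trans eq (sym (++-assoc (e ∷ m) (f ∷ []) (a ∷ []))))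
  ... | refl | refl , refl = embed-F {C = C} {C′} (twoPairs (subst (λ s → IsC (x ∷ s)) (++-assoc m (f ∷ []) (y ∷ κ)) isc) x∈ y∈ e∈ f∈ |κ|≤ |m|≤)
  attach C C′ {x} {y} γ κ isc x∈ y∈ {e} {f} (a ∷ []) m [] eq _ _ e∈ f∈ |m|≤ |κ|≤
    with ∷-injectiveˡ eq | ∷ʳ-injective (x ∷ γ) (a ∷ e ∷ m) eq
  ... | refl | refl , refl = embed-F {C = C} {C′} (twoPairs
      (subst (λ s → IsC (y ∷ s)) (trans (cong (_++ x ∷ reverse κ) (unfold-reverse e m)) (++-assoc (reverse m) (e ∷ []) (x ∷ reverse κ)))
        (flip (e ∷ m) κ isc)) y∈ x∈ f∈ e∈
      (subst (_≤ k ∸ 1) (sym (length-reverse κ)) |κ|≤) (subst (_≤ k ∸ 1) (sym (length-reverse m)) |m|≤))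
  attach C C′ γ κ isc x∈ y∈ [] m [] eq () _ e∈ f∈ |m|≤ |κ|≤
  attach C C′ γ κ isc x∈ y∈ [] m (_ ∷ _ ∷ _) eq _ (s≤s ()) e∈ f∈ |m|≤ |κ|≤
  attach C C′ γ κ isc x∈ y∈ (_ ∷ []) m (_ ∷ _) eq _ (s≤s ()) e∈ f∈ |m|≤ |κ|≤
  attach C C′ γ κ isc x∈ y∈ (_ ∷ _ ∷ _) m r eq _ (s≤s ()) e∈ f∈ |m|≤ |κ|≤

  module _ {v₀} (C₀ : Comp v₀) {x y} (α β : List (Fin n)) (isc : IsC (x ∷ α ++ y ∷ β)) (x∈ : x ∈ Comp.X C₀) (y∈ : y ∈ Comp.X C₀)
    (w∉α : w ∉ α) where

    private
      d = length (Comp.D C₀)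
      k≡ : suc d ≡ k
      k≡ = |D| C₀
      d≡ : d ≡ k ∸ 1
      d≡ = cong (_∸ 1) k≡
      |D′| : ∀ {v} (C : Comp v) → length (Comp.D C) ≡ d
      |D′| C = suc-injective (trans (|D| C) (sym k≡))
      d≤α : d ≤ length α
      d≤α = detour₂ α β (Comp.D C₀) isc (comp-out C₀ x∈ y∈) w∉α
      |α|≤k : length α ≤ suc d
      |α|≤k = arith (length α) d (subst (λ K → 2 + (d + length α) ≤ 2 * K + 1) (sym k≡) (detour₁ β α (Comp.D C₀) (swap α β isc) (comp-out C₀ y∈ x∈)))
        where
        arith : ∀ a d → 2 + (d + a) ≤ 2 * suc d + 1 → a ≤ suc d
        arith a d h = lin _ _ 0 h (eq a d)
          where
          eq : ∀ a d → 2 * suc d + 1 + a + 0 ≡ 2 + (d + a) + suc d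
          eq a d = solve (a ∷ d ∷ [])
      |αβ| : 2 + (length α + length β) ≤ 2 * suc d + 1
      |αβ| = subst (λ K → 2 + (length α + length β) ≤ 2 * K + 1) (sym k≡) (|cycle| α β isc)

    -- At least `d` vertices lie between the two neighbours of the component, while `α` has at most
    -- `suc d`; so at most one vertex of the closed arc is left over.
    pair-in-α : ∀ {v} (C : Comp v) {e f} l m r → x ∷ α ++ y ∷ [] ≡ l ++ e ∷ m ++ f ∷ r → 1 ≤ length l + length r →
      e ∈ Comp.X C → f ∈ Comp.X C → G ⊆ Fgraph n n k
    pair-in-α C l m r eq 1≤ e∈ f∈ = let (h₁ , h₂ , h₃) = arith (length l) (length m) (length r) (length α) (length β) d (pair-length l m r eq) 1≤ d≤m |α|≤k |αβ| in
      attach C₀ C α β isc x∈ y∈ l m r eq 1≤ h₁ e∈ f∈ (subst (length m ≤_) d≡ h₂) (subst (length β ≤_) d≡ h₃)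
      where
      d≤m : d ≤ length m
      d≤m = subst (_≤ length m) (|D′| C) (detour₂ m _ (Comp.D C) (rotate-pair α β isc l m r eq) (comp-out C e∈ f∈)
        (λ w∈m → w∉α (mid-∈ l m eq (nd-arc α β isc) w∈m)))
      arith : ∀ l m r a b d → a + 2 ≡ l + (1 + (m + (1 + r))) → 1 ≤ l + r → d ≤ m → a ≤ suc d → 2 + (a + b) ≤ 2 * suc d + 1 →
        l + r ≤ 1 × m ≤ d × b ≤ d
      arith l m r a b d e 1≤ d≤ a≤ ab = lin _ _ 0 (+-mono-≤ (+-mono-≤ d≤ a≤) (≤-reflexive (sym e))) (eq₁ l m r a d) ,
        lin _ _ 0 (+-mono-≤ (+-mono-≤ 1≤ a≤) (≤-reflexive (sym e))) (eq₂ l m r a d) ,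
        lin _ _ 0 (+-mono-≤ (+-mono-≤ (+-mono-≤ 1≤ d≤) (≤-reflexive (sym e))) ab) (eq₃ l m r a b d)
        where
        eq₁ : ∀ l m r a d → m + suc d + (a + 2) + (l + r) + 0 ≡ d + a + (l + (1 + (m + (1 + r)))) + 1
        eq₁ l m r a d = solve (l ∷ m ∷ r ∷ a ∷ d ∷ [])
        eq₂ : ∀ l m r a d → l + r + suc d + (a + 2) + m + 0 ≡ 1 + a + (l + (1 + (m + (1 + r)))) + d
        eq₂ l m r a d = solve (l ∷ m ∷ r ∷ a ∷ d ∷ [])
        eq₃ : ∀ l m r a b d → l + r + m + (a + 2) + (2 * suc d + 1) + b + 0 ≡ 1 + d + (l + (1 + (m + (1 + r)))) + (2 + (a + b)) + d
        eq₃ l m r a b d = solve (l ∷ m ∷ r ∷ a ∷ b ∷ d ∷ [])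

    -- Here `m` may contain `w`, so the component need not fit into it. Instead the cycle through
    -- the component and the outer side, which includes `α` with at least `d` vertices, is bounded
    -- by `2 * k + 1`.
    pair-in-β : ∀ {v} (C : Comp v) {e f} l m r → y ∷ β ++ x ∷ [] ≡ l ++ e ∷ m ++ f ∷ r → 1 ≤ length l + length r →
      e ∈ Comp.X C → f ∈ Comp.X C → G ⊆ Fgraph n n k
    pair-in-β C l m r eq 1≤ e∈ f∈ = let (h₁ , h₂ , h₃) = arith (length l) (length m) (length r) (length α) (length β) d (pair-length l m r eq) 1≤ around d≤α |αβ| in
      attach C₀ C β α (swap α β isc) y∈ x∈ l m r eq 1≤ h₁ e∈ f∈ (subst (length m ≤_) d≡ h₂) (subst (length α ≤_) d≡ h₃)
      where
      around : 2 + (d + (length r + (length α + length l))) ≤ 2 * suc d + 1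
      around = subst (λ K → 2 + (d + (length r + (length α + length l))) ≤ 2 * K + 1) (sym k≡)
        (subst (λ D → 2 + (D + (length r + (length α + length l))) ≤ 2 * k + 1) (|D′| C)
          (subst (λ s → 2 + (length (Comp.D C) + s) ≤ 2 * k + 1) (length-⟦⟧ (r ∷ α ∷ l ∷ []) (` 0 ⊕ ` 1 ⊕ ` 2))
            (detour₁ m (r ++ α ++ l) (Comp.D C) (rotate-pair β α (swap α β isc) l m r eq) (comp-out C e∈ f∈))))
      arith : ∀ l m r a b d → b + 2 ≡ l + (1 + (m + (1 + r))) → 1 ≤ l + r → 2 + (d + (r + (a + l))) ≤ 2 * suc d + 1 → d ≤ a →
        2 + (a + b) ≤ 2 * suc d + 1 → l + r ≤ 1 × m ≤ d × a ≤ d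
      arith l m r a b d e 1≤ ar d≤ ab = lin _ _ 0 (+-mono-≤ ar d≤) (eq₁ l r a d) ,
        lin _ _ 0 (+-mono-≤ (+-mono-≤ (+-mono-≤ 1≤ d≤) ab) (≤-reflexive (sym e))) (eq₂ l m r a b d) ,
        lin _ _ 0 (+-mono-≤ 1≤ ar) (eq₃ l r a d)
        where
        eq₁ : ∀ l r a d → 2 * suc d + 1 + a + (l + r) + 0 ≡ 2 + (d + (r + (a + l))) + d + 1
        eq₁ l r a d = solve (l ∷ r ∷ a ∷ d ∷ [])
        eq₂ : ∀ l m r a b d → l + r + a + (2 * suc d + 1) + (b + 2) + m + 0 ≡ 1 + d + (2 + (a + b)) + (l + (1 + (m + (1 + r)))) + d
        eq₂ l m r a b d = solve (l ∷ m ∷ r ∷ a ∷ b ∷ d ∷ [])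
        eq₃ : ∀ l r a d → l + r + (2 * suc d + 1) + a + 0 ≡ 1 + (2 + (d + (r + (a + l)))) + d
        eq₃ l r a d = solve (l ∷ r ∷ a ∷ d ∷ [])

    extra : ∀ {u e} → u ∉ L → e ∈ L → e ∉ x ∷ y ∷ [] → Adj G u e → G ⊆ Fgraph n n k
    extra {u} {e} u∉ e∈L e∉ a with other-∈ {e = e} (Comp.X (comp u u∉)) (Comp.ndX (comp u u∉)) (Comp.2≤X (comp u u∉))
    ... | f , f∈ , f≢e = by-arc (on-cycle isc e∈L) (on-cycle isc (Comp.X⊆L C f∈))
      where
      C = comp u u∉
      e∈ : e ∈ Comp.X C
      e∈ = [ (λ e∈D → contradiction e∈L (Comp.D∥L C e∈D)) , id ]′ (Comp.nbr C (Comp.v∈D C) a)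
      e∉′ : e ∉ y ∷ x ∷ []
      e∉′ (here p) = e∉ (there (here p))
      e∉′ (there (here p)) = e∉ (here p)
      via-∉ : ∀ {t} → t ∈ u ∷ [] → t ∉ Comp.D C₀
      via-∉ = link-∉ C C₀ e∈ (e∉ ∘ pair-only C₀ α β isc x∈ y∈)
      in-α : e ∈ α → f ∈ x ∷ α ++ y ∷ [] → G ⊆ Fgraph n n k
      in-α e∈α f∈′ with ordered-pair (there (∈-++⁺ˡ e∈α)) f∈′ (f≢e ∘ sym)
      ... | inj₁ (l , m , r , eq) = pair-in-α C l m r eq (ends-strict l r eq (inj₁ e∉)) e∈ f∈
      ... | inj₂ (l , m , r , eq) = pair-in-α C l m r eq (ends-strict l r eq (inj₂ e∉)) f∈ e∈
      in-β : e ∈ β → f ∈ y ∷ β ++ x ∷ [] → G ⊆ Fgraph n n k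
      in-β e∈β f∈′ with ordered-pair (there (∈-++⁺ˡ e∈β)) f∈′ (f≢e ∘ sym)
      ... | inj₁ (l , m , r , eq) = pair-in-β C l m r eq (ends-strict l r eq (inj₁ e∉′)) e∈ f∈
      ... | inj₂ (l , m , r , eq) = pair-in-β C l m r eq (ends-strict l r eq (inj₂ e∉′)) f∈ e∈
      by-arc : e ∈ x ∷ y ∷ [] ⊎ e ∈ α ⊎ e ∈ β → f ∈ x ∷ y ∷ [] ⊎ f ∈ α ⊎ f ∈ β → G ⊆ Fgraph n n k
      by-arc (inj₁ p) _ = contradiction p e∉
      by-arc (inj₂ (inj₁ p)) (inj₁ (here refl)) = in-α p (here refl)
      by-arc (inj₂ (inj₁ p)) (inj₁ (there (here refl))) = in-α p (∈-++⁺ʳ (x ∷ α) (here refl))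
      by-arc (inj₂ (inj₁ p)) (inj₂ (inj₁ q)) = in-α p (there (∈-++⁺ˡ q))
      by-arc (inj₂ (inj₁ p)) (inj₂ (inj₂ q)) = ⊥-elim (separated C₀ α β isc x∈ y∈ (u ∷ []) p q (link C e∈ f∈) via-∉)
      by-arc (inj₂ (inj₂ p)) (inj₁ (here refl)) = in-β p (∈-++⁺ʳ (y ∷ β) (here refl))
      by-arc (inj₂ (inj₂ p)) (inj₁ (there (here refl))) = in-β p (here refl)
      by-arc (inj₂ (inj₂ p)) (inj₂ (inj₁ q)) = ⊥-elim (separated C₀ α β isc x∈ y∈ (u ∷ []) q p (link C f∈ e∈) via-∉)
      by-arc (inj₂ (inj₂ p)) (inj₂ (inj₂ q)) = in-β p (there (∈-++⁺ˡ q))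

    oriented : G ⊆ Fgraph n n k ⊎ G ⊆ F₁ n k
    oriented with any? (λ u → any? (λ e → ¬? (u ∈? L) ×-dec ((e ∈? L) ×-dec (¬? (e ∈? (x ∷ y ∷ [])) ×-dec Adj? u e))))
    ... | yes (u , e , u∉ , e∈ , e∉ , a) = inj₁ (extra u∉ e∈ e∉ a)
    ... | no ¬p = inj₂ (by-size (length α ≤? d))
      where
      no-extra : ∀ {u e} → u ∉ L → e ∈ L → e ∉ x ∷ y ∷ [] → ¬ Adj G u e
      no-extra u∉ e∈ e∉ a = ¬p (_ , _ , u∉ , e∈ , e∉ , a)
      -- The two arcs have at most `2 * k ∸ 1` vertices together, so one of them fits into
      -- `K (k ∸ 1)`; the other takes `K k`.
      by-size : Dec (length α ≤ d) → G ⊆ F₁ n k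
      by-size (yes α≤d) = embed-F₁ C₀ β α (swap α β isc) y∈ x∈
        (λ u∉ e∈ e∉ → no-extra u∉ e∈ (λ { (here p) → e∉ (there (here p)) ; (there (here p)) → e∉ (here p) }))
        (subst (length β ≤_) k≡ (arith (length α) (length β) d d≤α |αβ|)) (subst (length α ≤_) d≡ α≤d)
        where
        arith : ∀ a b d → d ≤ a → 2 + (a + b) ≤ 2 * suc d + 1 → b ≤ suc d
        arith a b d d≤ h = lin _ _ 0 (+-mono-≤ d≤ h) (eq a b d)
          where
          eq : ∀ a b d → a + (2 * suc d + 1) + b + 0 ≡ d + (2 + (a + b)) + suc d
          eq a b d = solve (a ∷ b ∷ d ∷ [])
      by-size (no α≰d) = embed-F₁ C₀ α β isc x∈ y∈ no-extra (subst (length α ≤_) k≡ |α|≤k)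
        (subst (length β ≤_) d≡ (arith (length α) (length β) d (≰⇒> α≰d) |αβ|))
        where
        arith : ∀ a b d → suc d ≤ a → 2 + (a + b) ≤ 2 * suc d + 1 → b ≤ d
        arith a b d d< h = lin _ _ 0 (+-mono-≤ d< h) (eq a b d)
          where
          eq : ∀ a b d → a + (2 * suc d + 1) + b + 0 ≡ suc d + (2 + (a + b)) + d
          eq a b d = solve (a ∷ b ∷ d ∷ [])

  caseII : ∀ {v} → Comp v → G ⊆ Fgraph n n k ⊎ G ⊆ F₁ n k
  caseII C = from (Comp.X C) (Comp.ndX C) (|X|≡2 C) id
    where
    from : ∀ xs → NoDup xs → length xs ≡ 2 → (∀ {y} → y ∈ xs → y ∈ Comp.X C) → G ⊆ Fgraph n n k ⊎ G ⊆ F₁ n k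
    from (x ∷ y ∷ []) nd′ refl s with locate₂ (Comp.X⊆L C (s (here refl))) (Comp.X⊆L C (s (there (here refl)))) (λ { refl → NoDup-head nd′ (here refl) })
    ... | α , β , isc with w ∈? α
    ...   | no w∉α  = oriented C α β isc (s (here refl)) (s (there (here refl))) w∉α
    ...   | yes w∈α = oriented C β α (swap α β isc) (s (there (here refl))) (s (here refl))
              (λ w∈β → NoDup-disjoint {xs = x ∷ α} (IsC-nd isc) (there w∈α) (there w∈β))

-- Alternating cycles

module _ {n : ℕ} where

  zig : List (Fin n × Fin n) → List (Fin n)
  zig []             = []
  zig ((a , b) ∷ qs) = a ∷ b ∷ zig qs

  zig-++ : ∀ ps qs → zig (ps ++ qs) ≡ zig ps ++ zig qs
  zig-++ []             qs = refl
  zig-++ ((a , b) ∷ ps) qs = cong (λ z → a ∷ b ∷ z) (zig-++ ps qs)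

  length-zig : ∀ qs → length (zig qs) ≡ 2 * length qs
  length-zig []       = refl
  length-zig (_ ∷ qs) = trans (cong (2 +_) (length-zig qs)) (eq (length qs))
    where
    eq : ∀ m → 2 + 2 * m ≡ 2 * suc m
    eq m = solve (m ∷ [])

  -- A cyclic sequence of marks and single gaps, except that one gap may have two vertices.
  data Tail : List (Fin n) → Set where
    none   : Tail []
    double : ∀ a c₁ c₂ → Tail (a ∷ c₁ ∷ c₂ ∷ [])

  tail-marks : ∀ {tl} → Tail tl → List (Fin n)
  tail-marks none           = []
  tail-marks (double a _ _) = a ∷ []

  tail-gap : ∀ {tl} → Tail tl → List (Fin n)
  tail-gap none             = []
  tail-gap (double _ c₁ c₂) = c₁ ∷ c₂ ∷ []

  tail-excess : ∀ {tl} → Tail tl → ℕ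
  tail-excess none           = 0
  tail-excess (double _ _ _) = 1

  tail-∈ : ∀ {tl t} (τ : Tail tl) → t ∈ tl → t ∈ tail-marks τ ⊎ t ∈ tail-gap τ
  tail-∈ (double a c₁ c₂) (here refl) = inj₁ (here refl)
  tail-∈ (double a c₁ c₂) (there p)   = inj₂ p

  tail-gap-∈ : ∀ {tl t} (τ : Tail tl) → t ∈ tail-gap τ → t ∈ tl
  tail-gap-∈ (double _ _ _) p = there p

  tail-marks-⊑ : ∀ {tl} (τ : Tail tl) → tail-marks τ ⊑ tl
  tail-marks-⊑ none           = sub λ u → z≤n
  tail-marks-⊑ (double a _ _) = sub λ u → +-monoʳ-≤ (δ u a) z≤n

  |tail-marks|≤1 : ∀ {tl} (τ : Tail tl) → length (tail-marks τ) ≤ 1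
  |tail-marks|≤1 none           = z≤n
  |tail-marks|≤1 (double _ _ _) = ≤-refl

  |tail-gap|≤2 : ∀ {tl} (τ : Tail tl) → length (tail-gap τ) ≤ 2
  |tail-gap|≤2 none           = z≤n
  |tail-gap|≤2 (double _ _ _) = ≤-refl

  tail-gap-other : ∀ {tl x c c°} (τ : Tail tl) → x ≢ c → c ≢ c° → x ∈ tail-gap τ → c ∈ tail-gap τ → c° ∈ tail-gap τ → x ≡ c°
  tail-gap-other (double _ _ _) x≢c c≢c° (here refl)         (here refl)         _                   = contradiction refl x≢c
  tail-gap-other (double _ _ _) x≢c c≢c° (here refl)         (there _)           (here refl)         = refl
  tail-gap-other (double _ _ _) x≢c c≢c° (here refl)         (there (here refl)) (there (here refl)) = contradiction refl c≢c°
  tail-gap-other (double _ _ _) x≢c c≢c° (there (here refl)) (here refl)         (here refl)         = contradiction refl c≢c°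
  tail-gap-other (double _ _ _) x≢c c≢c° (there (here refl)) (here refl)         (there (here refl)) = refl
  tail-gap-other (double _ _ _) x≢c c≢c° (there (here refl)) (there (here refl)) _                   = contradiction refl x≢c

  zig-firsts-⊑ : ∀ (qs : List (Fin n × Fin n)) → map proj₁ qs ⊑ zig qs
  zig-firsts-⊑ qs = sub (bound qs)
    where
    bound : ∀ (qs : List (Fin n × Fin n)) u → occ u (map proj₁ qs) ≤ occ u (zig qs)
    bound []             u = z≤n
    bound ((a , b) ∷ qs) u = +-monoʳ-≤ (δ u a) (≤-trans (bound qs u) (m≤n+m _ (δ u b)))

  zig-seconds-⊑ : ∀ (qs : List (Fin n × Fin n)) → map proj₂ qs ⊑ zig qs
  zig-seconds-⊑ qs = sub (bound qs)
    where
    bound : ∀ qs u → occ u (map proj₂ qs) ≤ occ u (zig qs)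
    bound []             u = z≤n
    bound ((a , b) ∷ qs) u = ≤-trans (+-monoʳ-≤ (δ u b) (bound qs u)) (m≤n+m _ (δ u a))

  ++-⊑ : ∀ (xs xs′ ys ys′ : List (Fin n)) → xs ⊑ xs′ → ys ⊑ ys′ → xs ++ ys ⊑ xs′ ++ ys′
  ++-⊑ xs xs′ ys ys′ p q = sub λ u → subst₂ _≤_ (sym (occ-++ u xs ys)) (sym (occ-++ u xs′ ys′)) (+-mono-≤ (occ-≤ p u) (occ-≤ q u))

  filter-⊑ : ∀ {P : Fin n → Set} (P? : ∀ u → Dec (P u)) xs → filter P? xs ⊑ xs
  filter-⊑ P? xs = sub (bound xs)
    where
    bound : ∀ xs u → occ u (filter P? xs) ≤ occ u xs
    bound []       u = z≤n
    bound (x ∷ xs) u with P? x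
    ... | yes _ = +-monoʳ-≤ (δ u x) (bound xs u)
    ... | no _  = ≤-trans (bound xs u) (m≤n+m _ (δ u x))

  flat-++ : ∀ (as bs : Blocks {n}) → flat (as ++ bs) ≡ flat as ++ flat bs
  flat-++ []             bs = refl
  flat-++ ((m , g) ∷ as) bs = cong (m ∷_) (trans (cong (g ++_) (flat-++ as bs)) (sym (++-assoc g (flat as) (flat bs))))

  length-flat-≥ : ∀ (bs : Blocks {n}) → (∀ {m g} → (m , g) ∈ bs → 1 ≤ length g) → 2 * length bs ≤ length (flat bs)
  length-flat-≥ []             o = z≤n
  length-flat-≥ ((m , g) ∷ bs) o = subst (λ l → 2 * suc (length bs) ≤ suc l) (sym (length-++ g))
    (lin _ _ 0 (+-mono-≤ (o (here refl)) (length-flat-≥ bs (o ∘ there))) (eq (length g) (length (flat bs)) (length bs)))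
    where
    eq : ∀ g f b → g + f + 2 * suc b + 0 ≡ 1 + 2 * b + suc (g + f)
    eq g f b = solve (g ∷ f ∷ b ∷ [])

  singles : ∀ (bs : Blocks {n}) → (∀ {m g} → (m , g) ∈ bs → 1 ≤ length g) → length (flat bs) ≤ 2 * length bs →
    ∃ λ qs → flat bs ≡ zig qs × marks bs ≡ map proj₁ qs
  singles [] o l = [] , refl , refl
  singles ((m , []) ∷ bs) o l = contradiction (o (here refl)) λ ()
  singles ((m , b ∷ []) ∷ bs) o l with singles bs (o ∘ there) (lin _ _ 0 l (eq (length (flat bs)) (length bs)))
    where
    eq : ∀ f b → 2 * suc b + f + 0 ≡ 2 + f + 2 * b
    eq f b = solve (f ∷ b ∷ [])
  ... | qs , e , f = (m , b) ∷ qs , cong (λ z → m ∷ b ∷ z) e , cong (m ∷_) f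
  singles ((m , b ∷ b′ ∷ g) ∷ bs) o l = contradiction
    (lin 1 0 (length g) (+-mono-≤ l (length-flat-≥ bs (o ∘ there)))
      (trans (eq (length g) (length (flat bs)) (length bs)) (cong (λ z → suc (suc (suc z)) + 2 * length bs + 0) (sym (length-++ g))))) λ ()
    where
    eq : ∀ g f b → 2 * suc b + f + 1 + g ≡ suc (suc (suc (g + f))) + 2 * b + 0
    eq g f b = solve (g ∷ f ∷ b ∷ [])

  -- Every block needs two vertices, and the single spare one pays for a second vertex in just one
  -- gap.
  alternating : ∀ (bs : Blocks {n}) → (∀ {m g} → (m , g) ∈ bs → 1 ≤ length g) → length (flat bs) ≤ 2 * length bs + 1 →
    ∃₂ λ ps qs → ∃ λ tl → Σ (Tail tl) λ τ → flat bs ≡ zig ps ++ tl ++ zig qs × marks bs ≡ map proj₁ ps ++ tail-marks τ ++ map proj₁ qs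
  alternating [] o l = [] , [] , [] , none , refl , refl
  alternating ((m , []) ∷ bs) o l = contradiction (o (here refl)) λ ()
  alternating ((m , b ∷ []) ∷ bs) o l with alternating bs (o ∘ there) (lin _ _ 0 l (eq (length (flat bs)) (length bs)))
    where
    eq : ∀ f b → 2 * suc b + 1 + f + 0 ≡ 2 + f + (2 * b + 1)
    eq f b = solve (f ∷ b ∷ [])
  ... | ps , qs , tl , τ , e , f = (m , b) ∷ ps , qs , tl , τ , cong (λ z → m ∷ b ∷ z) e , cong (m ∷_) f
  alternating ((m , c₁ ∷ c₂ ∷ []) ∷ bs) o l with singles bs (o ∘ there) (lin _ _ 0 l (eq (length (flat bs)) (length bs)))
    where
    eq : ∀ f b → 2 * suc b + 1 + f + 0 ≡ 3 + f + 2 * b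
    eq f b = solve (f ∷ b ∷ [])
  ... | qs , e , f = [] , qs , m ∷ c₁ ∷ c₂ ∷ [] , double m c₁ c₂ , cong (λ z → m ∷ c₁ ∷ c₂ ∷ z) e , cong (m ∷_) f
  alternating ((m , b ∷ b′ ∷ b″ ∷ g) ∷ bs) o l = contradiction
    (lin 1 0 (length g) (+-mono-≤ l (length-flat-≥ bs (o ∘ there)))
      (trans (eq (length g) (length (flat bs)) (length bs)) (cong (λ z → suc (suc (suc (suc z))) + 2 * length bs + 0) (sym (length-++ g))))) λ ()
    where
    eq : ∀ g f b → 2 * suc b + 1 + f + 1 + g ≡ suc (suc (suc (suc (g + f)))) + 2 * b + 0
    eq g f b = solve (g ∷ f ∷ b ∷ [])

  zig-∈ : ∀ {qs : List (Fin n × Fin n)} {t} → t ∈ zig qs → t ∈ map proj₁ qs ⊎ ∃ λ a → (a , t) ∈ qs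
  zig-∈ {(a , b) ∷ qs} (here refl)         = inj₁ (here refl)
  zig-∈ {(a , b) ∷ qs} (there (here refl)) = inj₂ (a , here refl)
  zig-∈ {(a , b) ∷ qs} (there (there p))   = Data.Sum.map there (λ (a′ , q) → a′ , there q) (zig-∈ {qs} p)

  zig-pair : ∀ {qs : List (Fin n × Fin n)} {a b} → (a , b) ∈ qs → ∃₂ λ ps rs → zig qs ≡ zig ps ++ a ∷ b ∷ zig rs × qs ≡ ps ++ (a , b) ∷ rs
  zig-pair {qs} p with ∈-∃++ p
  ... | ps , rs , refl = ps , rs , zig-++ ps _ , refl

  -- Used with `bs` longer than `as`, so that it starts and ends in `bs`.
  weave : List (Fin n) → List (Fin n) → List (Fin n)
  weave []       as       = []
  weave (b ∷ bs) []       = b ∷ []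
  weave (b ∷ bs) (a ∷ as) = b ∷ a ∷ weave bs as

  weave-⊑ : ∀ bs as → weave bs as ⊑ bs ++ as
  weave-⊑ bs as = sub (bound bs as)
    where
    open ≤-Reasoning
    eq : ∀ x y z t → x + (y + (z + t)) ≡ x + z + (y + t)
    eq x y z t = solve (x ∷ y ∷ z ∷ t ∷ [])
    bound : ∀ bs as u → occ u (weave bs as) ≤ occ u (bs ++ as)
    bound []       as       u = z≤n
    bound (b ∷ bs) []       u = +-monoʳ-≤ (δ u b) z≤n
    bound (b ∷ bs) (a ∷ as) u = begin
      δ u b + (δ u a + occ u (weave bs as))   ≤⟨ +-monoʳ-≤ (δ u b) (+-monoʳ-≤ (δ u a) (bound bs as u)) ⟩
      δ u b + (δ u a + occ u (bs ++ as))      ≡⟨ cong (λ z → δ u b + (δ u a + z)) (occ-++ u bs as) ⟩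
      δ u b + (δ u a + (occ u bs + occ u as)) ≡⟨ eq (δ u b) (δ u a) (occ u bs) (occ u as) ⟩
      δ u b + occ u bs + (δ u a + occ u as)   ≡⟨ sym (occ-++ u (b ∷ bs) (a ∷ as)) ⟩
      occ u ((b ∷ bs) ++ a ∷ as)              ∎

  length-weave : ∀ bs as → length as < length bs → length (weave bs as) ≡ suc (2 * length as)
  length-weave (b ∷ bs) []       _       = refl
  length-weave (b ∷ bs) (a ∷ as) (s≤s l) = trans (cong (2 +_) (length-weave bs as l)) (eq (length as))
    where
    eq : ∀ m → 2 + suc (2 * m) ≡ suc (2 * suc m)
    eq m = solve (m ∷ [])

-- A component with a single vertex

IntoH : ∀ {n} → Graph n → ℕ → Set
IntoH {n} G k = (n ≡ 2 * k + 1 × G ⊆ Hgraph (2 * k + 1) (2 * k + 1) k) ⊎ (2 * k + 2 ≤ n × G ⊆ Hgraph n (2 * k + 2) k)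

IntoK₂+S∪M : ∀ {n} → Graph n → Set
IntoK₂+S∪M G = Σ ℕ λ s → Σ ℕ λ t → 1 ≤ s × 6 ≤ s + t × G ⊆ (K 2 ⊹ (S s ∪ M t))

module CaseI {n : ℕ} {G : Graph n} {k : ℕ} {w : Fin n} (setting : Setting G k w)
  {L : List (Fin n)} (longest-L : Longest G w L) (3≤k : 3 ≤ k)
  (shape : ∀ {v} (c : Outside.Comp setting longest-L v) → length (Outside.Comp.X c) ≡ 2 ⊎ length (Outside.Comp.D c) ≡ 1)
  {v : Fin n} (C₀ : Outside.Comp setting longest-L v) (|D₀| : length (Outside.Comp.D C₀) ≡ 1) where

  open Setting setting
  open Walks G
  open Around setting longest-L
  open Outside setting longest-L
  open Common setting longest-L

  A : List (Fin n)
  A = Comp.X C₀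

  |A| : length A ≡ k
  |A| = suc-injective (trans (+-comm 1 (length A)) (trans (cong (length A +_) (sym |D₀|)) (Comp.size C₀)))

  ndA : NoDup A
  ndA = Comp.ndX C₀

  v∉L : v ∉ L
  v∉L = Comp.D∥L C₀ (Comp.v∈D C₀)

  A⊆L : ∀ {a} → a ∈ A → a ∈ L
  A⊆L = Comp.X⊆L C₀

  v~A : ∀ {a} → a ∈ A → Adj G v a
  v~A = Comp.joined C₀ (Comp.v∈D C₀)

  D₀-only : ∀ {y} → y ∈ Comp.D C₀ → y ≡ v
  D₀-only y∈ = singleton-≡ (Comp.D C₀) |D₀| (Comp.v∈D C₀) y∈

  v-nbr : ∀ {y} → Adj G v y → y ∈ A
  v-nbr a = [ (λ y∈ → contradiction (sym (D₀-only y∈)) (adj⇒≢ a)) , id ]′ (Comp.nbr C₀ (Comp.v∈D C₀) a)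

  record Alternating (qs : List (Fin n × Fin n)) {tl : List (Fin n)} (τ : Tail tl) : Set where
    constructor alt
    field
      isc     : IsC (zig qs ++ tl)
      marks-A : ∀ {a} → a ∈ map proj₁ qs ++ tail-marks τ → a ∈ A
      A-marks : ∀ {a} → a ∈ A → a ∈ map proj₁ qs ++ tail-marks τ

  -- `v` could be inserted between two consecutive vertices of `A`, so the `k` gaps are not empty,
  -- and `L` has at most one vertex more than this requires.
  some-alternating : ∃₂ λ qs tl → Σ (Tail tl) (Alternating qs)
  some-alternating with some-∈ A (subst (1 ≤_) (sym |A|) (≤-trans (s≤s z≤n) 3≤k))
  ... | a , a∈ with locate (A⊆L a∈)
  ... | r , c with parse (_∈? A) (a ∷ r) | parse-marks (parse (_∈? A) (a ∷ r))
  ... | parsed (_ ∷ _) bs refl po bl | _ = contradiction a∈ (po (here refl))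
  ... | parsed [] bs split po bl | pm = finish (alternating bs gaps short)
    where
    c′ : IsC (flat bs)
    c′ = subst IsC split c
    mark-A : ∀ {m} → m ∈ marks bs → m ∈ A
    mark-A m∈ with ∈-map⁻ proj₁ m∈
    ... | (m , g) , mg∈ , refl = proj₁ (bl mg∈)
    A-mark : ∀ {m} → m ∈ A → m ∈ marks bs
    A-mark m∈ = pm (∈-IsC c (A⊆L m∈)) m∈
    |bs| : length bs ≡ k
    |bs| = trans (sym (length-map proj₁ bs)) (trans (≤-antisym
      (length-⊆ (NoDup-⊑ (marks-⊑ bs) (IsC-nd c′)) mark-A) (length-⊆ ndA A-mark)) |A|)
    short : length (flat bs) ≤ 2 * length bs + 1
    short = subst₂ (λ x y → x ≤ 2 * y + 1) (sym (IsC-length c′)) (sym |bs|) |L|≤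
    gaps : ∀ {m g} → (m , g) ∈ bs → 1 ≤ length g
    gaps {m} {_ ∷ _} mg∈ = s≤s z≤n
    gaps {m} {[]} mg∈ with ∈-∃++ mg∈
    ... | bs₁ , bs₂ , refl = ⊥-elim (next (bs₂ ++ bs₁) refl)
      where
      rotated : IsC (m ∷ flat (bs₂ ++ bs₁))
      rotated = subst (λ z → IsC (m ∷ z)) (sym (flat-++ bs₂ bs₁)) (IsC-rotate (flat bs₁) (m ∷ flat bs₂) (subst IsC (flat-++ bs₁ ((m , []) ∷ bs₂)) c′))
      next : ∀ bs′ → bs₂ ++ bs₁ ≡ bs′ → ⊥
      -- If there were only one block, its empty gap would lead back to its own mark; `k` blocks
      -- with `3 ≤ k` exclude this.
      next [] e = <⇒≱ 3≤k (≤-trans (≤-reflexive (trans (sym |bs|) (trans (length-++ bs₁) (trans (+-suc (length bs₁) (length bs₂))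
        (cong suc (trans (+-comm (length bs₁) (length bs₂)) (trans (sym (length-++ bs₂)) (cong length e)))))))) (s≤s z≤n))
      next ((m′ , g′) ∷ bs′) e = not-consecutive C₀ (subst (λ z → IsC (m ∷ flat z)) e rotated) (proj₁ (bl mg∈))
        (mark-A (reorder (∈-map⁺ proj₁ (subst ((m′ , g′) ∈_) (sym e) (here refl)))))
        where
        reorder : m′ ∈ marks (bs₂ ++ bs₁) → m′ ∈ marks (bs₁ ++ (m , []) ∷ bs₂)
        reorder p with ∈-map⁻ proj₁ p
        ... | mg , q , refl = ∈-map⁺ proj₁ ([ (λ q₂ → ∈-++⁺ʳ bs₁ (there q₂)) , ∈-++⁺ˡ ]′ (∈-++⁻ bs₂ q))
    finish : (∃₂ λ ps qs → ∃ λ tl → Σ (Tail tl) λ τ → flat bs ≡ zig ps ++ tl ++ zig qs × marks bs ≡ map proj₁ ps ++ tail-marks τ ++ map proj₁ qs) →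
      ∃₂ λ qs tl → Σ (Tail tl) (Alternating qs)
    finish (ps , qs , tl , τ , e , f) = qs ++ ps , tl , τ , alt
      (subst IsC (trans (sym (++-assoc (zig qs) (zig ps) tl)) (cong (_++ tl) (sym (zig-++ qs ps))))
        (IsC-rotate (zig ps ++ tl) (zig qs) (subst IsC (trans e (sym (++-assoc (zig ps) tl (zig qs)))) c′)))
      (λ {a} p → mark-A (subst (a ∈_) (sym f) (⊑-∈ (⊑-by (map proj₁ ps ∷ tail-marks τ ∷ map proj₁ qs ∷ [])
        ((` 2 ⊕ ` 0) ⊕ ` 1) (` 0 ⊕ ` 1 ⊕ ` 2)) (subst (λ z → a ∈ z ++ tail-marks τ) (map-++ proj₁ qs ps) p))))
      (λ {a} p → subst (λ z → a ∈ z ++ tail-marks τ) (sym (map-++ proj₁ qs ps))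
        (⊑-∈ (⊑-by (map proj₁ ps ∷ tail-marks τ ∷ map proj₁ qs ∷ []) (` 0 ⊕ ` 1 ⊕ ` 2) ((` 2 ⊕ ` 0) ⊕ ` 1)) (subst (a ∈_) f (A-mark p))))

  private
    longer : ∀ {xs} zs → IsC xs → Closed zs → zs ≋ v ∷ xs → ⊥
    longer {xs} zs c cl e = <⇒≱ (s≤s (≤-reflexive (sym (IsC-length c))))
      (≤-trans (≤-reflexive (sym (≋-length nd-zs e))) (maximal cl nd-zs 3≤zs (⊑-∈ (≋⇒⊑ (≋-sym e)) (there (∈-IsC c w∈)))))
      where
      nd-zs : NoDup zs
      nd-zs = NoDup-⊑ (≋⇒⊑ e) (NoDup-∷ (λ p → v∉L (IsC-∈ c p)) (IsC-nd c))
      3≤zs : 3 ≤ length zs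
      3≤zs = ≤-trans 3≤ (≤-trans (≤-reflexive (sym (IsC-length c))) (≤-trans (n≤1+n _) (≤-reflexive (sym (≋-length nd-zs e)))))

    -- The classical exchange for successors `b`, `t` of two neighbours `a`, `a′` of `v`: the chord
    -- and the path through `v` give a cycle on all of `L` and `v`.
    crossing : ∀ {a b a′ t} r₁ r₂ → IsC (a ∷ b ∷ r₁ ++ a′ ∷ t ∷ r₂) → a ∈ A → a′ ∈ A → ¬ Adj G b t
    crossing {a} {b} {a′} {t} r₁ r₂ c a∈ a′∈ b~t = longer (v ∷ a′ ∷ reverse r₁ ++ b ∷ t ∷ r₂ ++ a ∷ []) c
      (v~A a′∈ , W-++ (reverse r₁) (W-reverse r₁ (proj₁ walks)) (b~t , W-++ r₂ (proj₂ (proj₂ walks)) (adj-sym (v~A a∈))))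
      (≋-by ((v ∷ []) ∷ (a ∷ []) ∷ (b ∷ []) ∷ r₁ ∷ (a′ ∷ []) ∷ (t ∷ []) ∷ r₂ ∷ [])
        (` 0 ⊕ ` 4 ⊕ rev (` 3) ⊕ ` 2 ⊕ ` 5 ⊕ ` 6 ⊕ ` 1) (` 0 ⊕ ` 1 ⊕ ` 2 ⊕ ` 3 ⊕ ` 4 ⊕ ` 5 ⊕ ` 6))
      where
      walks : W b r₁ a′ × Adj G a′ t × W t r₂ a
      walks = W-split r₁ (proj₂ (closed′ c))

    -- The same exchange for predecessors; it is needed for the second vertex of the double gap,
    -- whose own predecessor is not in `A`.
    crossing-back : ∀ {a b a⁺ s t} r₁ r₂ → IsC (a ∷ b ∷ a⁺ ∷ r₁ ++ t ∷ s ∷ r₂) → a⁺ ∈ A → s ∈ A → ¬ Adj G b t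
    crossing-back {a} {b} {a⁺} {s} {t} r₁ r₂ c a⁺∈ s∈ b~t = longer (v ∷ a⁺ ∷ r₁ ++ t ∷ b ∷ a ∷ reverse r₂ ++ s ∷ []) c
      (v~A a⁺∈ , W-++ r₁ (proj₁ walks) (adj-sym b~t , adj-sym (proj₁ (closed′ c)) ,
        W-++ (reverse r₂) (W-reverse r₂ (proj₂ (proj₂ walks))) (adj-sym (v~A s∈))))
      (≋-by ((v ∷ []) ∷ (a ∷ []) ∷ (b ∷ []) ∷ (a⁺ ∷ []) ∷ r₁ ∷ (t ∷ []) ∷ (s ∷ []) ∷ r₂ ∷ [])
        (` 0 ⊕ ` 3 ⊕ ` 4 ⊕ ` 5 ⊕ ` 2 ⊕ ` 1 ⊕ rev (` 7) ⊕ ` 6) (` 0 ⊕ ` 1 ⊕ ` 2 ⊕ ` 3 ⊕ ` 4 ⊕ ` 5 ⊕ ` 6 ⊕ ` 7))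
      where
      walks : W a⁺ r₁ t × Adj G t s × W s r₂ a
      walks = W-split r₁ (proj₂ (proj₂ (closed′ c)))

    -- The case of `crossing-back` in which the successor of `t` is `a` itself.
    crossing-last : ∀ {a b a⁺ t} r₁ → IsC (a ∷ b ∷ a⁺ ∷ r₁ ++ t ∷ []) → a ∈ A → a⁺ ∈ A → ¬ Adj G b t
    crossing-last {a} {b} {a⁺} {t} r₁ c a∈ a⁺∈ b~t = longer (v ∷ a⁺ ∷ r₁ ++ t ∷ b ∷ a ∷ []) c
      (v~A a⁺∈ , W-++ r₁ (proj₁ walks) (adj-sym b~t , adj-sym (proj₁ (closed′ c)) , adj-sym (v~A a∈)))
      (≋-by ((v ∷ []) ∷ (a ∷ []) ∷ (b ∷ []) ∷ (a⁺ ∷ []) ∷ r₁ ∷ (t ∷ []) ∷ [])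
        (` 0 ⊕ ` 3 ⊕ ` 4 ⊕ ` 5 ⊕ ` 2 ⊕ ` 1) (` 0 ⊕ ` 1 ⊕ ` 2 ⊕ ` 3 ⊕ ` 4 ⊕ ` 5))
      where
      walks : W a⁺ r₁ t × Adj G t a
      walks = W-split r₁ (proj₂ (proj₂ (closed′ c)))

    -- Exchanging the single gap b for v gives another longest cycle, off which b must be a one-vertex component.
    exchange : ∀ {a b a⁺ r} → IsC (a ∷ b ∷ a⁺ ∷ r) → a ∈ A → a⁺ ∈ A → b ≢ w → (∀ {t} → t ∈ r → t ∉ A → ¬ Adj G b t) →
      (∀ {t} → Adj G b t → t ∈ A) × (∀ {t} → t ∈ A → Adj G b t)
    exchange {a} {b} {a⁺} {r} c a∈ a⁺∈ b≢w no-cross = in-A , λ t∈ → Outside′.Comp.joined C′ b∈D (A⊆X t∈)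
      where
      L′ = a ∷ v ∷ a⁺ ∷ r
      nd-vL : NoDup (v ∷ a ∷ b ∷ a⁺ ∷ r)
      nd-vL = NoDup-∷ (λ p → v∉L (IsC-∈ c p)) (IsC-nd c)
      w∈L′ : w ∈ a ∷ b ∷ a⁺ ∷ r → w ∈ L′
      w∈L′ (here p) = here p
      w∈L′ (there (here refl)) = contradiction refl b≢w
      w∈L′ (there (there p)) = there (there p)
      longest-L′ : Longest G w L′
      longest-L′ = record
        { closed = adj-sym (v~A a∈) , v~A a⁺∈ , proj₂ (proj₂ (closed′ c))
        ; nd = NoDup-⊑ (⊑-by ((v ∷ []) ∷ (a ∷ []) ∷ (b ∷ []) ∷ (a⁺ ∷ r) ∷ []) (` 1 ⊕ ` 0 ⊕ ` 3) (` 0 ⊕ ` 1 ⊕ ` 2 ⊕ ` 3)) nd-vL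
        ; 3≤ = s≤s (s≤s (s≤s z≤n)) ; w∈ = w∈L′ (∈-IsC c w∈)
        ; maximal = λ x y z t → ≤-trans (maximal x y z t) (≤-reflexive (sym (IsC-length c))) }
      module Around′ = Around setting longest-L′
      module Outside′ = Outside setting longest-L′
      b∉L′ : b ∉ L′
      b∉L′ (here refl) = NoDup-head (IsC-nd c) (here refl)
      b∉L′ (there (here refl)) = v∉L (IsC-∈ c (there (here refl)))
      b∉L′ (there (there p)) = NoDup-head (NoDup-tail (IsC-nd c)) p
      C′ : Outside′.Comp b
      C′ = Outside′.comp b b∉L′
      open Outside′.Comp C′ using () renaming (D to D′; X to X′; v∈D to b∈D)
      to-X : ∀ {t} → t ∈ L′ → Adj G b t → t ∈ X′
      to-X t∈ e = [ (λ p → contradiction t∈ (Outside′.Comp.D∥L C′ p)) , id ]′ (Outside′.Comp.nbr C′ b∈D e)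
      |D′|≤1 : length D′ ≤ 1
      |D′|≤1 = Around′.detour₂ (v ∷ []) r D′ Around′.IsC-L (Common.comp-out setting longest-L′ C′
        (to-X (here refl) (adj-sym (proj₁ (closed′ c)))) (to-X (there (there (here refl))) (proj₁ (proj₂ (closed′ c)))))
        (λ { (here refl) → v∉L w∈ })
      in-A : ∀ {t} → Adj G b t → t ∈ A
      in-A {t} e with Outside′.Comp.nbr C′ b∈D e
      ... | inj₁ t∈D = contradiction (length-⊆ (NoDup-pair (adj⇒≢ e)) (both b∈D t∈D)) (<⇒≱ (s≤s |D′|≤1))
      ... | inj₂ t∈X with Outside′.Comp.X⊆L C′ t∈X
      ...   | here refl = a∈
      ...   | there (here refl) = contradiction (v-nbr (adj-sym e)) (not-consecutive C₀ c a∈)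
      ...   | there (there (here refl)) = a⁺∈
      ...   | there (there (there t∈r)) with t ∈? A
      ...     | yes t∈A = t∈A
      ...     | no t∉A  = contradiction e (no-cross t∈r t∉A)
      A⊆X : ∀ {t} → t ∈ A → t ∈ X′
      A⊆X {t} t∈ with t ∈? X′
      ... | yes p = p
      ... | no ¬p = ⊥-elim (<⇒≱ {k} {suc (length X′)} (arith (length X′) (length D′) k (Outside′.Comp.size C′) |D′|≤1) (subst (suc (length X′) ≤_) |A|
          (length-⊆ (NoDup-∷ ¬p (Outside′.Comp.ndX C′)) (cons t∈ (λ q → in-A (Outside′.Comp.joined C′ b∈D q))))))
        where
        arith : ∀ x d k → x + d ≡ suc k → d ≤ 1 → suc k ≤ suc x
        arith x d k e d≤ = ≤-trans (≤-reflexive (sym e)) (≤-trans (+-monoʳ-≤ x d≤) (≤-reflexive (+-comm x 1)))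

  -- c and c° are the two vertices of the double gap, with cycle neighbours p and s in A.
  record Double (gs : List (Fin n)) (c c° p s : Fin n) : Set where
    field
      c~c° : Adj G c c°
      c~p  : Adj G c p
      c°~s : Adj G c° s
      p∈   : p ∈ A
      s∈   : s ∈ A
      p≢s  : p ≢ s
      c∉   : c ∉ A
      c°∉  : c° ∉ A
      c∈L  : c ∈ L
      c°∈L : c° ∈ L
      c∈g  : c ∈ gs
      c°∈g : c° ∈ gs
      not-both : ∀ {u} (C : Comp u) → c ∈ Comp.X C → c° ∉ Comp.X C

  Double-sym : ∀ {gs c c° p s} → Double gs c c° p s → Double gs c° c s p
  Double-sym d = record
    { c~c° = adj-sym c~c° ; c~p = c°~s ; c°~s = c~p ; p∈ = s∈ ; s∈ = p∈ ; p≢s = p≢s ∘ sym ; c∉ = c°∉ ; c°∉ = c∉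
    ; c∈L = c°∈L ; c°∈L = c∈L ; c∈g = c°∈g ; c°∈g = c∈g ; not-both = λ C p q → not-both C q p }
    where open Double d

  double-gap : ∀ {qs tl} (τ : Tail tl) → Alternating qs τ → 1 ≤ length qs → ∀ {t} → t ∈ tail-gap τ →
    ∃ λ c° → ∃₂ λ p s → Double (tail-gap τ) t c° p s
  double-gap {(s , b) ∷ qs} (double a c₁ c₂) (alt isc ms _) _ t∈ = by-end t∈
    where
    c : IsC (a ∷ c₁ ∷ c₂ ∷ s ∷ b ∷ zig qs)
    c = IsC-rotate (zig ((s , b) ∷ qs)) (a ∷ c₁ ∷ c₂ ∷ []) isc
    a∈ : a ∈ A
    a∈ = ms (∈-++⁺ʳ (s ∷ map proj₁ qs) (here refl))
    s∈ : s ∈ A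
    s∈ = ms (here refl)
    d : Double (c₁ ∷ c₂ ∷ []) c₁ c₂ a s
    d = record
      { c~c° = proj₁ (proj₂ (closed′ c)) ; c~p = adj-sym (proj₁ (closed′ c)) ; c°~s = proj₁ (proj₂ (proj₂ (closed′ c)))
      ; p∈ = a∈ ; s∈ = s∈ ; p≢s = λ { refl → NoDup-head (IsC-nd c) (there (there (here refl))) }
      ; c∉ = not-consecutive C₀ c a∈
      ; c°∉ = λ c₂∈ → not-consecutive C₀ (IsC-rotate (a ∷ c₁ ∷ []) (c₂ ∷ s ∷ b ∷ zig qs) c) c₂∈ s∈
      ; c∈L = IsC-∈ c (there (here refl)) ; c°∈L = IsC-∈ c (there (there (here refl)))
      ; c∈g = here refl ; c°∈g = there (here refl)
      ; not-both = λ C → not-consecutive C (IsC-rotate (a ∷ []) (c₁ ∷ c₂ ∷ s ∷ b ∷ zig qs) c) }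
    by-end : ∀ {t} → t ∈ c₁ ∷ c₂ ∷ [] → ∃ λ c° → ∃₂ λ p s → Double (c₁ ∷ c₂ ∷ []) t c° p s
    by-end (here refl)         = c₂ , a , s , d
    by-end (there (here refl)) = c₁ , s , a , Double-sym d

  module _ {qs : List (Fin n × Fin n)} {tl : List (Fin n)} (τ : Tail tl) (al : Alternating qs τ) where

    open Alternating al

    pair-A : ∀ {a b} → (a , b) ∈ qs → a ∈ A
    pair-A p = marks-A (∈-++⁺ˡ (∈-map⁺ proj₁ p))

    |qs| : k ≤ suc (length qs)
    |qs| = ≤-trans (≤-trans (≤-reflexive (sym |A|)) (length-⊆ ndA A-marks))
      (≤-trans (≤-reflexive (trans (length-++ (map proj₁ qs)) (cong (_+ length (tail-marks τ)) (length-map proj₁ qs))))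
        (≤-trans (+-monoʳ-≤ (length qs) (|tail-marks|≤1 τ)) (≤-reflexive (+-comm (length qs) 1))))

    record Single (a b : Fin n) : Set where
      constructor single
      field
        a⁺   : Fin n
        r    : List (Fin n)
        isc₁ : IsC (a ∷ b ∷ a⁺ ∷ r)
        a∈   : a ∈ A
        a⁺∈  : a⁺ ∈ A
        no-cross : ∀ {t} → t ∈ r → t ∉ A → ¬ Adj G b t

    single-of : ∀ {a b} → (a , b) ∈ qs → Single a b
    single-of {a} {b} ab∈ with zig-pair ab∈
    ... | ps , rs , e , e′ = from rs τ ps (pair-A ab∈) rotated marks′ |qs|′
      where
      rotated : IsC (a ∷ b ∷ zig rs ++ tl ++ zig ps)
      rotated = subst (λ z → IsC (a ∷ b ∷ z)) (++-assoc (zig rs) tl (zig ps)) (IsC-rotate (zig ps) (a ∷ b ∷ zig rs ++ tl)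
        (subst IsC (trans (cong (_++ tl) e) (++-assoc (zig ps) (a ∷ b ∷ zig rs) tl)) isc))
      marks′ : ∀ {x} → x ∈ map proj₁ rs ++ tail-marks τ ++ map proj₁ ps → x ∈ A
      marks′ {x} p = marks-A (subst (λ z → x ∈ z ++ tail-marks τ) (sym (trans (cong (map proj₁) e′) (map-++ proj₁ ps _)))
        (⊑-∈ (⊑-by (map proj₁ rs ∷ tail-marks τ ∷ map proj₁ ps ∷ (a ∷ []) ∷ []) (` 0 ⊕ ` 1 ⊕ ` 2) ((` 2 ⊕ ` 3 ⊕ ` 0) ⊕ ` 1)) p))
      |qs|′ : 3 ≤ suc (length (ps ++ (a , b) ∷ rs))
      |qs|′ = ≤-trans 3≤k (subst (λ z → k ≤ suc (length z)) e′ |qs|)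
      in-zig : ∀ {a b t} pre zs post → IsC (a ∷ b ∷ pre ++ zig zs ++ post) → a ∈ A → (∀ {x} → x ∈ map proj₁ zs → x ∈ A) → t ∈ zig zs → t ∉ A → ¬ Adj G b t
      in-zig {a} {b} {t} pre zs post c a∈ ms t∈ t∉ with zig-∈ {qs = zs} t∈
      ... | inj₁ p = contradiction (ms p) t∉
      ... | inj₂ (a′ , p) with zig-pair p
      ...   | zs₁ , zs₂ , f , _ = crossing (pre ++ zig zs₁) (zig zs₂ ++ post)
        (subst (λ z → IsC (a ∷ b ∷ z)) (trans (cong (λ z → pre ++ z ++ post) f)
          (trans (cong (pre ++_) (++-assoc (zig zs₁) (a′ ∷ t ∷ zig zs₂) post)) (sym (++-assoc pre (zig zs₁) _)))) c)
        a∈ (ms (∈-map⁺ proj₁ p))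
      -- The cases are what follows `b` around the cycle: another pair, the double gap, or, when
      -- neither is left, the front part of the list. Something does follow, because `k` is at least
      -- 3.
      from : ∀ rs′ {tl′} (τ′ : Tail tl′) ps′ → a ∈ A → IsC (a ∷ b ∷ zig rs′ ++ tl′ ++ zig ps′) →
        (∀ {x} → x ∈ map proj₁ rs′ ++ tail-marks τ′ ++ map proj₁ ps′ → x ∈ A) → 3 ≤ suc (length (ps′ ++ (a , b) ∷ rs′)) → Single a b
      from [] none [] a∈ c ms (s≤s (s≤s ()))
      from [] none ((s , t) ∷ ps′) a∈ c ms _ = single s (t ∷ zig ps′) c a∈ (ms (here refl))
        λ {x} x∈ x∉ → in-zig [] ((s , t) ∷ ps′) [] (subst (λ z → IsC (a ∷ b ∷ z)) (sym (++-identityʳ _)) c) a∈ ms (there x∈) x∉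
      from [] (double a′ c₁ c₂) ps′ a∈ c ms _ = single a′ (c₁ ∷ c₂ ∷ zig ps′) c a∈ (ms (here refl)) (no-cross ps′ c ms)
        where
        no-cross : ∀ ps′ → IsC (a ∷ b ∷ a′ ∷ c₁ ∷ c₂ ∷ zig ps′) → (∀ {x} → x ∈ a′ ∷ map proj₁ ps′ → x ∈ A) →
          ∀ {t} → t ∈ c₁ ∷ c₂ ∷ zig ps′ → t ∉ A → ¬ Adj G b t
        no-cross ps′ c ms (here refl) t∉ = crossing [] (c₂ ∷ zig ps′) c a∈ (ms (here refl))
        no-cross [] c ms (there (here refl)) t∉ = crossing-last (c₁ ∷ []) c a∈ (ms (here refl))
        no-cross ((s , t) ∷ ps′) c ms (there (here refl)) t∉ = crossing-back (c₁ ∷ []) (t ∷ zig ps′) c (ms (here refl)) (ms (there (here refl)))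
        no-cross ps′ c ms (there (there x∈)) t∉ = in-zig (a′ ∷ c₁ ∷ c₂ ∷ []) ps′ []
          (subst (λ z → IsC (a ∷ b ∷ a′ ∷ c₁ ∷ c₂ ∷ z)) (sym (++-identityʳ _)) c) a∈ (ms ∘ there) x∈ t∉
      from ((s , t) ∷ rs′) {tl′} τ′ ps′ a∈ c ms _ = single s (t ∷ zig rs′ ++ tl′ ++ zig ps′) c a∈ (ms (here refl)) (no-cross τ′ c ms)
        where
        no-cross : ∀ {tl′} (τ′ : Tail tl′) → IsC (a ∷ b ∷ s ∷ t ∷ zig rs′ ++ tl′ ++ zig ps′) →
          (∀ {x} → x ∈ s ∷ map proj₁ rs′ ++ tail-marks τ′ ++ map proj₁ ps′ → x ∈ A) →
          ∀ {x} → x ∈ t ∷ zig rs′ ++ tl′ ++ zig ps′ → x ∉ A → ¬ Adj G b x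
        no-cross {tl′} τ′ c ms {x} x∈ x∉ with ∈-++⁻ (t ∷ zig rs′) x∈
        ... | inj₁ x∈rs = in-zig [] ((s , t) ∷ rs′) (tl′ ++ zig ps′) c a∈ (λ p → ms (∈-++⁺ˡ p)) (there x∈rs) x∉
        ... | inj₂ x∈′ with ∈-++⁻ tl′ x∈′
        ...   | inj₂ x∈ps = in-zig (s ∷ t ∷ zig rs′ ++ tl′) ps′ []
                (subst (λ z → IsC (a ∷ b ∷ z)) (trans (sym (++-assoc (s ∷ t ∷ zig rs′) tl′ (zig ps′)))
                  (cong ((s ∷ t ∷ zig rs′ ++ tl′) ++_) (sym (++-identityʳ (zig ps′))))) c) a∈
                (λ p → ms (∈-++⁺ʳ (s ∷ map proj₁ rs′) (∈-++⁺ʳ (tail-marks τ′) p))) x∈ps x∉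
        no-cross (double a′ c₁ c₂) c ms x∈ x∉ | inj₂ _ | inj₁ (here refl) = contradiction (ms (∈-++⁺ʳ (s ∷ map proj₁ rs′) (here refl))) x∉
        no-cross (double a′ c₁ c₂) c ms x∈ x∉ | inj₂ _ | inj₁ (there (here refl)) =
          crossing (s ∷ t ∷ zig rs′) (c₂ ∷ zig ps′) c a∈ (ms (∈-++⁺ʳ (s ∷ map proj₁ rs′) (here refl)))
        no-cross (double a′ c₁ c₂) c ms x∈ x∉ | inj₂ _ | inj₁ (there (there (here refl))) = by-ps ps′ c ms
          where
          assoc : ∀ z → s ∷ t ∷ zig rs′ ++ a′ ∷ c₁ ∷ c₂ ∷ z ≡ s ∷ (t ∷ zig rs′ ++ a′ ∷ c₁ ∷ []) ++ c₂ ∷ z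
          assoc z = cong (λ l → s ∷ t ∷ l) (sym (++-assoc (zig rs′) (a′ ∷ c₁ ∷ []) (c₂ ∷ z)))
          by-ps : ∀ ps′ → IsC (a ∷ b ∷ s ∷ t ∷ zig rs′ ++ a′ ∷ c₁ ∷ c₂ ∷ zig ps′) →
            (∀ {x} → x ∈ s ∷ map proj₁ rs′ ++ a′ ∷ map proj₁ ps′ → x ∈ A) → ¬ Adj G b c₂
          by-ps [] c ms = crossing-last (t ∷ zig rs′ ++ a′ ∷ c₁ ∷ []) (subst (λ z → IsC (a ∷ b ∷ z)) (assoc []) c) a∈ (ms (here refl))
          by-ps ((s′ , t′) ∷ ps′) c ms = crossing-back (t ∷ zig rs′ ++ a′ ∷ c₁ ∷ []) (t′ ∷ zig ps′)
            (subst (λ z → IsC (a ∷ b ∷ z)) (assoc _) c) (ms (here refl)) (ms (∈-++⁺ʳ (s ∷ map proj₁ rs′) (there (here refl))))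

    b∉A : ∀ {a b} → (a , b) ∈ qs → b ∉ A
    b∉A p = let open Single (single-of p) in not-consecutive C₀ isc₁ a∈

    single-nbrs : ∀ {a b} → (a , b) ∈ qs → b ≢ w → (∀ {t} → Adj G b t → t ∈ A) × (∀ {t} → t ∈ A → Adj G b t)
    single-nbrs p = let open Single (single-of p) in λ b≢w → exchange isc₁ a∈ a⁺∈ b≢w no-cross

    -- Each of these is joined to exactly `A` (`Bs-nbrs`). Leaving out `w`, whose degree is unknown,
    -- there are still `k ∸ 1` of them, just enough to separate the `k` vertices of `A` along a
    -- path.
    Bs : List (Fin n)
    Bs = filter (λ b → ¬? (b ≟ w)) (v ∷ map proj₂ qs)

    Bs-nbrs : ∀ {b} → b ∈ Bs → (∀ {t} → Adj G b t → t ∈ A) × (∀ {t} → t ∈ A → Adj G b t)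
    Bs-nbrs {b} b∈ with ∈-filter⁻ (λ b → ¬? (b ≟ w)) {xs = v ∷ map proj₂ qs} b∈
    ... | here refl , b≢w = v-nbr , v~A
    ... | there p , b≢w with ∈-map⁻ proj₂ p
    ...   | (a , _) , q , refl = single-nbrs q b≢w

    ∉Bs : ∀ {u t} → Adj G u t → t ∉ A → u ∉ Bs
    ∉Bs a t∉ u∈ = t∉ (proj₁ (Bs-nbrs u∈) a)

    w∉Bs : w ∉ Bs
    w∉Bs p = proj₂ (∈-filter⁻ (λ b → ¬? (b ≟ w)) {xs = v ∷ map proj₂ qs} p) refl

    nd-singles : NoDup (v ∷ map proj₂ qs)
    nd-singles = NoDup-∷ (λ p → v∉L (IsC-∈ isc (∈-++⁺ˡ (⊑-∈ (zig-seconds-⊑ qs) p))))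
      (NoDup-⊑ (⊑-trans (zig-seconds-⊑ qs) (⊑-by (zig qs ∷ tl ∷ []) (` 0) (` 0 ⊕ ` 1))) (IsC-nd isc))

    ndB : NoDup Bs
    ndB = NoDup-⊑ (filter-⊑ (λ b → ¬? (b ≟ w)) (v ∷ map proj₂ qs)) nd-singles

    |Bs| : k ≤ suc (length Bs)
    |Bs| = ≤-trans |qs| (≤-trans (≤-reflexive (cong suc (sym (length-map proj₂ qs))))
      (length-⊆ nd-singles (λ {u} p → case u ≟ w of λ { (yes e) → here e ; (no ne) → there (∈-filter⁺ (λ b → ¬? (b ≟ w)) p ne) })))

    A∥Bs : ∀ {a} → a ∈ A → a ∉ Bs
    A∥Bs a∈ p with ∈-filter⁻ (λ b → ¬? (b ≟ w)) {xs = v ∷ map proj₂ qs} p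
    ... | here refl , _ = v∉L (A⊆L a∈)
    ... | there q , _ with ∈-map⁻ proj₂ q
    ...   | (_ , _) , ab∈ , refl = b∉A ab∈ a∈

    -- Closing a path between two vertices of A by a zigzag through all of A and k - 1 vertices of Bs.
    zigzag-close : ∀ {α β} A′ → α ∷ β ∷ A′ ≋ A → ∀ δ → W α δ β → NoDup δ → (∀ {t} → t ∈ δ → t ∉ A) → (∀ {t} → t ∈ δ → t ∉ Bs) → length δ ≤ 2
    zigzag-close {α} {β} A′ e δ wδ ndδ δ∥A δ∥B = arith (length δ) (length A′) k |A′| (≤-trans (≤-reflexive (sym |zs|)) (circumference cz ndz 3z))
      where
      in-A : ∀ {a} → a ∈ α ∷ β ∷ A′ → a ∈ A
      in-A = ⊑-∈ (≋⇒⊑ e)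
      |A′| : 2 + length A′ ≡ k
      |A′| = trans (≋-length (NoDup-⊑ (≋⇒⊑ e) ndA) e) |A|
      |A′|<|Bs| : length A′ < length Bs
      |A′|<|Bs| = s≤s⁻¹ (≤-trans (≤-reflexive |A′|) |Bs|)
      joined : ∀ {b a} → b ∈ Bs → a ∈ A → Adj G b a
      joined b∈ = proj₂ (Bs-nbrs b∈)
      woven : ∀ bs as {x} → x ∈ A → (∀ {b} → b ∈ bs → b ∈ Bs) → (∀ {a} → a ∈ as → a ∈ A) → length as < length bs → W x (weave bs as) α
      woven (b ∷ bs) []       x∈ ⊆B ⊆A _ = adj-sym (joined (⊆B (here refl)) x∈) , joined (⊆B (here refl)) (in-A (here refl))
      woven (b ∷ bs) (a ∷ as) x∈ ⊆B ⊆A (s≤s l) = adj-sym (joined (⊆B (here refl)) x∈) , joined (⊆B (here refl)) (⊆A (here refl)) ,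
        woven bs as (⊆A (here refl)) (⊆B ∘ there) (⊆A ∘ there) l
      zs = α ∷ δ ++ β ∷ weave Bs A′
      cz : Closed zs
      cz = W-++ δ wδ (woven Bs A′ (in-A (there (here refl))) id (λ p → in-A (there (there p))) |A′|<|Bs|)
      zs-⊑ : zs ⊑ δ ++ (α ∷ β ∷ A′) ++ Bs
      zs-⊑ = ⊑-trans (⊑-by (δ ∷ (α ∷ []) ∷ (β ∷ []) ∷ weave Bs A′ ∷ []) (` 1 ⊕ ` 0 ⊕ ` 2 ⊕ ` 3) ((` 0 ⊕ ` 1 ⊕ ` 2) ⊕ ` 3))
        (⊑-trans (++-⊑ (δ ++ α ∷ β ∷ []) (δ ++ α ∷ β ∷ []) (weave Bs A′) (Bs ++ A′) (sub λ _ → ≤-refl) (weave-⊑ Bs A′))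
          (⊑-by (δ ∷ (α ∷ []) ∷ (β ∷ []) ∷ Bs ∷ A′ ∷ []) ((` 0 ⊕ ` 1 ⊕ ` 2) ⊕ ` 3 ⊕ ` 4) (` 0 ⊕ (` 1 ⊕ ` 2 ⊕ ` 4) ⊕ ` 3)))
      ndz : NoDup zs
      ndz = NoDup-⊑ zs-⊑ (NoDup-++ ndδ (NoDup-++ (NoDup-⊑ (≋⇒⊑ e) ndA) ndB (A∥Bs ∘ in-A))
        (λ t∈ p → [ δ∥A t∈ ∘ in-A , δ∥B t∈ ]′ (∈-++⁻ (α ∷ β ∷ A′) p)))
      |zs| : length zs ≡ 3 + (length δ + 2 * length A′)
      |zs| = cong suc (trans (length-++ δ) (trans (cong (λ l → length δ + suc l) (length-weave Bs A′ |A′|<|Bs|)) (eq (length δ) (length A′))))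
        where
        eq : ∀ d a → d + suc (suc (2 * a)) ≡ 2 + (d + 2 * a)
        eq d a = solve (d ∷ a ∷ [])
      3z : 3 ≤ length zs
      3z = ≤-trans (m≤m+n 3 _) (≤-reflexive (sym |zs|))
      arith : ∀ d a k → 2 + a ≡ k → 3 + (d + 2 * a) ≤ 2 * k + 1 → d ≤ 2
      arith d a .(2 + a) refl h = lin _ _ 0 h (eq d a)
        where
        eq : ∀ d a → 2 * (2 + a) + 1 + d + 0 ≡ 3 + (d + 2 * a) + 2
        eq d a = solve (d ∷ a ∷ [])

    zigzag : ∀ {α β} → α ∈ A → β ∈ A → α ≢ β → ∀ δ → W α δ β → NoDup δ → (∀ {t} → t ∈ δ → t ∉ A) → (∀ {t} → t ∈ δ → t ∉ Bs) → length δ ≤ 2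
    zigzag {α} {β} α∈ β∈ α≢β with ordered-pair α∈ β∈ α≢β
    ... | inj₁ (l , m , r , e) = zigzag-close (l ++ m ++ r) (subst (λ z → α ∷ β ∷ l ++ m ++ r ≋ z) (sym e)
      (≋-by ((α ∷ []) ∷ (β ∷ []) ∷ l ∷ m ∷ r ∷ []) (` 0 ⊕ ` 1 ⊕ ` 2 ⊕ ` 3 ⊕ ` 4) (` 2 ⊕ ` 0 ⊕ ` 3 ⊕ ` 1 ⊕ ` 4)))
    ... | inj₂ (l , m , r , e) = zigzag-close (l ++ m ++ r) (subst (λ z → α ∷ β ∷ l ++ m ++ r ≋ z) (sym e)
      (≋-by ((α ∷ []) ∷ (β ∷ []) ∷ l ∷ m ∷ r ∷ []) (` 0 ⊕ ` 1 ⊕ ` 2 ⊕ ` 3 ⊕ ` 4) (` 2 ⊕ ` 1 ⊕ ` 3 ⊕ ` 0 ⊕ ` 4)))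

    IsDouble : Fin n → Fin n → Fin n → Fin n → Set
    IsDouble = Double (tail-gap τ)

    location : ∀ {t} → t ∈ L → t ∈ A ⊎ (∃ λ a → (a , t) ∈ qs) ⊎ ∃ λ c° → ∃₂ λ p s → IsDouble t c° p s
    location t∈ with ∈-++⁻ (zig qs) (∈-IsC isc t∈)
    ... | inj₁ p = Data.Sum.map (λ q → marks-A (∈-++⁺ˡ q)) inj₁ (zig-∈ {qs = qs} p)
    ... | inj₂ p with tail-∈ τ p
    ...   | inj₁ q = inj₁ (marks-A (∈-++⁺ʳ (map proj₁ qs) q))
    ...   | inj₂ q = inj₂ (inj₂ (double-gap τ al (s≤s⁻¹ (≤-trans (≤-trans (n≤1+n 2) 3≤k) |qs|)) q))

    D∉A : ∀ {u} (C : Comp u) → ∀ {y} → y ∈ Comp.D C → y ∉ A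
    D∉A C y∈ y∈A = Comp.D∥L C y∈ (A⊆L y∈A)

    D∉Bs : ∀ {u} (C : Comp u) {t} → t ∈ Comp.X C → t ∉ A → ∀ {y} → y ∈ Comp.D C → y ∉ Bs
    D∉Bs C t∈ t∉ y∈ = ∉Bs (Comp.joined C y∈ t∈) t∉

    b≢w-free : ∀ {a b} → (a , b) ∈ qs → b ≢ w → ∀ {u} (C : Comp u) → b ∉ Comp.X C
    b≢w-free p b≢w C b∈ = D∉A C (Comp.v∈D C) (proj₁ (single-nbrs p b≢w) (adj-sym (Comp.joined C (Comp.v∈D C) b∈)))

    -- A single gap has two neighbours in `A` on the cycle, so a path through it can end in `A` away
    -- from its other end, as `zigzag` requires.
    flank : ∀ {a b} → (a , b) ∈ qs → ∀ x → ∃ λ f → f ∈ A × f ≢ x × Adj G f b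
    flank {a} {b} p x with a ≟ x
    ... | no a≢x = let open Single (single-of p) in a , a∈ , a≢x , proj₁ (closed′ isc₁)
    ... | yes refl = let open Single (single-of p) in a⁺ , a⁺∈ , (λ e → NoDup-head (IsC-nd isc₁) (there (here (sym e)))) , adj-sym (proj₁ (proj₂ (closed′ isc₁)))

    3≰2 : ∀ {m} → ¬ 3 + m ≤ 2
    3≰2 (s≤s (s≤s ()))

    -- By `zigzag` such a component would be a single vertex whose neighbours other than `w` are in
    -- `A`. There are `k ∸ 1` of these, and they avoid the two vertices `a`, `a⁺` next to `w`, which
    -- is one too many for `A`.
    w-free : ∀ {a} → (a , w) ∈ qs → ∀ {u} (C : Comp u) → w ∉ Comp.X C
    w-free {a} aw∈ {u} C w∈X = <⇒≱ (s≤s (≤-reflexive (cong suc |A|))) (≤-trans (s≤s (s≤s (≤-reflexive (sym |X|≡k)))) too-many)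
      where
      open Single (single-of aw∈)
      X = Comp.X C
      D = Comp.D C
      others-A : ∀ {x} → x ∈ X → x ≢ w → x ∈ A
      others-A {x} x∈ x≢w with location (Comp.X⊆L C x∈)
      ... | inj₁ p = p
      ... | inj₂ (inj₁ (_ , p)) = contradiction x∈ (b≢w-free p x≢w C)
      ... | inj₂ (inj₂ (c° , p , s , d)) = let (f , f∈ , f≢p , f~w) = flank aw∈ p in
        ⊥-elim (3≰2 (≤-trans (s≤s (≤-trans (+-monoˡ-≤ 1 (1≤D C)) (≤-reflexive (sym (length-++ D)))))
          (≤-trans (s≤s (≤-reflexive refl)) (zigzag f∈ (Double.p∈ d) f≢p (w ∷ D ++ x ∷ [])
            (f~w , W-++ D (Out.walk (comp-out C w∈X x∈)) (Double.c~p d))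
            (NoDup-∷ (λ q → [ (λ w∈D → Comp.D∥L C w∈D w∈) , (λ { (here e) → x≢w (sym e) }) ]′ (∈-++⁻ D q))
              (NoDup-++ (Comp.ndD C) NoDup-[x] (λ { y∈ (here refl) → Comp.D∥L C y∈ (Double.c∈L d) })))
            (cons (b∉A aw∈) (λ q → [ D∉A C , sole (Double.c∉ d) ]′ (∈-++⁻ D q)))
            (cons w∉Bs (λ q → [ D∉Bs C w∈X (b∉A aw∈) , sole (∉Bs (Double.c~c° d) (Double.c°∉ d)) ]′ (∈-++⁻ D q)))))))
      |D|≤1 : length D ≤ 1
      |D|≤1 with other-∈ {e = w} X (Comp.ndX C) (Comp.2≤X C)
      ... | x , x∈ , x≢w = let (f , f∈ , f≢x , f~w) = flank aw∈ x in
        s≤s⁻¹ (zigzag f∈ (others-A x∈ x≢w) f≢x (w ∷ D) (f~w , Out.walk (comp-out C w∈X x∈))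
          (NoDup-∷ (λ w∈D → Comp.D∥L C w∈D w∈) (Comp.ndD C))
          (cons (b∉A aw∈) (D∉A C))
          (cons w∉Bs (D∉Bs C w∈X (b∉A aw∈))))
      |X|≡k : length X ≡ k
      |X|≡k = suc-injective (trans (+-comm 1 (length X)) (trans (cong (length X +_) (sym (≤-antisym |D|≤1 (1≤D C)))) (Comp.size C)))
      a∉X : a ∉ X
      a∉X p = not-consecutive C isc₁ p w∈X
      a⁺∉X : a⁺ ∉ X
      a⁺∉X = not-consecutive C (IsC-rotate (a ∷ []) _ isc₁) w∈X
      too-many : 2 + length X ≤ suc (length A)
      too-many = length-⊆ {ys = w ∷ A} (NoDup-∷ {x = a} {a⁺ ∷ X} (λ { (here e) → NoDup-head (IsC-nd isc₁) (there (here e)) ; (there p) → a∉X p })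
          (NoDup-∷ a⁺∉X (Comp.ndX C)))
        (λ { (here refl) → there a∈ ; (there (here e)) → there (subst (_∈ A) (sym e) a⁺∈) ; {x} (there (there p)) → case x ≟ w of λ { (yes e) → here e ; (no ne) → there (others-A p ne) } })

    -- Another neighbour in `A` than `s` would give the path from `s` through `c°`, `c` and `D`,
    -- with three inner vertices at least. So `c` and `s` are the only neighbours, `D` has at least
    -- two vertices because `k` is at least 3, and the path from `p` through `c` and `D` to `s` is
    -- too long for `zigzag`.
    double-free : ∀ {c c° p s} → IsDouble c c° p s → ∀ {u} (C : Comp u) → c ∉ Comp.X C
    double-free {c} {c°} {p} {s} d C c∈ = 3≰2 (≤-trans (s≤s 2≤D) (zigzag p∈ s∈ p≢s (c ∷ D) (adj-sym c~p , Out.walk (comp-out C c∈ s∈X))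
        (NoDup-∷ (λ q → Comp.D∥L C q c∈L) (Comp.ndD C)) (cons c∉ (D∉A C))
        (cons (∉Bs c~c° c°∉) (D∉Bs C c∈ c∉))))
      where
      open Double d
      X = Comp.X C
      D = Comp.D C
      others : ∀ {x} → x ∈ X → x ≢ c → x ≡ s
      others {x} x∈ x≢c with location (Comp.X⊆L C x∈)
      ... | inj₂ (inj₁ (_ , q)) = ⊥-elim (case x ≟ w of λ { (yes refl) → w-free q C x∈ ; (no x≢w) → b≢w-free q x≢w C x∈ })
      ... | inj₂ (inj₂ (_ , _ , _ , d′)) = contradiction x∈ (subst (_∉ X) (sym (tail-gap-other τ x≢c (adj⇒≢ c~c°) (Double.c∈g d′) c∈g c°∈g)) (not-both C c∈))
      ... | inj₁ x∈A with x ≟ s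
      ...   | yes e = e
      ...   | no x≢s = ⊥-elim (3≰2 (≤-trans (s≤s (s≤s (1≤D C))) (zigzag s∈ x∈A (x≢s ∘ sym) (c° ∷ c ∷ D)
              (adj-sym c°~s , adj-sym c~c° , Out.walk (comp-out C c∈ x∈))
              (NoDup-∷ (λ { (here e) → adj⇒≢ c~c° (sym e) ; (there q) → Comp.D∥L C q c°∈L }) (NoDup-∷ (λ q → Comp.D∥L C q c∈L) (Comp.ndD C)))
              (cons c°∉ (cons c∉ (D∉A C)))
              (cons (∉Bs (adj-sym c~c°) c∉) (cons (∉Bs c~c° c°∉) (D∉Bs C c∈ c∉))))))
      s∈X : s ∈ X
      s∈X with other-∈ {e = c} X (Comp.ndX C) (Comp.2≤X C)
      ... | x , x∈ , x≢c = subst (_∈ X) (others x∈ x≢c) x∈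
      2≤D : 2 ≤ length D
      2≤D = arith (length X) (length D) k (Comp.size C) 3≤k (length-⊆ {ys = c ∷ s ∷ []} (Comp.ndX C)
        (λ {x} p → case x ≟ c of λ { (yes e) → here e ; (no ne) → there (here (others p ne)) }))
        where
        arith : ∀ x d k → x + d ≡ suc k → 3 ≤ k → x ≤ 2 → 2 ≤ d
        arith x d k e 3≤ x≤ = lin _ _ 0 (+-mono-≤ (+-mono-≤ (≤-reflexive (sym e)) 3≤) x≤) (eq x d k)
          where
          eq : ∀ x d k → x + d + k + 2 + 2 + 0 ≡ suc k + 3 + x + d
          eq x d k = solve (x ∷ d ∷ k ∷ [])

    X⊆A : ∀ {u} (C : Comp u) {t} → t ∈ Comp.X C → t ∈ A
    X⊆A C {t} t∈ with location (Comp.X⊆L C t∈)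
    ... | inj₁ p = p
    ... | inj₂ (inj₁ (_ , p)) = ⊥-elim (case t ≟ w of λ { (yes refl) → w-free p C t∈ ; (no t≢w) → b≢w-free p t≢w C t∈ })
    ... | inj₂ (inj₂ (_ , _ , _ , d)) = contradiction t∈ (double-free d C)

    off-L-nbr : ∀ {u t} → u ∉ L → Adj G u t → t ∉ A → t ∉ L
    off-L-nbr {u} {t} u∉ a t∉ t∈ = [ (λ p → Comp.D∥L (comp u u∉) p t∈) , (λ p → t∉ (X⊆A (comp u u∉) p)) ]′
      (Comp.nbr (comp u u∉) (Comp.v∈D (comp u u∉)) a)

    -- New only for `b ≡ w`. Other single gaps see nothing outside `A`, components do not see `w`,
    -- and an edge to the double gap gives a path with three inner vertices between vertices of `A`.
    b-nbr : ∀ {a b} → (a , b) ∈ qs → ∀ {t} → Adj G b t → t ∈ A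
    b-nbr {a} {b} p {t} e with b ≟ w
    ... | no b≢w = proj₁ (single-nbrs p b≢w) e
    ... | yes refl with t ∈? A | t ∈? L
    ...   | yes t∈A | _ = t∈A
    ...   | no t∉A | no t∉L = contradiction (IsC-∈ isc₁ (there (here refl))) (off-L-nbr t∉L (adj-sym e) (b∉A p))
      where open Single (single-of p)
    ...   | no t∉A | yes t∈L with location t∈L
    ...     | inj₁ q = q
    ...     | inj₂ (inj₁ (_ , q)) = contradiction (proj₁ (single-nbrs q (λ { refl → adj⇒≢ e refl })) (adj-sym e)) (b∉A p)
    ...     | inj₂ (inj₂ (c° , _ , s , d)) = let open Double d ; (f , f∈ , f≢s , f~w) = flank p s in
              ⊥-elim (3≰2 (zigzag f∈ s∈ f≢s (w ∷ t ∷ c° ∷ []) (f~w , e , c~c° , c°~s)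
                (NoDup-∷ (λ { (here e′) → adj⇒≢ e e′ ; (there (here refl)) → c°≢w d refl }) (NoDup-pair (adj⇒≢ c~c°)))
                (cons (b∉A p) (both c∉ c°∉))
                (cons w∉Bs (both (∉Bs c~c° c°∉) (∉Bs (adj-sym c~c°) c∉)))))
      where
      c°≢w : ∀ {c c° p s} → IsDouble c c° p s → c° ≢ w
      c°≢w d refl = NoDup-disjoint {xs = zig qs} (IsC-nd isc) (⊑-∈ (zig-seconds-⊑ qs) (∈-map⁺ proj₂ p)) (tail-gap-∈ τ (Double.c°∈g d))

    double-nbr : ∀ {c c° p s} → IsDouble c c° p s → ∀ {t} → Adj G c t → t ∉ A → t ∈ tail-gap τ
    double-nbr d {t} e t∉A with t ∈? L
    ... | no t∉L = contradiction (Double.c∈L d) (off-L-nbr t∉L (adj-sym e) (Double.c∉ d))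
    ... | yes t∈L with location t∈L
    ...   | inj₁ q = contradiction q t∉A
    ...   | inj₂ (inj₁ (_ , q)) = contradiction (b-nbr q (adj-sym e)) (Double.c∉ d)
    ...   | inj₂ (inj₂ (_ , _ , _ , d′)) = Double.c∈g d′

    on-L-edge : ∀ {u t} → u ∈ L → u ∉ A → t ∉ A → Adj G u t → u ∈ tail-gap τ × t ∈ tail-gap τ
    on-L-edge u∈ u∉ t∉ e with location u∈
    ... | inj₁ q = contradiction q u∉
    ... | inj₂ (inj₁ (_ , q)) = contradiction (b-nbr q e) t∉
    ... | inj₂ (inj₂ (_ , _ , _ , d)) = Double.c∈g d , double-nbr d e t∉

    |L|≥ : 2 * k + tail-excess τ ≤ length L
    |L|≥ = subst₂ (λ x y → 2 * x + tail-excess τ ≤ y) (trans (≤-antisym (length-⊆ marks-nd marks-A) (length-⊆ ndA A-marks)) |A|) (IsC-length isc)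
      (subst₂ (λ x y → 2 * x + tail-excess τ ≤ y) (sym (trans (length-++ (map proj₁ qs)) (cong (_+ length (tail-marks τ)) (length-map proj₁ qs))))
        (sym (trans (length-++ (zig qs)) (cong (_+ length tl) (length-zig qs)))) (count τ))
      where
      count : ∀ {tl} (τ : Tail tl) → 2 * (length qs + length (tail-marks τ)) + tail-excess τ ≤ 2 * length qs + length tl
      count none = ≤-reflexive (cong (_+ 0) (cong (2 *_) (+-identityʳ (length qs))))
      count (double _ _ _) = ≤-reflexive (eq (length qs))
        where
        eq : ∀ m → 2 * (m + 1) + 1 ≡ 2 * m + 3
        eq m = solve (m ∷ [])
      marks-nd : NoDup (map proj₁ qs ++ tail-marks τ)
      marks-nd = NoDup-⊑ (++-⊑ (map proj₁ qs) (zig qs) (tail-marks τ) tl (zig-firsts-⊑ qs) (tail-marks-⊑ τ)) (IsC-nd isc)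

    |L|<n : length L < n
    |L|<n = NoDup⇒length≤ (NoDup-∷ v∉L nd)

    1≤|qs| : 1 ≤ length qs
    1≤|qs| = s≤s⁻¹ (≤-trans (≤-trans (n≤1+n 2) 3≤k) |qs|)

    into-H : (∀ {u t} → u ∉ L → t ∉ L → ¬ Adj G u t) → IntoH G k
    into-H none-off = by-tail τ refl |L|≥
      where
      inside : ∀ {u t} → u ∉ A → t ∉ A → Adj G u t → u ∈ tail-gap τ × t ∈ tail-gap τ
      inside {u} u∉ t∉ e with u ∈? L
      ... | yes u∈ = on-L-edge u∈ u∉ t∉ e
      ... | no u∉L = contradiction e (none-off u∉L (off-L-nbr u∉L e t∉))
      embed : ∀ Cs → NoDup Cs → (∀ {u} → u ∈ Cs → u ∉ A) → 2 * k + length Cs ≤ n → (∀ {u} → u ∈ tail-gap τ → u ∈ Cs) → G ⊆ Hgraph n (2 * k + length Cs) k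
      embed Cs ndC C∥A size s = subst (λ x → G ⊆ Hgraph n (2 * x + length Cs) x) |A|
        (⊆-Hgraph G A Cs ndA ndC (λ p q → C∥A q p) (subst (λ x → 2 * x + length Cs ≤ n) (sym |A|) size)
          (λ u∉ t∉ e → let (p , q) = inside u∉ t∉ e in s p , s q))
      by-tail : ∀ {tl} (τ′ : Tail tl) → tail-gap τ ≡ tail-gap τ′ → 2 * k + tail-excess τ′ ≤ length L → IntoH G k
      by-tail (double _ c₁ c₂) eq |L|≥′ = inj₂ (size , embed (c₁ ∷ c₂ ∷ []) nd₂ C∥A size (subst (_ ∈_) eq))
        where
        size : 2 * k + 2 ≤ n
        size = ≤-trans (≤-reflexive (+-suc (2 * k) 1)) (≤-trans (s≤s |L|≥′) |L|<n)
        gap-double : ∀ {c} → c ∈ c₁ ∷ c₂ ∷ [] → ∃ λ c° → ∃₂ λ p s → IsDouble c c° p s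
        gap-double p = double-gap τ al 1≤|qs| (subst (_ ∈_) (sym eq) p)
        C∥A : ∀ {u} → u ∈ c₁ ∷ c₂ ∷ [] → u ∉ A
        C∥A p = let (_ , _ , _ , d) = gap-double p in Double.c∉ d
        nd₂ : NoDup (c₁ ∷ c₂ ∷ [])
        nd₂ = let (c° , _ , _ , d) = gap-double (here refl) in
          NoDup-pair λ { refl → adj⇒≢ (Double.c~c° d) (sym (both {P = _≡ c₁} refl refl (subst (c° ∈_) eq (Double.c°∈g d)))) }
      -- Without a double gap there is no edge outside `A`, so C can be filled with any vertices
      -- outside `A`: one if `n` is `2 * k + 1`, otherwise two.
      by-tail none eq |L|≥′ with n Data.Nat.≟ 2 * k + 1
      ... | yes n≡ = inj₁ (n≡ , subst (λ m → G ⊆ Hgraph m (2 * k + 1) k) n≡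
            (embed (v ∷ []) NoDup-[x] (sole (λ p → v∉L (A⊆L p))) (≤-reflexive (sym n≡)) (λ p → contradiction (subst (_ ∈_) eq p) λ ())))
      ... | no n≢ = let (a , b , ab∈) = some-pair qs 1≤|qs| in inj₂ (size , with-single ab∈)
        where
        size : 2 * k + 2 ≤ n
        size = ≤-trans (≤-reflexive (+-suc (2 * k) 1))
          (≤∧≢⇒< (≤-trans (≤-reflexive (+-suc (2 * k) 0)) (≤-trans (s≤s |L|≥′) |L|<n)) (n≢ ∘ sym))
        some-pair : ∀ (qs : List (Fin n × Fin n)) → 1 ≤ length qs → ∃₂ λ a b → (a , b) ∈ qs
        some-pair ((a , b) ∷ _) _ = a , b , here refl
        with-single : ∀ {a b} → (a , b) ∈ qs → G ⊆ Hgraph n (2 * k + 2) k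
        with-single {a} {b} ab∈ = embed (v ∷ b ∷ []) (NoDup-∷ (λ { (here refl) → v∉L (IsC-∈ isc₁ (there (here refl))) }) NoDup-[x])
          (both (λ p → v∉L (A⊆L p)) (b∉A ab∈)) size (λ p → contradiction (subst (_ ∈_) eq p) λ ())
          where open Single (single-of ab∈)

    D-small : ∀ {u} (C : Comp u) → length (Comp.D C) ≤ 2
    D-small C with shape C
    ... | inj₂ |D|≡1 = ≤-trans (≤-reflexive |D|≡1) (n≤1+n 1)
    ... | inj₁ _ with 2 ≤? length (Comp.D C)
    ...   | no ¬2≤ = ≤-trans (s≤s⁻¹ (≰⇒> ¬2≤)) (n≤1+n 1)
    ...   | yes 2≤ = let (x , y , x∈ , y∈ , x≢y) = two-∈ (Comp.X C) (Comp.ndX C) (Comp.2≤X C) in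
      zigzag (X⊆A C x∈) (X⊆A C y∈) x≢y (Comp.D C) (Out.walk (comp-out C x∈ y∈)) (Comp.ndD C) (D∉A C)
        λ {d} d∈ → let (d′ , d′∈ , d′≢d) = other-∈ {e = d} (Comp.D C) (Comp.ndD C) 2≤ in ∉Bs (Comp.clique C d∈ d′∈ (d′≢d ∘ sym)) (D∉A C d′∈)

    module OffEdge {u₀ t₀ : Fin n} (u₀∉ : u₀ ∉ L) (t₀∉ : t₀ ∉ L) (u₀~t₀ : Adj G u₀ t₀) where

      C₁ : Comp u₀
      C₁ = comp u₀ u₀∉

      open Comp C₁ using () renaming (D to D₁; X to X₁)

      t₀∈D : t₀ ∈ D₁
      t₀∈D = [ id , (λ p → contradiction (Comp.X⊆L C₁ p) t₀∉) ]′ (Comp.nbr C₁ (Comp.v∈D C₁) u₀~t₀)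

      |D₁| : length D₁ ≡ 2
      |D₁| = ≤-antisym (D-small C₁) (length-⊆ (NoDup-pair (adj⇒≢ u₀~t₀)) (both (Comp.v∈D C₁) t₀∈D))

      |X₁| : length X₁ ≡ 2
      |X₁| with shape C₁
      ... | inj₁ e = e
      ... | inj₂ e = contradiction (trans (sym |D₁|) e) λ ()

      k≡3 : k ≡ 3
      k≡3 = suc-injective (trans (sym (Comp.size C₁)) (cong₂ _+_ |X₁| |D₁|))

      D₁∉Bs : ∀ {d} → d ∈ D₁ → d ∉ Bs
      D₁∉Bs {d} d∈ = let (d′ , d′∈ , d′≢d) = other-∈ {e = d} D₁ (Comp.ndD C₁) (≤-reflexive (sym |D₁|)) in
        ∉Bs (Comp.clique C₁ d∈ d′∈ (d′≢d ∘ sym)) (D∉A C₁ d′∈)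

      module _ {x y q : Fin n} (x∈ : x ∈ X₁) (y∈ : y ∈ X₁) (x≢y : x ≢ y) (q∈ : q ∈ A) (q≢x : q ≢ x) (q≢y : q ≢ y)
        (A-only : ∀ {a} → a ∈ A → a ∈ x ∷ y ∷ q ∷ []) (X₁-only : ∀ {a} → a ∈ X₁ → a ∈ x ∷ y ∷ []) where

        -- The cycle `q`, `u`, `u′`, `x′`, the two vertices of `D₁`, `y′`, `b` has eight vertices,
        -- and `2 * k + 1` is 7.
        eight : ∀ {u u′ x′ y′} → x′ ∈ X₁ → y′ ∈ X₁ → x′ ≢ y′ → q ≢ x′ → q ≢ y′ → u ∉ A → u′ ∉ A → u ∉ D₁ → u′ ∉ D₁ →
          Adj G q u → Adj G u u′ → ¬ Adj G u′ x′
        eight {u} {u′} {x′} {y′} x′∈ y′∈ x′≢y′ q≢x′ q≢y′ u∉ u′∉ u∉D u′∉D q~u u~u′ u′~x′ with some-∈ Bs (s≤s⁻¹ (≤-trans (≤-trans (n≤1+n 2) 3≤k) |Bs|))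
        ... | b , b∈ = contradiction (subst (_≤ 7) |zs| (subst (λ m → length zs ≤ 2 * m + 1) k≡3 (circumference cz ndz 3z))) λ { (s≤s (s≤s (s≤s (s≤s (s≤s (s≤s (s≤s ()))))))) }
          where
          ρ = (u ∷ u′ ∷ []) ∷ D₁ ∷ (q ∷ []) ∷ (x′ ∷ []) ∷ (y′ ∷ []) ∷ (b ∷ []) ∷ []
          the-cycle : Exp 6
          the-cycle = ` 2 ⊕ ` 0 ⊕ ` 3 ⊕ ` 1 ⊕ ` 4 ⊕ ` 5
          zs = ⟦ ρ ⟧ the-cycle
          |zs| : length zs ≡ 8
          |zs| = trans (length-⟦⟧ ρ the-cycle) (cong (λ d → 4 + (d + 2)) |D₁|)
          cz : Closed zs
          cz = q~u , u~u′ , u′~x′ , W-++ D₁ (Out.walk (comp-out C₁ x′∈ y′∈)) (adj-sym (proj₂ (Bs-nbrs b∈) (X⊆A C₁ y′∈)) , proj₂ (Bs-nbrs b∈) q∈)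
          3∈A : ∀ {a} → a ∈ q ∷ x′ ∷ y′ ∷ [] → a ∈ A
          3∈A = cons q∈ (both (X⊆A C₁ x′∈) (X⊆A C₁ y′∈))
          uu′∉ : ∀ {a} → a ∈ u ∷ u′ ∷ [] → a ∉ A × a ∉ D₁ × a ∉ Bs
          uu′∉ = both (u∉ , u∉D , ∉Bs u~u′ u′∉) (u′∉ , u′∉D , ∉Bs (adj-sym u~u′) u∉)
          b-only : ∀ {a} → a ∈ b ∷ [] → a ∈ Bs
          b-only = sole b∈
          ndz : NoDup zs
          ndz = NoDup-⊑ (⊑-by ρ the-cycle (` 0 ⊕ ` 1 ⊕ (` 2 ⊕ ` 3 ⊕ ` 4) ⊕ ` 5))
            (NoDup-++ (NoDup-pair (adj⇒≢ u~u′))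
              (NoDup-++ (Comp.ndD C₁)
                (NoDup-++ (NoDup-∷ {x = q} {x′ ∷ y′ ∷ []} (λ { (here e) → q≢x′ e ; (there (here e)) → q≢y′ e })
                    (NoDup-pair x′≢y′)) (NoDup-[x] {x = b})
                  (λ a∈ p → A∥Bs (3∈A a∈) (b-only p)))
                (λ d∈ p → [ D∉A C₁ d∈ ∘ 3∈A , D₁∉Bs d∈ ∘ b-only ]′ (∈-++⁻ (q ∷ x′ ∷ y′ ∷ []) p)))
              (λ a∈ p → let (∉A , ∉D , ∉B) = uu′∉ a∈ in
                [ ∉D , (λ r → [ ∉A ∘ 3∈A , ∉B ∘ b-only ]′ (∈-++⁻ (q ∷ x′ ∷ y′ ∷ []) r)) ]′ (∈-++⁻ D₁ p)))
          3z : 3 ≤ length zs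
          3z = ≤-trans (m≤m+n 3 5) (≤-reflexive (sym |zs|))

        no-eight : ∀ {u u′ s} → u ∉ A → u′ ∉ A → u ∉ D₁ → u′ ∉ D₁ → s ∈ A → s ≢ q → Adj G q u → Adj G u u′ → ¬ Adj G u′ s
        no-eight u∉ u′∉ u∉D u′∉D s∈ s≢q q~u u~u′ with A-only s∈
        ... | here refl = eight x∈ y∈ x≢y q≢x q≢y u∉ u′∉ u∉D u′∉D q~u u~u′
        ... | there (here refl) = eight y∈ x∈ (x≢y ∘ sym) q≢y q≢x u∉ u′∉ u∉D u′∉D q~u u~u′
        ... | there (there (here refl)) = contradiction refl s≢q

        q∉X₁ : q ∉ X₁
        q∉X₁ p with X₁-only p
        ... | here e = q≢x e
        ... | there (here e) = q≢y e

        -- So vertices with a neighbour outside `A` do not see `q`: without `x` and `y` they form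
        -- the matching, while `q` and the remaining vertices form the star.
        partnered-q : ∀ {u u′} → u ∉ A → u′ ∉ A → Adj G u u′ → ¬ Adj G u q
        partnered-q {u} {u′} u∉ u′∉ e u~q with u ∈? L
        ... | no u∉L = let (s , s∈ , s≢q) = other-∈ {e = q} (Comp.X C) (Comp.ndX C) (Comp.2≤X C) in
              no-eight u∉ u′∉ (comps-disjoint C C₁ q∈X q∉X₁ (Comp.v∈D C)) (comps-disjoint C C₁ q∈X q∉X₁ u′∈D)
                (X⊆A C s∈) s≢q (adj-sym u~q) e (Comp.joined C u′∈D s∈)
          where
          C = comp u u∉L
          q∈X : q ∈ Comp.X C
          q∈X = [ (λ p → contradiction (A⊆L q∈) (Comp.D∥L C p)) , id ]′ (Comp.nbr C (Comp.v∈D C) u~q)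
          u′∈D : u′ ∈ Comp.D C
          u′∈D = [ id , (λ p → contradiction (X⊆A C p) u′∉) ]′ (Comp.nbr C (Comp.v∈D C) e)
        ... | yes u∈L with location u∈L
        ...   | inj₁ p = u∉ p
        ...   | inj₂ (inj₁ (_ , p)) = u′∉ (b-nbr p e)
        ...   | inj₂ (inj₂ (c° , p , s , d)) = by-s (s ≟ q)
          where
          open Double d
          on : ∀ {t} → t ∈ L → t ∉ D₁
          on t∈ t∈D = Comp.D∥L C₁ t∈D t∈
          -- The stretch through the gap must leave to a vertex other than `q`. If `s` is `q`, it is
          -- run the other way, from `q` through `c°` and `u` to `p`.
          by-s : Dec (s ≡ q) → ⊥
          by-s (no s≢q)   = no-eight c∉ c°∉ (on c∈L) (on c°∈L) s∈ s≢q (adj-sym u~q) c~c° c°~s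
          by-s (yes refl) = no-eight c°∉ c∉ (on c°∈L) (on c∈L) p∈ p≢s (adj-sym c°~s) (adj-sym c~c°) c~p

        Dom : Fin n → Set
        Dom u = u ∉ A × ∃ λ t → t ∉ A × Adj G u t

        Dom? : ∀ u → Dec (Dom u)
        Dom? u = ¬? (u ∈? A) ×-dec any? (λ t → ¬? (t ∈? A) ×-dec Adj? u t)

        gap-double : ∀ {c} → c ∈ tail-gap τ → ∃ λ c° → ∃₂ λ p s → IsDouble c c° p s
        gap-double = double-gap τ al 1≤|qs|

        zone-Dom : ∀ {z u} → z ∈ tail-gap τ ∷ [] → u ∈ z → Dom u
        zone-Dom (here refl) u∈ = let (c° , _ , _ , d) = gap-double u∈ in Double.c∉ d , c° , Double.c°∉ d , Double.c~c° d

        zone-L : ∀ {z u} → z ∈ tail-gap τ ∷ [] → u ∈ z → u ∈ L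
        zone-L (here refl) u∈ = let (_ , _ , _ , d) = gap-double u∈ in Double.c∈L d

        cover : ∀ {u} → Dom u → u ∈ L → ∃ λ z → z ∈ tail-gap τ ∷ [] × u ∈ z
        cover (u∉ , t , t∉ , e) u∈ = tail-gap τ , here refl , proj₁ (on-L-edge u∈ u∉ t∉ e)

        off-Dom : ∀ {u y} → Dom u → u ∉ L → y ∈ off-class u → Dom y
        off-Dom (u∉ , t , t∉ , e) u∉L y∈ with off-class-∈ y∈
        ... | y∉L , inj₁ refl = u∉ , t , t∉ , e
        ... | y∉L , inj₂ a    = (λ p → y∉L (A⊆L p)) , _ , u∉ , adj-sym a

        disjoint : Disjoint (tail-gap τ ∷ [])
        disjoint = (λ _ ()) , tt

        open Zones {Dom} (tail-gap τ ∷ []) disjoint zone-Dom zone-L cover off-Dom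

        closed-zone : ∀ {z u t} → z ∈ tail-gap τ ∷ [] → u ∈ z → Dom t → Adj G u t → t ∈ z
        closed-zone (here refl) u∈ (t∉ , _) e = proj₂ (on-L-edge (zone-L (here refl) u∈) (proj₁ (zone-Dom (here refl) u∈)) t∉ e)

        class-bound : ∀ {u} → Dom u → length (zone-class (tail-gap τ ∷ []) u) ≤ 2
        class-bound = zone-bound (sole (|tail-gap|≤2 τ)) (λ {u} u∉ _ → D-small (comp u u∉))

        embed : G ⊆ (K 2 ⊹ (S (suc n) ∪ M (n * 2)))
        embed = ⊆-K₂+S∪M G x y q Dom? zone-classes class-bound (zone-sep closed-zone)
          (λ (u∉ , _ , t∉ , e) → partnered-q u∉ t∉ e) (λ u∉ t∉ e → u∉ ∘ A-only , _ , t∉ ∘ A-only , e)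

      into-S∪M : k ≡ 3 × IntoK₂+S∪M G
      into-S∪M = k≡3 , suc n , n * 2 , s≤s z≤n , ≤-trans (m≤m+n 6 4) (+-mono-≤ (s≤s 3≤n) (*-monoˡ-≤ 2 3≤n)) , by-X X₁ (Comp.ndX C₁) |X₁| id id
        where
        3≤n : 3 ≤ n
        3≤n = ≤-trans 3≤ (<⇒≤ |L|<n)
        by-X : ∀ xs → NoDup xs → length xs ≡ 2 → (∀ {a} → a ∈ xs → a ∈ X₁) → (∀ {a} → a ∈ X₁ → a ∈ xs) → G ⊆ (K 2 ⊹ (S (suc n) ∪ M (n * 2)))
        by-X (x ∷ y ∷ []) nd′ _ to only with any? (λ q → (q ∈? A) ×-dec ¬? (q ∈? (x ∷ y ∷ [])))
        ... | no ¬q = contradiction (length-⊆ {ys = x ∷ y ∷ []} ndA (λ {a} a∈ → case a ∈? (x ∷ y ∷ []) of λ { (yes p) → p ; (no p) → contradiction (a , a∈ , p) ¬q }))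
              (<⇒≱ (≤-reflexive (sym (trans |A| k≡3))))
        ... | yes (q , q∈ , q∉) = embed (to (here refl)) (to (there (here refl))) (λ { refl → NoDup-head nd′ (here refl) }) q∈ (q∉ ∘ here) (q∉ ∘ there ∘ here) A-only only
          where
          A-only : ∀ {a} → a ∈ A → a ∈ x ∷ y ∷ q ∷ []
          A-only {a} a∈ with a ∈? (x ∷ y ∷ q ∷ [])
          ... | yes p = p
          ... | no p  = contradiction (length-⊆ {ys = A} (NoDup-∷ p (NoDup-⊑ (⊑-by ((x ∷ y ∷ []) ∷ (q ∷ []) ∷ []) (` 0 ⊕ ` 1) (` 1 ⊕ ` 0)) (NoDup-∷ q∉ nd′)))
              (cons a∈ (cons (X⊆A C₁ (to (here refl))) (both (X⊆A C₁ (to (there (here refl)))) q∈))))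
            (<⇒≱ (s≤s (≤-reflexive (trans |A| k≡3))))

  caseI : IntoH G k ⊎ k ≡ 3 × IntoK₂+S∪M G
  caseI with some-alternating
  ... | qs , tl , τ , al with any? (λ u → any? (λ t → ¬? (u ∈? L) ×-dec (¬? (t ∈? L) ×-dec Adj? u t)))
  ...   | yes (u , t , u∉ , t∉ , e) = inj₂ (OffEdge.into-S∪M τ al u∉ t∉ e)
  ...   | no ¬e = inj₁ (into-H τ al (λ u∉ t∉ e → ¬e (_ , _ , u∉ , t∉ , e)))

-- The exceptional vertex and a cycle through it

module _ {n : ℕ} (G : Graph n) where

  open Walks G

  exceptional : ∀ {k} → 3 ≤ n → (∀ u v → u ≢ v → k ≤ degree G u ⊎ k ≤ degree G v) → ∃ λ w → ∀ {v} → v ≢ w → k ≤ degree G v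
  exceptional {k} 3≤n h with any? (λ u → ¬? (k ≤? degree G u))
  ... | yes (w , k≰) = w , λ {v} v≢w → [ id , (λ k≤ → contradiction k≤ k≰) ]′ (h v w v≢w)
  -- If every vertex has degree at least `k`, an arbitrary one is named.
  ... | no all-good = fromℕ< (≤-trans (s≤s z≤n) 3≤n) ,
    λ {v} _ → case k ≤? degree G v of λ { (yes p) → p ; (no ¬p) → contradiction (v , ¬p) all-good }

  module _ (3≤n : 3 ≤ n) (connected : ∀ x u v → u ≢ x → v ≢ x → Walk G (λ t → t ≢ x) u v) where

    third : ∀ (u v : Fin n) → ∃ λ x → x ≢ u × x ≢ v
    third u v = from (complement (u ∷ v ∷ []))
      where
      from : (∀ x → x ∈ u ∷ v ∷ []) ⊎ ∃ (_∉ u ∷ v ∷ []) → ∃ λ x → x ≢ u × x ≢ v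
      from (inj₂ (x , x∉)) = x , x∉ ∘ here , x∉ ∘ there ∘ here
      from (inj₁ full) = contradiction (≤-trans 3≤n (≤-trans (≤-reflexive (sym (length-tabulate id)))
        (length-⊆ (Unique⇒NoDup (allFin⁺ n)) (λ {u} _ → full u)))) λ { (s≤s (s≤s ())) }

    neighbour-avoiding : ∀ {w y} → y ≢ w → ∃ λ x → Adj G w x × x ≢ y
    neighbour-avoiding {w} {y} y≢w = from (third w y)
      where
      first-step : ∀ {v} → Walk G (_≢ y) w v → w ≢ v → ∃ λ x → Adj G w x × x ≢ y
      first-step (here _)                ne = contradiction refl ne
      first-step (step _ a (here p))     ne = _ , a , p
      first-step (step _ a (step p _ _)) ne = _ , a , p
      from : (∃ λ x → x ≢ w × x ≢ y) → ∃ λ x → Adj G w x × x ≢ y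
      from (x , x≢w , x≢y) = first-step (connected y w x (y≢w ∘ sym) x≢y) (x≢w ∘ sym)

    private
      Cycle : Fin n → List (Fin n) → Set
      Cycle w xs = Closed xs × NoDup xs × 3 ≤ length xs × w ∈ xs

      Cycle? : ∀ w xs → Dec (Cycle w xs)
      Cycle? w xs = Closed? xs ×-dec (NoDup? xs ×-dec ((3 ≤? length xs) ×-dec (w ∈? xs)))
        where
        W? : ∀ a xs b → Dec (W a xs b)
        W? a []       b = Adj? a b
        W? a (x ∷ xs) b = Adj? a x ×-dec W? x xs b
        Closed? : ∀ xs → Dec (Closed xs)
        Closed? []       = yes tt
        Closed? (a ∷ xs) = W? a xs a

    -- A walk between the two neighbours that avoids `w` closes up at `w`; `hit`, with an empty set
    -- `T′` and the only target `b`, serves to make it a path.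
    join-neighbours : ∀ {w a b} → Adj G w a → Adj G w b → b ≢ a → ∃ (Cycle w)
    join-neighbours {w} {a} {b} w~a w~b b≢a = from (hit (connected w a b (adj⇒≢ w~a ∘ sym) (adj⇒≢ w~b ∘ sym)) refl (b≢a ∘ sym))
      where
      open Fans G connected []
      is-b? : ∀ u → Dec (u ≡ b)
      is-b? u = u ≟ b
      open Hitting [] w is-b?
      from : Reach a ⊎ (∃ λ t → t ∈ [] × Reach t) → ∃ (Cycle w)
      from (inj₁ (reach ins .b walk refl _ nd avoids)) = w ∷ a ∷ ins ++ b ∷ [] , (w~a , W-++ ins walk (adj-sym w~b)) ,
        NoDup-∷ w∉ (NoDup-++ nd NoDup-[x] (λ { (here e) (here refl) → b≢a e ; (there y∈) (here refl) → proj₁ (proj₂ (avoids y∈)) refl })) ,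
        s≤s (s≤s (subst (1 ≤_) (sym (length-++ ins)) (m≤n+m 1 (length ins)))) , here refl
        where
        w∉ : w ∉ a ∷ ins ++ b ∷ []
        w∉ (here e) = adj⇒≢ w~a e
        w∉ (there p) = [ (λ q → proj₂ (proj₂ (avoids q)) refl) , (λ { (here e) → adj⇒≢ w~b e }) ]′ (∈-++⁻ ins p)

    cycle-through : ∀ w → ∃ (Cycle w)
    cycle-through w = step₁ (third w w)
      where
      step₂ : (∃ λ a → Adj G w a) → ∃ (Cycle w)
      step₂ (a , w~a) = let (b , w~b , b≢a) = neighbour-avoiding (adj⇒≢ w~a ∘ sym) in join-neighbours w~a w~b b≢a
      step₁ : (∃ λ x → x ≢ w × x ≢ w) → ∃ (Cycle w)
      step₁ (x , x≢w , _) = let (a , w~a , _) = neighbour-avoiding x≢w in step₂ (a , w~a)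

    longest-through : ∀ w → ∃ (Longest G w)
    longest-through w = from (longest (Cycle? w) nodup-of (proj₂ (cycle-through w)))
      where
      nodup-of : ∀ {xs} → Cycle w xs → NoDup xs
      nodup-of (_ , nd , _) = nd
      from : (∃ λ L → Cycle w L × (∀ {zs} → Cycle w zs → length zs ≤ length L)) → ∃ (Longest G w)
      from (L , (c , nd , 3≤ , w∈) , mx) = L , record
        { closed = c ; nd = nd ; 3≤ = 3≤ ; w∈ = w∈ ; maximal = λ a b d e → mx (a , b , d , e) }

-- The case distinction

module _ {n : ℕ} {G : Graph n} {k : ℕ} {w : Fin n} (setting : Setting G k w) {L : List (Fin n)} (longest-L : Longest G w L) where

  open Outside setting longest-L
  open Common setting longest-L

  comp-size : ∀ {v v′} (c : Comp v) (c′ : Comp v′) → v′ ∈ Comp.D c → length (Comp.D c) ≡ length (Comp.D c′)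
  comp-size c c′ v′∈ = ≤-antisym (length-⊆ (Comp.ndD c) (comp-≡ c c′ v′∈ (Comp.v∈D c′)))
    (length-⊆ (Comp.ndD c′) (comp-≡ c′ c (Comp.v∈D c′) v′∈))

  -- A vertex may have several `Comp` records, but they agree in size by `comp-size`, so it is
  -- enough to inspect the one given by `comp`.
  component-of-size? : ∀ m → (∃ λ v → Σ (Comp v) λ c → length (Comp.D c) ≡ m) ⊎ (∀ {v} (c : Comp v) → length (Comp.D c) ≢ m)
  component-of-size? m with any? (λ v → sized? v)
    where
    Sized : Fin n → Set
    Sized v = Σ (v ∉ L) λ v∉ → length (Comp.D (comp v v∉)) ≡ m
    sized? : ∀ v → Dec (Sized v)
    sized? v with v ∈? L
    ... | yes v∈ = no λ (v∉ , _) → v∉ v∈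
    ... | no v∉ with length (Comp.D (comp v v∉)) Data.Nat.≟ m
    ...   | yes e = yes (v∉ , e)
    ...   | no ne = no λ (v∉′ , e) → ne (trans (comp-size (comp v v∉) (comp v v∉′) (Comp.v∈D (comp v v∉))) e)
  ... | yes (v , v∉ , e) = inj₁ (v , comp v v∉ , e)
  ... | no ¬s = inj₂ λ {v} c e → let v∉ = Comp.D∥L c (Comp.v∈D c) in
        ¬s (v , v∉ , trans (comp-size (comp v v∉) c (Comp.v∈D (comp v v∉))) e)

  into-K₃+M : ∀ {v} (c : Comp v) → k ≡ 4 → length (Comp.D c) ≡ 2 → ∃ λ t → 7 ≤ t × G ⊆ (K 3 ⊹ M t)
  into-K₃+M c refl |D|≡2 = CaseIII.caseIII setting longest-L c
    (+-cancelʳ-≡ 2 (length (Comp.X c)) 3 (trans (cong (length (Comp.X c) +_) (sym |D|≡2)) (Comp.size c))) |D|≡2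

  private
    pairs : ∃ (_∉ L) → (∀ {v} (c : Comp v) → length (Comp.X c) ≡ 2) → G ⊆ Fgraph n n k ⊎ G ⊆ F₁ n k
    pairs (v , v∉) |X|≡2 = CaseII.caseII setting longest-L |X|≡2 (comp v v∉)

    -- The third alternative of `shape` forces `k ≡ 4` by `size`. Treating it first leaves every
    -- component with two neighbours or one vertex, which the one-vertex case relies on.
    edges : k ≡ 4 × (Σ ℕ λ t → 7 ≤ t × G ⊆ (K 3 ⊹ M t)) ⊎ (∀ {v} (c : Comp v) → length (Comp.X c) ≡ 2 ⊎ length (Comp.D c) ≡ 1)
    edges with k Data.Nat.≟ 4 | component-of-size? 2
    ... | yes k≡4 | inj₁ (v , c , |D|≡2) = inj₁ (k≡4 , into-K₃+M c k≡4 |D|≡2)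
    ... | _ | inj₂ absent = inj₂ λ c → Data.Sum.map₂ [ id , (λ (_ , |D|≡2) → contradiction |D|≡2 (absent c)) ]′ (Comp.shape c)
    ... | no k≢4 | _ = inj₂ λ c → Data.Sum.map₂ [ id , (λ (|X|≡3 , |D|≡2) →
            contradiction (suc-injective (trans (sym (Comp.size c)) (cong₂ _+_ |X|≡3 |D|≡2))) k≢4) ]′ (Comp.shape c)

    singletons : (∀ {v} (c : Comp v) → length (Comp.X c) ≡ 2 ⊎ length (Comp.D c) ≡ 1) →
      (IntoH G k ⊎ k ≡ 3 × IntoK₂+S∪M G) ⊎ (∀ {v} (c : Comp v) → length (Comp.X c) ≡ 2)
    singletons shape with 3 ≤? k | component-of-size? 1
    ... | yes 3≤k | inj₁ (v , c , |D|≡1) = inj₁ (CaseI.caseI setting longest-L 3≤k shape c |D|≡1)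
    ... | _ | inj₂ absent = inj₂ λ c → [ id , (λ |D|≡1 → contradiction |D|≡1 (absent c)) ]′ (shape c)
    -- For `k = 2` a one-vertex component has only two neighbours, so it belongs to the other case.
    ... | no 3≰k | _ = inj₂ λ c → [ id , (λ |D|≡1 → trans (+-cancelʳ-≡ 1 (length (Comp.X c)) k
            (trans (cong (length (Comp.X c) +_) (sym |D|≡1)) (trans (Comp.size c) (+-comm 1 k))))
            (≤-antisym (s≤s⁻¹ (≰⇒> 3≰k)) (Setting.2≤k setting))) ]′ (shape c)

  classification : ∃ (_∉ L) → (k ≡ 4 × (Σ ℕ λ t → 7 ≤ t × G ⊆ (K 3 ⊹ M t))) ⊎ (IntoH G k ⊎ k ≡ 3 × IntoK₂+S∪M G) ⊎
    (G ⊆ Fgraph n n k ⊎ G ⊆ F₁ n k)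
  classification v∉ with edges
  ... | inj₁ four = inj₁ four
  ... | inj₂ shape with singletons shape
  ...   | inj₁ p     = inj₂ (inj₁ p)
  ...   | inj₂ |X|≡2 = inj₂ (inj₂ (pairs v∉ |X|≡2))

theorem1p6 : (k n : ℕ) (G : Graph n) →
    2 ≤ k →
    TwoConnected G →
    ¬ Hamiltonian G →
    CircumferenceAtMost G (2 * k + 1) →
    (∀ u v → u ≢ v → k ≤ degree G u ⊎ k ≤ degree G v) →
    ((n ≡ 2 * k + 1 × G ⊆ Hgraph (2 * k + 1) (2 * k + 1) k)
    ⊎ (2 * k + 2 ≤ n × G ⊆ Hgraph n (2 * k + 2) k))
    ⊎ ((Σ ℕ λ s → Σ ℕ λ t → 1 ≤ s × 1 ≤ t × G ⊆ Fgraph s t k)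
    ⊎ (Σ ℕ λ t → 1 ≤ t × G ⊆ F₁ t k))
    ⊎ ((k ≡ 3 ×
    ((Σ ℕ λ t → 6 ≤ t × G ⊆ (K 2 ⊹ M t))
    ⊎ (Σ ℕ λ s → Σ ℕ λ t → 1 ≤ s × 6 ≤ s + t × G ⊆ (K 2 ⊹ (S s ∪ M t)))))
    ⊎ (k ≡ 4 × (Σ ℕ λ t → 7 ≤ t × G ⊆ (K 3 ⊹ M t))))
theorem1p6 k n G 2≤k (3≤n , _ , connected) ¬ham circ degrees with exceptional G 3≤n degrees
... | w , good = conclude (longest-through G 3≤n connected w)
  where
  open Walks G
  setting : Setting G k w
  setting = record
    { 2≤k = 2≤k ; connected = connected ; good = good
    ; circumference = λ {xs} c nd 3≤ → circ (length xs) (Closed⇒HasCycle xs c nd 3≤) }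
  1≤n : 1 ≤ n
  1≤n = ≤-trans (s≤s z≤n) 3≤n
  outside : ∀ {L} → Longest G w L → ∃ (_∉ L)
  outside {L} longest-L with complement L
  ... | inj₂ p = p
  ... | inj₁ full = contradiction (subst (HasCycle G) (full⇒length nd full) (Closed⇒HasCycle L closed nd 3≤)) ¬ham
    where open Longest longest-L
  conclude : ∃ (Longest G w) → _
  conclude (L , longest-L) with classification setting longest-L (outside longest-L)
  ... | inj₁ four                            = inj₂ (inj₂ (inj₂ four))
  ... | inj₂ (inj₁ (inj₁ h))                 = inj₁ h
  ... | inj₂ (inj₁ (inj₂ (k≡3 , s∪m)))       = inj₂ (inj₂ (inj₁ (k≡3 , inj₂ s∪m)))
  -- The cliques on either side are indexed by labels, which are vertices; hence `s = t = n`.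
  ... | inj₂ (inj₂ (inj₁ f))                 = inj₂ (inj₁ (inj₁ (n , n , 1≤n , 1≤n , f)))
  ... | inj₂ (inj₂ (inj₂ f))                 = inj₂ (inj₁ (inj₂ (n , 1≤n , f)))
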